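{- Let $G$ be a bridgeless bipartite graph that is not $2$-simultaneous edge colorable, chosen so that $|E(G)|$ is minimum among all bridgeless bipartite graphs that are not $2$-simultaneous edge colorable, and, subject to this, $|V(G)|$ is maximum. Then: (i) $G$ is $2$-connected; (ii) $\delta(G)=2$ and $\Delta(G)=3$; (iii) $G$ has no nontrivial edge cut of size $2$; (iv) for each vertex $v$ with $\deg(v)=2$, the graph $G-v$ is bridgeless; (v) for each vertex $v$ with $N(v)=\{u,w\}$, we have $N(u)\cap N(w)=\{v\}$.
   Context: All graphs are finite and simple; $[l]=\{1,\ldots,l\}$. For a nonempty proper subset $S\subset V(G)$, the edge cut $[S,\overline S]$ is the set of edges with one end in $S$ and one in $V(G)\setminus S$; the edge connectivity $\kappa'(G)$ is the minimum size of an edge cut, and "bridgeless" means $2$-edge-connected, i.e. $\kappa'(G)\ge 2$ (in particular connected). An edge cut $F$ is trivial if some component of $G\setminus F$ is an isolated vertex. A $2$-simultaneous edge coloring of $G$ is a pair $(c_1,c_2)$ of proper edge colorings $c_i:E(G)\to[l]$ with a common color set such that for every vertex $v$ the sets of colors on edges incident to $v$ are the same under $c_1$ and $c_2$, and $c_1(e)\ne c_2(e)$ for every edge $e$; $G$ is $2$-simultaneous edge colorable if such a pair exists for some $l$. $\delta,\Delta$ denote minimum and maximum degree, $N(v)$ the neighbourhood of $v$. -}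

module Defs where

open import Data.Nat using (ℕ; zero; suc; pred; _+_; _≤_; _<ᵇ_)
open import Data.Fin using (Fin; toℕ; punchIn)
open import Data.Bool using (Bool; true; false; if_then_else_; _∧_; not)
open import Data.Product using (Σ; ∃; ∃-syntax; _×_; _,_)
open import Data.Sum using (_⊎_)
open import Relation.Binary.PropositionalEquality using (_≡_; _≢_)
open import Relation.Nullary using (¬_)

record SimpleGraph : Set where
  field
    n          : ℕ
    adj        : Fin n → Fin n → Bool
    adj-sym    : ∀ u v → adj u v ≡ adj v u
    adj-irrefl : ∀ v → adj v v ≡ false
open SimpleGraph public

sumFin : ∀ m → (Fin m → ℕ) → ℕ
sumFin zero    f = 0
sumFin (suc m) f = f Fin.zero + sumFin m (λ i → f (Fin.suc i))

b2n : Bool → ℕ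
b2n true  = 1
b2n false = 0

degree : (G : SimpleGraph) → Fin (n G) → ℕ
degree G v = sumFin (n G) (λ u → b2n (adj G v u))

numEdges : (G : SimpleGraph) → ℕ
numEdges G = sumFin (n G) (λ u → sumFin (n G) (λ v → b2n (adj G u v ∧ (toℕ u <ᵇ toℕ v))))

punchIn' : ∀ {m} → Fin m → Fin (pred m) → Fin m
punchIn' {suc k} v i = punchIn v i

delete : (G : SimpleGraph) → Fin (n G) → SimpleGraph
delete G v = record
  { n          = pred (n G)
  ; adj        = λ i j → adj G (punchIn' v i) (punchIn' v j)
  ; adj-sym    = λ i j → adj-sym G (punchIn' v i) (punchIn' v j)
  ; adj-irrefl = λ i → adj-irrefl G (punchIn' v i)
  }

data Reach (G : SimpleGraph) : Fin (n G) → Fin (n G) → Set where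
  here : ∀ {u} → Reach G u u
  step : ∀ {u v w} → adj G u v ≡ true → Reach G v w → Reach G u w

Connected : SimpleGraph → Set
Connected G = ∀ u v → Reach G u v

TwoConnected : SimpleGraph → Set
TwoConnected G = 3 ≤ n G × Connected G × (∀ v → Connected (delete G v))

Bipartite : SimpleGraph → Set
Bipartite G = Σ (Fin (n G) → Bool) λ side → (∀ u v → adj G u v ≡ true → side u ≢ side v)

Subset : SimpleGraph → Set
Subset G = Fin (n G) → Bool

NonemptyProper : (G : SimpleGraph) → Subset G → Set
NonemptyProper G S = (∃[ v ] S v ≡ true) × (∃[ v ] S v ≡ false)

cutSize : (G : SimpleGraph) → Subset G → ℕ
cutSize G S = sumFin (n G) (λ u → sumFin (n G) (λ v →
  b2n (adj G u v ∧ (S u ∧ not (S v)))))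

-- Bridgeless: κ'(G) ≥ 2, i.e. every edge cut has at least 2 edges
Bridgeless : SimpleGraph → Set
Bridgeless G = ∀ S → NonemptyProper G S → 2 ≤ cutSize G S

-- The edge cut [S, S̄] is trivial: some component of G - [S, S̄] is an
-- isolated vertex, i.e. some vertex v has all its incident edges in the cut.
TrivialCut : (G : SimpleGraph) → Subset G → Set
TrivialCut G S = ∃[ v ] (∀ u → adj G v u ≡ true → S u ≡ not (S v))

-- Proper edge colouring, with colourings represented as functions on ordered
-- pairs whose values on edges are symmetric (values on non-edges irrelevant).
ProperEdgeColoring : (G : SimpleGraph) (l : ℕ) → (Fin (n G) → Fin (n G) → Fin l) → Set
ProperEdgeColoring G l c =
  (∀ u v → adj G u v ≡ true → c u v ≡ c v u) ×
  (∀ u v w → adj G u v ≡ true → adj G u w ≡ true → v ≢ w → c u v ≢ c u w)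

ColorAt : (G : SimpleGraph) {l : ℕ} → (Fin (n G) → Fin (n G) → Fin l) → Fin (n G) → Fin l → Set
ColorAt G c v k = ∃[ u ] (adj G v u ≡ true × c v u ≡ k)

TwoSimultaneousEdgeColorable : SimpleGraph → Set
TwoSimultaneousEdgeColorable G =
  ∃[ l ] Σ (Fin (n G) → Fin (n G) → Fin l) λ c₁ → Σ (Fin (n G) → Fin (n G) → Fin l) λ c₂ →
    ProperEdgeColoring G l c₁ × ProperEdgeColoring G l c₂ ×
    (∀ v k → (ColorAt G c₁ v k → ColorAt G c₂ v k) × (ColorAt G c₂ v k → ColorAt G c₁ v k)) ×
    (∀ u v → adj G u v ≡ true → c₁ u v ≢ c₂ u v)

Counterexample : SimpleGraph → Set
Counterexample G = Bipartite G × Bridgeless G × ¬ TwoSimultaneousEdgeColorable G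

MinimalCounterexample : SimpleGraph → Set
MinimalCounterexample G =
  Counterexample G ×
  (∀ H → Counterexample H → numEdges G ≤ numEdges H) ×
  (∀ H → Counterexample H → numEdges H ≡ numEdges G → n H ≤ n G)

{-# OPTIONS --safe #-}
module Submission where

-- In a bipartite graph a pair (c₁ , c₂) amounts to a colouring of the arcs: traverse an edge with
-- colour c₁ from the true side and with colour c₂ in the other direction.  Every colour class is then a
-- union of disjoint directed cycles, so that a simultaneous colouring is an oriented cycle double cover.
-- Conversely it suffices that each colour class enters and leaves every vertex equally often and that no
-- edge has the same colour in both directions ("good"): permutations can be extracted from the classes one
-- after another.  Goodness, unlike properness, survives identifying vertices and gluing along small cuts,
-- and every claim about the minimal counterexample becomes a reduction to smaller good graphs.  Blocks at
-- a cut vertex are glued by a disjoint union, the sides of a 2-cut along a pair of colours; at a vertex of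
-- degree at least 4, Fleischner's lemma splits off two edges without creating a bridge, which increases the
-- number of vertices; regular graphs are coloured by König's theorem.

-- Minimality says only that a smaller graph is not uncolourable, so every reduction delivers
-- `¬ ¬ Good`. This suffices: each claim is proved by refuting its failure, and cut sizes and
-- searches over `Fin` are decidable. The reductions must stay simple and bipartite, which shapes
-- the treatment of a 2-cut. Let `a` and `c` be the ends of the cut edges in one side. Contracting
-- the other side to a vertex keeps the graph bipartite only if `a` and `c` lie in the same class;
-- otherwise an edge `a c` must replace it, and that edge may already be there. `HalfGood` unifies
-- these cases: it colours one side together with an invisible path for whatever has been removed,
-- and two such colourings fit together. A parallel edge is imitated by recolouring one arc of the
-- existing edge. The same device yields (v). If the neighbours `u` and `w` of a vertex `v` of
-- degree two had a further common neighbour `x`, then in a good colouring of G - v some colour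
-- would run along `u x w` or back, because `x` has degree at most 3; recolouring these two arcs
-- makes room for `v`.

open import Defs
open import Data.Nat as ℕ using (ℕ; zero; suc; _+_; _*_; _≤_; _<_; z≤n; s≤s)
open import Data.Nat.Properties
open import Data.Nat.Tactic.RingSolver using (solve-∀)
open import Data.Fin as Fin using (Fin; zero; suc; toℕ; punchIn; punchOut)
open import Data.Fin.Properties as Finₚ using (any?; all?)
open import Data.Bool using (Bool; true; false; if_then_else_; _∧_; _∨_; not; _xor_)
open import Data.Bool.Properties as Boolₚ using (∧-comm; not-involutive; ¬-not; not-¬)
open import Data.Empty using (⊥; ⊥-elim)
open import Data.Product using (Σ; ∃; ∃-syntax; _×_; _,_; proj₁; proj₂)
open import Data.Sum using (_⊎_; inj₁; inj₂; [_,_]′)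
open import Data.Maybe using (Maybe; just; nothing)
open import Data.Maybe.Properties as Maybeₚ using (just-injective)
open import Data.Sum.Properties as Sumₚ using (inj₁-injective; inj₂-injective)
open import Function using (_∘_; flip; const)
open import Relation.Binary using (DecidableEquality; tri<; tri≈; tri>)
open import Relation.Binary.PropositionalEquality
open import Relation.Nullary using (¬_; Dec; yes; no; does; contradiction)
open import Relation.Nullary.Decidable using (dec-true; dec-false; _×-dec_; ¬?; decidable-stable)

-- Sums over Fin

sum-cong : ∀ {m} {f g : Fin m → ℕ} → (∀ i → f i ≡ g i) → sumFin m f ≡ sumFin m g
sum-cong {zero}  e = refl
sum-cong {suc m} e = cong₂ _+_ (e zero) (sum-cong (e ∘ suc))

sum-mono : ∀ {m} {f g : Fin m → ℕ} → (∀ i → f i ≤ g i) → sumFin m f ≤ sumFin m g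
sum-mono {zero}  e = z≤n
sum-mono {suc m} e = +-mono-≤ (e zero) (sum-mono (e ∘ suc))

sum-zero : ∀ m → sumFin m (const 0) ≡ 0
sum-zero zero    = refl
sum-zero (suc m) = sum-zero m

interchange : ∀ a b c d → (a + b) + (c + d) ≡ (a + c) + (b + d)
interchange = solve-∀

sum-+ : ∀ {m} (f g : Fin m → ℕ) → sumFin m (λ i → f i + g i) ≡ sumFin m f + sumFin m g
sum-+ {zero}  f g = refl
sum-+ {suc m} f g = begin
  f zero + g zero + sumFin m (λ i → f (suc i) + g (suc i))
    ≡⟨ cong (f zero + g zero +_) (sum-+ (f ∘ suc) (g ∘ suc)) ⟩
  f zero + g zero + (sumFin m (f ∘ suc) + sumFin m (g ∘ suc))
    ≡⟨ interchange (f zero) (g zero) _ _ ⟩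
  f zero + sumFin m (f ∘ suc) + (g zero + sumFin m (g ∘ suc)) ∎
  where open ≡-Reasoning

sum-swap : ∀ {m k} (F : Fin m → Fin k → ℕ) →
  sumFin m (λ i → sumFin k (F i)) ≡ sumFin k (λ j → sumFin m (λ i → F i j))
sum-swap {zero}  {k} F = sym (sum-zero k)
sum-swap {suc m} F = trans (cong (sumFin _ (F zero) +_) (sum-swap (F ∘ suc))) (sym (sum-+ (F zero) _))

sum-punchIn : ∀ {m} (f : Fin (suc m) → ℕ) v → sumFin (suc m) f ≡ f v + sumFin m (f ∘ punchIn v)
sum-punchIn f zero = refl
sum-punchIn {suc m} f (suc v) = begin
  f zero + sumFin (suc m) (f ∘ suc) ≡⟨ cong (f zero +_) (sum-punchIn (f ∘ suc) v) ⟩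
  f zero + (f (suc v) + rest)       ≡⟨ +-assoc (f zero) _ _ ⟨
  f zero + f (suc v) + rest         ≡⟨ cong (_+ rest) (+-comm (f zero) _) ⟩
  f (suc v) + f zero + rest         ≡⟨ +-assoc (f (suc v)) _ _ ⟩
  f (suc v) + (f zero + rest)       ∎
  where
    open ≡-Reasoning
    rest = sumFin m (f ∘ suc ∘ punchIn v)

term≤sum : ∀ {m} (f : Fin m → ℕ) v → f v ≤ sumFin m f
term≤sum f zero    = m≤m+n _ _
term≤sum f (suc v) = ≤-trans (term≤sum (f ∘ suc) v) (m≤n+m _ _)

two-terms≤sum : ∀ {m} (f : Fin m → ℕ) {u v} → u ≢ v → f u + f v ≤ sumFin m f
two-terms≤sum f {zero}  {zero}  u≢v = contradiction refl u≢v
two-terms≤sum f {zero}  {suc v} u≢v = +-monoʳ-≤ (f zero) (term≤sum (f ∘ suc) v)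
two-terms≤sum f {suc u} {zero}  u≢v =
  ≤-trans (≤-reflexive (+-comm (f (suc u)) _)) (+-monoʳ-≤ (f zero) (term≤sum (f ∘ suc) u))
two-terms≤sum f {suc u} {suc v} u≢v = ≤-trans (two-terms≤sum (f ∘ suc) (u≢v ∘ cong suc)) (m≤n+m _ _)

sum-positive : ∀ {m} (f : Fin m → ℕ) → 1 ≤ sumFin m f → ∃[ i ] 1 ≤ f i
sum-positive {suc m} f p with f zero in e
... | suc k = zero , subst (1 ≤_) (sym e) (s≤s z≤n)
... | zero with sum-positive (f ∘ suc) p
...   | i , q = suc i , q

+-split-≡ : ∀ {a b c d} → a ≤ c → b ≤ d → a + b ≡ c + d → a ≡ c × b ≡ d
+-split-≡ {a} {b} {c} {d} a≤c b≤d e = a≡c , +-cancelˡ-≡ c b d (subst (λ x → x + b ≡ c + d) a≡c e)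
  where
    c≤a : c ≤ a
    c≤a = +-cancelʳ-≤ d c a (≤-trans (≤-reflexive (sym e)) (+-monoʳ-≤ a b≤d))
    a≡c = ≤-antisym a≤c c≤a

sum-tight : ∀ {m} {f g : Fin m → ℕ} → (∀ i → f i ≤ g i) → sumFin m f ≡ sumFin m g → ∀ i → f i ≡ g i
sum-tight {suc m} le e zero    = proj₁ (+-split-≡ (le zero) (sum-mono (le ∘ suc)) e)
sum-tight {suc m} le e (suc i) =
  sum-tight (le ∘ suc) (proj₂ (+-split-≡ (le zero) (sum-mono (le ∘ suc)) e)) i

-- Boolean matrices as arc sets

infix 6 _==_
_==_ : ∀ {m} → Fin m → Fin m → Bool
u == v = does (u Fin.≟ v)

==-refl : ∀ {m} (u : Fin m) → (u == u) ≡ true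
==-refl u = dec-true (u Fin.≟ u) refl

==-≡ : ∀ {m} {u v : Fin m} → u ≡ v → (u == v) ≡ true
==-≡ {u = u} refl = ==-refl u

==-≢ : ∀ {m} {u v : Fin m} → u ≢ v → (u == v) ≡ false
==-≢ {u = u} {v} = dec-false (u Fin.≟ v)

==-sound : ∀ {m} {u v : Fin m} → (u == v) ≡ true → u ≡ v
==-sound {u = u} {v} e with u Fin.≟ v
... | yes p = p

true≢false : {b : Bool} → b ≡ true → b ≡ false → ⊥
true≢false refl ()

∧-true : ∀ {a b} → a ∧ b ≡ true → a ≡ true × b ≡ true
∧-true {true} {true} _ = refl , refl

∧-intro : ∀ {a b} → a ≡ true → b ≡ true → a ∧ b ≡ true
∧-intro refl refl = refl

not-true : ∀ {a} → not a ≡ true → a ≡ false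
not-true {false} _ = refl

not-false : ∀ {a} → a ≡ false → not a ≡ true
not-false refl = refl

infixr 7 _▹_
_▹_ : Bool → ℕ → ℕ
true  ▹ m = m
false ▹ m = 0

▹-one : ∀ b → b ▹ 1 ≡ b2n b
▹-one true  = refl
▹-one false = refl

▹-cong : ∀ b {x y} → (b ≡ true → x ≡ y) → b ▹ x ≡ b ▹ y
▹-cong true  e = e refl
▹-cong false e = refl

▹-split : ∀ {z x y} m → b2n z ≡ b2n x + b2n y → z ▹ m ≡ x ▹ m + y ▹ m
▹-split {true}  {true}  {false} m e = sym (+-identityʳ m)
▹-split {true}  {false} {true}  m e = refl
▹-split {false} {false} {false} m e = refl

sum-pick : ∀ {m} (b : Fin m) (x : Fin m → ℕ) → sumFin m (λ t → (t == b) ▹ x t) ≡ x b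
sum-pick {suc m} zero x = begin
  x zero + sumFin m (λ t → (suc t == zero) ▹ x (suc t)) ≡⟨ cong (x zero +_) (sum-zero m) ⟩
  x zero + 0                                            ≡⟨ +-identityʳ _ ⟩
  x zero                                                ∎
  where open ≡-Reasoning
sum-pick {suc m} (suc b) x = sum-pick b (x ∘ suc)

sum-▹ : ∀ {m} b (x : Fin m → ℕ) → sumFin m (λ t → b ▹ x t) ≡ b ▹ sumFin m x
sum-▹ true  x = refl
sum-▹ {m} false x = sum-zero m

Matrix : ℕ → Set
Matrix m = Fin m → Fin m → Bool

Symmetric : ∀ {m} → Matrix m → Set
Symmetric A = ∀ s t → A s t ≡ A t s

Irreflexive : ∀ {m} → Matrix m → Set
Irreflexive A = ∀ s → A s s ≡ false

infix 4 _⊆_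
_⊆_ : ∀ {m} → Matrix m → Matrix m → Set
A ⊆ B = ∀ s t → A s t ≡ true → B s t ≡ true

infix 4 _≐_⊕_
-- Disjoint union is stated as an equation in ℕ: the left side is at most one, which encodes
-- disjointness, and summing the equation makes `out` and `total` additive.
record _≐_⊕_ {m} (Z X Y : Matrix m) : Set where
  constructor disjoint
  field split : ∀ s t → b2n (Z s t) ≡ b2n (X s t) + b2n (Y s t)

open _≐_⊕_

⊕-flip : ∀ {m} {X Y Z : Matrix m} → Z ≐ X ⊕ Y → flip Z ≐ flip X ⊕ flip Y
⊕-flip d = disjoint (λ s t → split d t s)

infixl 6 _∖_
_∖_ : ∀ {m} → Matrix m → Matrix m → Matrix m
(X ∖ Y) s t = X s t ∧ not (Y s t)

∖-⊕ : ∀ {m} {X Y : Matrix m} → Y ⊆ X → X ≐ X ∖ Y ⊕ Y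
∖-⊕ {X = X} {Y} Y⊆X = disjoint λ s t → lemma (X s t) (Y s t) (Y⊆X s t)
  where
    lemma : ∀ x y → (y ≡ true → x ≡ true) → b2n x ≡ b2n (x ∧ not y) + b2n y
    lemma true  true  _ = refl
    lemma true  false _ = refl
    lemma false false _ = refl
    lemma false true  f with () ← f refl

b2n-mono : ∀ {a b} → (a ≡ true → b ≡ true) → b2n a ≤ b2n b
b2n-mono {false} f = z≤n
b2n-mono {true}  f = ≤-reflexive (cong b2n (sym (f refl)))

▹-∧ : ∀ a b m → (a ∧ b) ▹ m ≡ a ▹ b ▹ m
▹-∧ true  b m = refl
▹-∧ false b m = refl

opaque
  δ : ∀ {m} → Fin m → Fin m → Matrix m
  δ a b s t = (s == a) ∧ (t == b)

  out : ∀ {m} → Matrix m → (Fin m → Fin m → ℕ) → Fin m → ℕ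
  out {m} X w s = sumFin m (λ t → X s t ▹ w s t)

  total : ∀ {m} → Matrix m → ℕ
  total {m} X = sumFin m (λ s → sumFin m (λ t → b2n (X s t)))

  δ-sound : ∀ {m} (a b s t : Fin m) → δ a b s t ≡ true → s ≡ a × t ≡ b
  δ-sound a b s t e = let p , q = ∧-true e in ==-sound p , ==-sound q

  δ-refl : ∀ {m} (a b : Fin m) → δ a b a b ≡ true
  δ-refl a b = ∧-intro (==-refl a) (==-refl b)

  δ-flip : ∀ {m} (a b s t : Fin m) → δ a b t s ≡ δ b a s t
  δ-flip a b s t = ∧-comm (t == a) (s == b)

  out-def : ∀ {m} (X : Matrix m) w s → out X w s ≡ sumFin m (λ t → X s t ▹ w s t)
  out-def X w s = refl

  total-out : ∀ {m} (X : Matrix m) → total X ≡ sumFin m (out X (λ _ _ → 1))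
  total-out {m} X = sum-cong {m} (λ s → sum-cong {m} (λ t → sym (▹-one (X s t))))

  out-cong : ∀ {m} (X : Matrix m) {w w′ : Fin m → Fin m → ℕ} s →
    (∀ t → X s t ≡ true → w s t ≡ w′ s t) → out X w s ≡ out X w′ s
  out-cong {m} X s e = sum-cong {m} (λ t → ▹-cong (X s t) (e t))

  out-mask-cong : ∀ {m} {X Y : Matrix m} w s → (∀ t → X s t ≡ Y s t) → out X w s ≡ out Y w s
  out-mask-cong {m} w s e = sum-cong {m} (λ t → cong (_▹ w s t) (e t))

  out-⊕ : ∀ {m} {X Y Z : Matrix m} → Z ≐ X ⊕ Y → ∀ w s → out Z w s ≡ out X w s + out Y w s
  out-⊕ {m} {X} {Y} {Z} d w s =
    trans (sum-cong {m} (λ t → ▹-split {Z s t} {X s t} {Y s t} (w s t) (split d s t))) (sum-+ {m} _ _)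

  total-⊕ : ∀ {m} {X Y Z : Matrix m} → Z ≐ X ⊕ Y → total Z ≡ total X + total Y
  total-⊕ {m} d =
    trans (sum-cong {m} (λ s → trans (sum-cong {m} (split d s)) (sum-+ {m} _ _))) (sum-+ {m} _ _)

  out-δ : ∀ {m} (a b : Fin m) w s → out (δ a b) w s ≡ (s == a) ▹ w a b
  out-δ {m} a b w s = begin
    sumFin m (λ t → ((s == a) ∧ (t == b)) ▹ w s t) ≡⟨ sum-cong {m} (λ t → ▹-∧ (s == a) (t == b) (w s t)) ⟩
    sumFin m (λ t → (s == a) ▹ (t == b) ▹ w s t)   ≡⟨ sum-▹ {m} (s == a) _ ⟩
    (s == a) ▹ sumFin m (λ t → (t == b) ▹ w s t)   ≡⟨ cong ((s == a) ▹_) (sum-pick {m} b (w s)) ⟩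
    (s == a) ▹ w s b                               ≡⟨ ▹-cong (s == a) (λ e → cong (λ x → w x b) (==-sound e)) ⟩
    (s == a) ▹ w a b                               ∎
    where open ≡-Reasoning

  total-mono : ∀ {m} {X Y : Matrix m} → X ⊆ Y → total X ≤ total Y
  total-mono {m} X⊆Y = sum-mono {m} (λ s → sum-mono {m} (λ t → b2n-mono (X⊆Y s t)))

  total-flip : ∀ {m} (X : Matrix m) → total (flip X) ≡ total X
  total-flip {m} X = sum-swap {m} {m} _

  total-positive : ∀ {m} (X : Matrix m) → 1 ≤ total X → ∃[ s ] ∃[ t ] X s t ≡ true
  total-positive {m} X p with sum-positive {m} _ p
  ... | s , q with sum-positive {m} _ q
  ...   | t , r with X s t in e
  ...     | true = s , t , e

in-δ : ∀ {m} (a b : Fin m) w s → out (flip (δ a b)) (flip w) s ≡ (s == b) ▹ w a b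
in-δ a b w s = trans (out-mask-cong (flip w) s (δ-flip a b s)) (out-δ b a (flip w) s)

total-cong : ∀ {m} {X Y : Matrix m} → (∀ s t → X s t ≡ Y s t) → total X ≡ total Y
total-cong e = ≤-antisym (total-mono (λ s t p → trans (sym (e s t)) p)) (total-mono (λ s t p → trans (e s t) p))

total-δ : ∀ {m} (a b : Fin m) → total (δ a b) ≡ 1
total-δ {m} a b = trans (total-out (δ a b)) (trans (sum-cong {m} (out-δ a b _)) (sum-pick {m} a _))

δ⊆ : ∀ {m} (X : Matrix m) {a b} → X a b ≡ true → δ a b ⊆ X
δ⊆ X {a} {b} e s t d with δ-sound a b s t d
... | refl , refl = e

total-remove : ∀ {m} (X : Matrix m) {a b} → X a b ≡ true → total X ≡ suc (total (X ∖ δ a b))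
total-remove X {a} {b} e = begin
  total X                           ≡⟨ total-⊕ (∖-⊕ (δ⊆ X e)) ⟩
  total (X ∖ δ a b) + total (δ a b) ≡⟨ cong (total (X ∖ δ a b) +_) (total-δ a b) ⟩
  total (X ∖ δ a b) + 1             ≡⟨ +-comm _ 1 ⟩
  suc (total (X ∖ δ a b))           ∎
  where open ≡-Reasoning

total-nonempty : ∀ {m} (X : Matrix m) {a b} → X a b ≡ true → 1 ≤ total X
total-nonempty X e = subst (1 ≤_) (sym (total-remove X e)) (s≤s z≤n)

pairs-distinct : ∀ {m} {a b c d : Fin m} → ¬ (c ≡ a × d ≡ b) → δ a b c d ≡ false
pairs-distinct {a = a} {b} {c} {d} ne with δ a b c d in e
... | false = refl
... | true  = contradiction (δ-sound a b c d e) ne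

∖-intro : ∀ {m} (X : Matrix m) {a b c d} → X c d ≡ true → ¬ (c ≡ a × d ≡ b) → (X ∖ δ a b) c d ≡ true
∖-intro X p ne = ∧-intro p (not-false (pairs-distinct ne))

∖-elim : ∀ {m} (X : Matrix m) {a b c d} → (X ∖ δ a b) c d ≡ true → X c d ≡ true × ¬ (c ≡ a × d ≡ b)
∖-elim X {a} {b} {c} {d} e with ∧-true {X c d} e
... | p , q = p , λ { (refl , refl) → true≢false (δ-refl a b) (not-true q) }

total-strict : ∀ {m} (X Y : Matrix m) {a b} → X ⊆ Y → X a b ≡ false → Y a b ≡ true → total X < total Y
total-strict X Y {a} {b} X⊆Y nx y = subst (total X <_) (sym (total-remove Y y)) (s≤s (total-mono X⊆))
  where
    X⊆ : X ⊆ Y ∖ δ a b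
    X⊆ s t e = ∖-intro Y (X⊆Y s t e) (λ { (refl , refl) → true≢false e nx })

total≥2 : ∀ {m} (X : Matrix m) {a b c d} → X a b ≡ true → X c d ≡ true → ¬ (c ≡ a × d ≡ b) → 2 ≤ total X
total≥2 X p q ne = subst (2 ≤_) (sym (total-remove X p)) (s≤s (total-nonempty _ (∖-intro X q ne)))

record TwoEntries {m} (X : Matrix m) : Set where
  constructor two
  field
    {p q p′ q′} : Fin m
    first       : X p q ≡ true
    second      : X p′ q′ ≡ true
    distinct    : ¬ (p′ ≡ p × q′ ≡ q)

two-entries : ∀ {m} (X : Matrix m) → 2 ≤ total X → TwoEntries X
two-entries X le with total-positive X (≤-trans (s≤s z≤n) le)
... | a , b , p with total-positive (X ∖ δ a b) (ℕ.s≤s⁻¹ (subst (2 ≤_) (total-remove X p) le))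
...   | c , d , q = let r , ne = ∖-elim X q in two p r ne

two-exhaust : ∀ {m} (X : Matrix m) {a b c d} → total X ≤ 2 → X a b ≡ true → X c d ≡ true →
  ¬ (c ≡ a × d ≡ b) → ∀ {s t} → X s t ≡ true → (s ≡ a × t ≡ b) ⊎ (s ≡ c × t ≡ d)
two-exhaust X {a} {b} {c} {d} le p q ne {s} {t} r with δ a b s t in e₁ | δ c d s t in e₂
... | true  | _    = inj₁ (δ-sound a b s t e₁)
... | false | true = inj₂ (δ-sound c d s t e₂)
... | false | false = contradiction (≤-trans three le) λ { (s≤s (s≤s ())) }
  where
    three : 3 ≤ total X
    three = subst (3 ≤_) (sym (total-remove X p)) (s≤s (total≥2 (X ∖ δ a b) {c} {d} {s} {t}
      (∖-intro X q ne)
      (∖-intro X r λ { (refl , refl) → true≢false (δ-refl a b) e₁ })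
      λ { (refl , refl) → true≢false (δ-refl c d) e₂ }))

total≤2 : ∀ {m} (X : Matrix m) {a b c d} →
  (∀ {s t} → X s t ≡ true → (s ≡ a × t ≡ b) ⊎ (s ≡ c × t ≡ d)) → total X ≤ 2
total≤2 {m} X {a} {b} {c} {d} cov with 2 ℕ.≤? total X
... | no  lt = <⇒≤ (≰⇒> lt)
... | yes le with two-entries X le
...   | two {p} {q} {p′} {q′} x y ne = ≤-reflexive (trans (total-remove X x) (cong suc
    (trans (total-remove (X ∖ δ p q) (∖-intro X y ne)) (cong suc (none _ empty)))))
  where
    none : ∀ {m} (Y : Matrix m) → (∀ s t → ¬ (Y s t ≡ true)) → total Y ≡ 0
    none Y emp with total Y in e
    ... | zero  = refl
    ... | suc k = let s , t , y = total-positive Y (subst (1 ≤_) (sym e) (s≤s z≤n)) in contradiction y (emp s t)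
    empty : ∀ s t → ¬ ((X ∖ δ p q ∖ δ p′ q′) s t ≡ true)
    empty s t e with ∖-elim (X ∖ δ p q) e
    ... | e₁ , ne₁ with ∖-elim X e₁
    ...   | e₂ , ne₂ with cov x | cov y | cov e₂
    ... | inj₁ (refl , refl) | inj₁ (refl , refl) | _ = ne (refl , refl)
    ... | inj₂ (refl , refl) | inj₂ (refl , refl) | _ = ne (refl , refl)
    ... | inj₁ (refl , refl) | inj₂ (refl , refl) | inj₁ (refl , refl) = ne₂ (refl , refl)
    ... | inj₁ (refl , refl) | inj₂ (refl , refl) | inj₂ (refl , refl) = ne₁ (refl , refl)
    ... | inj₂ (refl , refl) | inj₁ (refl , refl) | inj₁ (refl , refl) = ne₁ (refl , refl)
    ... | inj₂ (refl , refl) | inj₁ (refl , refl) | inj₂ (refl , refl) = ne₂ (refl , refl)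

-- Good arc colourings

-- Testing against all weights `φ` makes balance linear: it is additive over disjoint arc sets, and
-- precomposing `φ` with a map handles any renaming or merging of colours. An indicator as `φ`
-- recovers the count of a single colour.
Balanced : ∀ {m} {C : Set} → Matrix m → (Fin m → Fin m → C) → Set
Balanced {C = C} X f = ∀ (φ : C → ℕ) v → out X (λ s t → φ (f s t)) v ≡ out (flip X) (λ s t → φ (f t s)) v

-- The colours form an arbitrary type with decidable equality, so that gluing can use `⊎` and a new
-- colour can be adjoined by `Maybe`. A finite palette appears only when permutations are extracted.
record Good {m} (A : Matrix m) : Set₁ where
  field
    {Colour}   : Set
    _≟ᶜ_       : DecidableEquality Colour
    colour     : Fin m → Fin m → Colour
    turns      : ∀ {s t} → A s t ≡ true → A t s ≡ true → colour s t ≢ colour t s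
    balanced   : Balanced A colour

sum-strict : ∀ {m} {f g : Fin m → ℕ} → (∀ i → f i ≤ g i) → ∀ v → f v < g v → sumFin m f < sumFin m g
sum-strict {m} le v lt with m≤n⇒m<n∨m≡n (sum-mono {m} le)
... | inj₁ p = p
... | inj₂ e = contradiction (sum-tight {m} le e v) (<⇒≢ lt)

sum-▹-const : ∀ {m} (p : Fin m → Bool) x → sumFin m (λ u → p u ▹ x) ≡ sumFin m (b2n ∘ p) * x
sum-▹-const {zero}  p x = refl
sum-▹-const {suc m} p x = trans (cong₂ _+_ (head (p zero)) (sum-▹-const (p ∘ suc) x))
  (sym (*-distribʳ-+ x (b2n (p zero)) _))
  where
    head : ∀ b → b ▹ x ≡ b2n b * x
    head true  = sym (+-identityʳ x)
    head false = refl

b2n-* : ∀ b x → b2n b * x ≡ b ▹ x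
b2n-* true  x = +-identityʳ x
b2n-* false x = refl

b2n-positive : ∀ {b} → 1 ≤ b2n b → b ≡ true
b2n-positive {true} _ = refl

-- For a self-map of V the largest subset mapped onto itself is permuted.
recurrent : ∀ {m} (s : Fin m → Fin m) k (V : Fin m → Bool) → sumFin m (b2n ∘ V) ≤ k →
  (∃[ v ] V v ≡ true) → (∀ v → V v ≡ true → V (s v) ≡ true) →
  Σ (Fin m → Bool) λ P → (∀ v → P v ≡ true → V v ≡ true) × (∃[ v ] P v ≡ true) ×
    (∀ v → sumFin m (λ u → b2n (P u ∧ (v == s u))) ≡ b2n (P v))
recurrent {m} s zero V le (v , Vv) cl =
  contradiction (≤-trans (subst (λ b → 1 ≤ b2n b) (sym Vv) (s≤s z≤n)) (≤-trans (term≤sum (b2n ∘ V) v) le)) λ ()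
recurrent {m} s (suc k) V le ne cl = go (any? λ v → (V v Boolₚ.≟ true) ×-dec (pre v ℕ.≟ 0))
  where
    pre : Fin m → ℕ
    pre v = sumFin m (λ u → b2n (V u ∧ (v == s u)))

    sum-pre : sumFin m pre ≡ sumFin m (b2n ∘ V)
    sum-pre = trans (sum-swap {m} {m} _) (sum-cong {m} λ u →
      trans (sum-cong {m} λ v → trans (sym (▹-one _)) (trans (▹-∧ (V u) (v == s u) 1) refl))
        (trans (sum-▹ {m} (V u) _) (trans (cong (V u ▹_) (sum-pick {m} (s u) (const 1))) (▹-one (V u)))))

    go : Dec (∃[ v ] (V v ≡ true × pre v ≡ 0)) → _
    -- Each vertex of `V` has a preimage, while the numbers of preimages add up to the size of `V`;
    -- hence each has exactly one, and vertices outside `V` have none.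
    go (no none) = V , (λ _ p → p) , ne , λ v → sym (sum-tight {m} le′ (sym sum-pre) v)
      where
        le′ : ∀ v → b2n (V v) ≤ pre v
        le′ v with V v in e
        ... | false = z≤n
        ... | true = n≢0⇒n>0 (λ z → none (v , e , z))
    -- A vertex without preimage can be discarded: no value of `s` on `V` equals it, so closure
    -- survives, and `s v₀` shows that the rest is nonempty.
    go (yes (v₀ , Vv₀ , z)) =
      let P , P⊆ , ne′ , perm = recurrent s k V′ smaller (s v₀ , V′-intro v₀ Vv₀) closed
      in P , (λ v p → proj₁ (∧-true (P⊆ v p))) , ne′ , perm
      where
        V′ : Fin m → Bool
        V′ u = V u ∧ not (u == v₀)
        V′-intro : ∀ u → V u ≡ true → V′ (s u) ≡ true
        V′-intro u Vu = ∧-intro (cl u Vu) (not-false (==-≢ {u = s u} {v₀} λ e → contradiction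
          (≤-trans (≤-reflexive (sym (cong b2n (∧-intro {V u} Vu (==-≡ {u = v₀} {s u} (sym e))))))
                   (≤-trans (term≤sum (λ u → b2n (V u ∧ (v₀ == s u))) u) (≤-reflexive z)))
          λ ()))
        closed : ∀ u → V′ u ≡ true → V′ (s u) ≡ true
        closed u e = V′-intro u (proj₁ (∧-true e))
        smaller : sumFin m (b2n ∘ V′) ≤ k
        smaller = ℕ.s≤s⁻¹ (≤-trans (sum-strict {m} (λ u → b2n-mono (proj₁ ∘ ∧-true)) v₀
          (subst₂ _<_ (sym (cong b2n (trans (cong (λ b → V v₀ ∧ not b) (==-refl v₀)) (Boolₚ.∧-zeroʳ (V v₀)))))
                      (sym (cong b2n Vv₀)) (s≤s z≤n))) le)

opaque
  unfolding out

  out-positive : ∀ {m} (X : Matrix m) {w} s → 1 ≤ out X w s → ∃[ t ] (X s t ≡ true × 1 ≤ w s t)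
  out-positive {m} X {w} s p with sum-positive {m} _ p
  ... | t , q with X s t in e
  ...   | true = t , e , q

  term≤out : ∀ {m} (X : Matrix m) w {s t} → X s t ≡ true → w s t ≤ out X w s
  term≤out {m} X w {s} {t} e = ≤-trans (≤-reflexive (cong (_▹ w s t) (sym e))) (term≤sum {m} (λ t → X s t ▹ w s t) t)

  out-function : ∀ {m} (P : Fin m → Bool) (h : Fin m → Fin m) w v →
    out (λ u t → P u ∧ (t == h u)) w v ≡ P v ▹ w v (h v)
  out-function {m} P h w v = trans (sum-cong {m} λ t → ▹-∧ (P v) (t == h v) _)
    (trans (sum-▹ {m} (P v) _) (cong (P v ▹_) (sum-pick {m} (h v) (w v))))

  out-const : ∀ {m} (X : Matrix m) x v → out X (λ _ _ → x) v ≡ sumFin m (λ t → b2n (X v t)) * x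
  out-const X x v = sum-▹-const (X v) x

-- Each colour class is a disjoint union of directed cycles, none of which runs along an edge and
-- straight back. In a bipartite graph these fields translate into properness of both colourings,
-- equality of their palettes, and their difference on every edge.
record Simple {m} (X : Matrix m) {l} (g : Fin m → Fin m → Fin l) : Set where
  field
    out-injective : ∀ {v u w} → X v u ≡ true → X v w ≡ true → g v u ≡ g v w → u ≡ w
    in-injective  : ∀ {v u w} → X u v ≡ true → X w v ≡ true → g u v ≡ g w v → u ≡ w
    out⇒in        : ∀ {v u} → X v u ≡ true → ∃[ w ] (X w v ≡ true × g w v ≡ g v u)
    in⇒out        : ∀ {v u} → X u v ≡ true → ∃[ w ] (X v w ≡ true × g v w ≡ g u v)
    no-return     : ∀ {u v} → X u v ≡ true → X v u ≡ true → g u v ≢ g v u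

Turnless : ∀ {m} {C : Set} → Matrix m → (Fin m → Fin m → C) → Set
Turnless X f = ∀ {s t} → X s t ≡ true → X t s ≡ true → f s t ≢ f t s

module _ {m} {C : Set} (_≟ᶜ_ : DecidableEquality C) (f : Fin m → Fin m → C) where

  -- Every vertex with an outgoing arc of colour `f p q` chooses one as successor. By balance the
  -- head of that arc has such an arc again, so the choice is a self-map of these vertices, and
  -- `recurrent` finds a set that it permutes.
  extract-permutation : (X : Matrix m) → Balanced X f → ∀ {p q} → X p q ≡ true →
    Σ (Fin m → Bool) λ P → Σ (Fin m → Fin m) λ s → (∃[ v ] P v ≡ true) ×
    (∀ {u} → P u ≡ true → X u (s u) ≡ true × f u (s u) ≡ f p q) ×
    (∀ v → sumFin m (λ u → b2n (P u ∧ (v == s u))) ≡ b2n (P v))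
  extract-permutation X bal {p} {q} Xpq =
    let P , P⊆ , ne , perm = recurrent s _ V ≤-refl (p , dec-true (succ? p) (q , Xpq , refl)) closed
    in P , s , ne , (λ {u} Pu → s-correct u (P⊆ u Pu)) , perm
    where
      k = f p q
      Succ : Fin m → Fin m → Set
      Succ v t = X v t ≡ true × f v t ≡ k
      succ? : ∀ v → Dec (∃ (Succ v))
      succ? v = any? λ t → (X v t Boolₚ.≟ true) ×-dec (f v t ≟ᶜ k)
      V : Fin m → Bool
      V v = does (succ? v)
      pick : ∀ v → Dec (∃ (Succ v)) → Fin m
      pick v (yes (t , _)) = t
      pick v (no _) = v
      s : Fin m → Fin m
      s v = pick v (succ? v)
      s-correct : ∀ v → V v ≡ true → X v (s v) ≡ true × f v (s v) ≡ k
      s-correct v e with succ? v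
      ... | yes (t , c) = c
      φ : C → ℕ
      φ c = b2n (does (c ≟ᶜ k))
      closed : ∀ v → V v ≡ true → V (s v) ≡ true
      closed v Vv =
        let Xvs , fvs = s-correct v Vv
            1≤in : 1 ≤ out (flip X) (λ a b → φ (f b a)) (s v)
            1≤in = ≤-trans (≤-reflexive (sym (cong b2n (dec-true (f v (s v) ≟ᶜ k) fvs))))
                           (term≤out (flip X) (λ a b → φ (f b a)) {s v} {v} Xvs)
            t , Xst , pos = out-positive X (s v) (subst (1 ≤_) (sym (bal φ (s v))) 1≤in)
        in dec-true (succ? (s v)) (t , Xst , does-sound (f (s v) t ≟ᶜ k) (b2n-positive pos))
        where
          does-sound : ∀ {A : Set} (d : Dec A) → does d ≡ true → A
          does-sound (yes a) _ = a

  -- Induction on the number of arcs. A permutation taken out of one old colour class is balanced by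
  -- itself, so the remaining arcs are balanced too; the permutation receives the fresh colour
  -- `zero`, and the colours of the rest are shifted.
  simple-colouring : ∀ k (X : Matrix m) → total X ≤ k → Turnless X f → Balanced X f →
    ∃[ l ] Σ (Fin m → Fin m → Fin l) (Simple X)
  simple-colouring k X le tl bal with 1 ℕ.≤? total X
  ... | no empty = 1 , (λ _ _ → zero) , record
    { out-injective = λ x _ _ → ⊥-elim (none x) ; in-injective = λ x _ _ → ⊥-elim (none x)
    ; out⇒in = λ x → ⊥-elim (none x) ; in⇒out = λ x → ⊥-elim (none x) ; no-return = λ x _ _ → none x }
    where
      none : ∀ {s t} → ¬ X s t ≡ true
      none x = empty (total-nonempty X x)
  simple-colouring zero X le tl bal | yes 1≤ = contradiction (≤-trans 1≤ le) λ ()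
  simple-colouring (suc k) X le tl bal | yes 1≤ with total-positive X 1≤
  ... | p , q , Xpq with extract-permutation X bal Xpq
  ... | P , s , (v₀ , Pv₀) , s-arc , perm = suc l , g , record
    { out-injective = out-inj ; in-injective = in-inj ; out⇒in = o⇒i ; in⇒out = i⇒o ; no-return = ret }
    where
      Y : Matrix m
      Y u t = P u ∧ (t == s u)

      Y-sound : ∀ {u t} → Y u t ≡ true → P u ≡ true × t ≡ s u
      Y-sound e = let a , b = ∧-true e in a , ==-sound b

      Y-intro : ∀ {u} → P u ≡ true → Y u (s u) ≡ true
      Y-intro {u} Pu = ∧-intro Pu (==-refl (s u))

      Y⊆X : Y ⊆ X
      Y⊆X u t e with Y-sound {u} {t} e
      ... | Pu , refl = proj₁ (s-arc Pu)

      Y-colour : ∀ {u t} → Y u t ≡ true → f u t ≡ f p q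
      Y-colour {u} {t} e with Y-sound {u} {t} e
      ... | Pu , refl = proj₂ (s-arc Pu)

      balanced-Y : Balanced Y f
      balanced-Y φ v = trans
        (trans (out-function P s _ v) (▹-cong (P v) λ Pv → cong φ (proj₂ (s-arc Pv))))
        (sym (trans (out-cong (flip Y) v λ u e → cong φ (Y-colour {u} {v} e))
             (trans (out-const (flip Y) (φ (f p q)) v)
             (trans (cong (_* φ (f p q)) (perm v)) (b2n-* (P v) _)))))

      balanced-rest : Balanced (X ∖ Y) f
      balanced-rest φ v = +-cancelʳ-≡ (out Y (λ s t → φ (f s t)) v) _ _
        (trans (sym (out-⊕ (∖-⊕ Y⊆X) _ v))
        (trans (bal φ v)
        (trans (out-⊕ (⊕-flip (∖-⊕ Y⊆X)) _ v) (cong (out (flip (X ∖ Y)) _ v +_) (sym (balanced-Y φ v))))))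

      weaken : X ∖ Y ⊆ X
      weaken _ _ e = proj₁ (∧-true e)

      smaller : total (X ∖ Y) ≤ k
      smaller = ℕ.s≤s⁻¹ (≤-trans (total-strict (X ∖ Y) X {v₀} {s v₀} weaken
        (trans (cong (λ b → X v₀ (s v₀) ∧ not b) (Y-intro Pv₀)) (Boolₚ.∧-zeroʳ _)) (proj₁ (s-arc Pv₀))) le)

      ih = simple-colouring k (X ∖ Y) smaller (λ {a} {b} x y → tl (weaken a b x) (weaken b a y)) balanced-rest
      l  = proj₁ ih
      g′ = proj₁ (proj₂ ih)
      module S = Simple (proj₂ (proj₂ ih))

      g : Fin m → Fin m → Fin (suc l)
      g u t = if Y u t then zero else suc (g′ u t)

      data View (u t : Fin m) : Set where
        new : Y u t ≡ true → g u t ≡ zero → View u t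
        old : (X ∖ Y) u t ≡ true → g u t ≡ suc (g′ u t) → View u t

      view : ∀ {u t} → X u t ≡ true → View u t
      view {u} {t} x with Y u t in e
      ... | true  = new e (cong (if_then zero else suc (g′ u t)) e)
      ... | false = old (∧-intro x (not-false e)) (cong (if_then zero else suc (g′ u t)) e)

      view-rest : ∀ {u t} → (X ∖ Y) u t ≡ true → g u t ≡ suc (g′ u t)
      view-rest {u} {t} x = cong (if_then zero else suc (g′ u t)) (not-true (proj₂ (∧-true {X u t} x)))

      view-Y : ∀ {u t} → Y u t ≡ true → g u t ≡ zero
      view-Y {u} {t} e = cong (if_then zero else suc (g′ u t)) e

      suc-inj : ∀ {a b : Fin l} → Fin.suc a ≡ suc b → a ≡ b
      suc-inj refl = refl

      clash : ∀ {A : Set} {x y : Fin (suc l)} {a : Fin l} → x ≡ y → x ≡ zero → y ≡ suc a → A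
      clash refl refl ()

      out-inj : ∀ {v u w} → X v u ≡ true → X v w ≡ true → g v u ≡ g v w → u ≡ w
      out-inj {v} {u} {w} x y e with view {v} {u} x | view {v} {w} y
      ... | new a _ | new b _ = trans (proj₂ (Y-sound {v} {u} a)) (sym (proj₂ (Y-sound {v} {w} b)))
      ... | new a i | old b j = clash e i j
      ... | old a i | new b j = clash (sym e) j i
      ... | old a i | old b j = S.out-injective a b (suc-inj (trans (sym i) (trans e j)))

      in-inj : ∀ {v u w} → X u v ≡ true → X w v ≡ true → g u v ≡ g w v → u ≡ w
      in-inj {v} {u} {w} x y e with view {u} {v} x | view {w} {v} y
      ... | new a i | old b j = clash e i j
      ... | old a i | new b j = clash (sym e) j i
      ... | old a i | old b j = S.in-injective a b (suc-inj (trans (sym i) (trans e j)))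
      ... | new a _ | new b _ with u Fin.≟ w
      ...   | yes u≡w = u≡w
      ...   | no  u≢w = contradiction
        (≤-trans (≤-reflexive (sym (cong₂ _+_ (cong b2n a) (cong b2n b))))
          (≤-trans (two-terms≤sum (λ u → b2n (Y u v)) u≢w) (≤-trans (≤-reflexive (perm v)) (b2n≤1 (P v)))))
        λ { (s≤s ()) }
        where
          b2n≤1 : ∀ b → b2n b ≤ 1
          b2n≤1 true  = ≤-refl
          b2n≤1 false = z≤n

      into : ∀ {v} → P v ≡ true → ∃[ u ] Y u v ≡ true
      into {v} Pv with sum-positive (λ u → b2n (Y u v)) (≤-reflexive (sym (trans (perm v) (cong b2n Pv))))
      ... | u , pos = u , b2n-positive pos

      from : ∀ {u v} → Y u v ≡ true → P v ≡ true
      from {u} {v} e = b2n-positive (≤-trans (≤-trans (≤-reflexive (sym (cong b2n e)))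
        (term≤sum (λ u → b2n (Y u v)) u)) (≤-reflexive (perm v)))

      o⇒i : ∀ {v u} → X v u ≡ true → ∃[ w ] (X w v ≡ true × g w v ≡ g v u)
      o⇒i {v} {u} x with view {v} {u} x
      ... | new a i = let w , y = into (proj₁ (Y-sound {v} {u} a))
                      in w , Y⊆X w v y , trans (view-Y {w} {v} y) (sym i)
      ... | old a i = let w , y , e = S.out⇒in a
                      in w , weaken w v y , trans (view-rest y) (trans (cong suc e) (sym i))

      i⇒o : ∀ {v u} → X u v ≡ true → ∃[ w ] (X v w ≡ true × g v w ≡ g u v)
      i⇒o {v} {u} x with view {u} {v} x
      ... | new a i = let y = Y-intro (from {u} {v} a)
                      in s v , Y⊆X v (s v) y , trans (view-Y {v} {s v} y) (sym i)
      ... | old a i = let w , y , e = S.in⇒out a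
                      in w , weaken v w y , trans (view-rest y) (trans (cong suc e) (sym i))

      ret : ∀ {u v} → X u v ≡ true → X v u ≡ true → g u v ≢ g v u
      ret {u} {v} x y e with view {u} {v} x | view {v} {u} y
      -- All arcs of `Y` come from one old colour class, so `Y` cannot contain both directions of an
      -- edge.
      ... | new a _ | new b _ = tl x y (trans (Y-colour {u} {v} a) (sym (Y-colour {v} {u} b)))
      ... | new a i | old b j = clash e i j
      ... | old a i | new b j = clash (sym e) j i
      ... | old a i | old b j = S.no-return a b (suc-inj (trans (sym i) (trans e j)))

-- Simultaneous colourings and good arc colourings

opaque
  unfolding out

  palette : ∀ {m l} (p : Fin m → Bool) (c : Fin m → Fin l) (φ : Fin l → ℕ) →
    sumFin m (λ t → p t ▹ φ (c t)) ≡ sumFin l (λ k → sumFin m (λ t → (p t ∧ (k == c t)) ▹ φ k))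
  palette {m} {l} p c φ = begin
    sumFin m (λ t → p t ▹ φ (c t))
      ≡⟨ sum-cong {m} (λ t → cong (p t ▹_) (sym (sum-pick {l} (c t) φ))) ⟩
    sumFin m (λ t → p t ▹ sumFin l (λ k → (k == c t) ▹ φ k))
      ≡⟨ sum-cong {m} (λ t → sym (sum-▹ {l} (p t) _)) ⟩
    sumFin m (λ t → sumFin l (λ k → p t ▹ (k == c t) ▹ φ k))
      ≡⟨ sum-cong {m} (λ t → sum-cong {l} (λ k → sym (▹-∧ (p t) _ _))) ⟩
    sumFin m (λ t → sumFin l (λ k → (p t ∧ (k == c t)) ▹ φ k))
      ≡⟨ sum-swap {m} {l} _ ⟩
    sumFin l (λ k → sumFin m (λ t → (p t ∧ (k == c t)) ▹ φ k)) ∎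
    where open ≡-Reasoning

Distinct : ∀ {m l} → (Fin m → Bool) → (Fin m → Fin l) → Set
Distinct p c = ∀ {u w} → p u ≡ true → p w ≡ true → c u ≡ c w → u ≡ w

-- Regrouped by colour, an injective colouring contributes `φ k` once if `k` occurs and nothing
-- otherwise. The sum thus depends only on the set of colours that occur.
same-palette : ∀ {m l} (p : Fin m → Bool) (c c′ : Fin m → Fin l) → Distinct p c → Distinct p c′ →
  (∀ {u} → p u ≡ true → ∃[ w ] (p w ≡ true × c′ w ≡ c u)) →
  (∀ {u} → p u ≡ true → ∃[ w ] (p w ≡ true × c w ≡ c′ u)) →
  ∀ φ → sumFin m (λ t → p t ▹ φ (c t)) ≡ sumFin m (λ t → p t ▹ φ (c′ t))
same-palette {m} {l} p c c′ dc dc′ to from φ =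
  trans (palette p c φ) (trans (sum-cong {l} pointwise) (sym (palette p c′ φ)))
  where
    count : (Fin m → Fin l) → Fin l → ℕ
    count c k = sumFin m (λ t → (p t ∧ (k == c t)) ▹ φ k)

    present : ∀ c → Distinct p c → ∀ {t} → p t ≡ true → count c (c t) ≡ φ (c t)
    present c dc {t} pt = trans (sum-cong {m} eq) (sum-pick {m} t (const (φ (c t))))
      where
        eq : ∀ u → (p u ∧ (c t == c u)) ▹ φ (c t) ≡ (u == t) ▹ φ (c t)
        eq u with u Fin.≟ t
        ... | yes refl = cong (_▹ φ (c t)) (∧-intro {p t} {c t == c t} pt (==-refl (c t)))
        ... | no u≢t with p u in pu | c t Fin.≟ c u
        ...   | false | _ = refl
        ...   | true | no _ = refl
        ...   | true | yes e = contradiction (dc pu pt (sym e)) u≢t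

    absent : ∀ c k → (∀ t → ¬ (p t ≡ true × k ≡ c t)) → count c k ≡ 0
    absent c k none = trans (sum-cong {m} eq) (sum-zero m)
      where
        eq : ∀ t → (p t ∧ (k == c t)) ▹ φ k ≡ 0
        eq t with p t in pt | k Fin.≟ c t
        ... | false | _ = refl
        ... | true | no _ = refl
        ... | true | yes e = contradiction (pt , e) (none t)

    pointwise : ∀ k → count c k ≡ count c′ k
    pointwise k with any? (λ t → (p t Boolₚ.≟ true) ×-dec (k Fin.≟ c t))
    ... | yes (t , pt , refl) = let w , pw , e = to pt in
      trans (present c dc pt) (trans (cong φ (sym e)) (trans (sym (present c′ dc′ pw)) (cong (count c′) e)))
    ... | no none = trans (absent c k λ t q → none (t , q))
      (sym (absent c′ k λ { t (pt , refl) → let w , pw , e = from pt in none (w , pw , sym e) }))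

opposite : ∀ {a b : Bool} → a ≢ b → a ≡ true → b ≡ false
opposite ne e = trans (¬-not (≢-sym ne)) (cong not e)

opposite′ : ∀ {a b : Bool} → a ≢ b → a ≡ false → b ≡ true
opposite′ ne e = trans (¬-not (≢-sym ne)) (cong not e)

-- An edge receives c₁ when traversed from the true side and c₂ in the other direction.
colourable⇒good : ∀ G → Bipartite G → TwoSimultaneousEdgeColorable G → Good (adj G)
colourable⇒good G (side , bip) (l , c₁ , c₂ , (sym₁ , inj₁′) , (sym₂ , inj₂′) , same , diff) = record
  { _≟ᶜ_ = Fin._≟_ ; colour = f ; turns = turns′ ; balanced = bal }
  where
    A = adj G
    f : Fin (n G) → Fin (n G) → Fin l
    f u v = if side u then c₁ u v else c₂ u v

    distinct : ∀ (c : Fin (n G) → Fin (n G) → Fin l) →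
      (∀ u v w → A u v ≡ true → A u w ≡ true → v ≢ w → c u v ≢ c u w) → ∀ v → Distinct (A v) (c v)
    distinct c inj v {u} {w} p q e = decidable-stable (u Fin.≟ w) (λ ne → inj v u w p q ne e)

    turns′ : Turnless A f
    turns′ {s} {t} a b e with side s in es | side t in et
    ... | true  | true  = bip s t a (trans es (sym et))
    ... | false | false = bip s t a (trans es (sym et))
    ... | true  | false = diff s t a (trans e (sym (sym₂ s t a)))
    ... | false | true  = diff s t a (trans (sym₁ s t a) (sym e))

    swap-colours : ∀ φ v → out A (λ s t → φ (c₁ s t)) v ≡ out A (λ s t → φ (c₂ s t)) v
    swap-colours φ v = trans (out-def A _ v) (trans
      (same-palette (A v) (c₁ v) (c₂ v) (distinct c₁ inj₁′ v) (distinct c₂ inj₂′ v)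
        (λ {u} p → proj₁ (same v (c₁ v u)) (u , p , refl))
        (λ {u} p → proj₂ (same v (c₂ v u)) (u , p , refl)) φ)
      (sym (out-def A _ v)))

    bal : Balanced A f
    bal φ v with side v in ev
    -- The arcs leaving a true vertex carry `c₁`; those entering it come from false vertices and
    -- carry `c₂`. Balance at `v` is therefore the equality of the two palettes.
    ... | true = begin
      out A (λ s t → φ (f s t)) v  ≡⟨ out-cong A v (λ t _ → cong (λ b → φ (if b then c₁ v t else c₂ v t)) ev) ⟩
      out A (λ s t → φ (c₁ s t)) v ≡⟨ swap-colours φ v ⟩
      out A (λ s t → φ (c₂ s t)) v ≡⟨ out-cong A v (λ t a → cong φ (trans (sym₂ v t a)
          (cong (if_then c₁ t v else c₂ t v) (sym (opposite (bip v t a) ev))))) ⟩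
      out A (λ s t → φ (f t s)) v  ≡⟨ out-mask-cong _ v (λ t → adj-sym G v t) ⟩
      out (flip A) (λ s t → φ (f t s)) v ∎
      where open ≡-Reasoning
    ... | false = begin
      out A (λ s t → φ (f s t)) v  ≡⟨ out-cong A v (λ t _ → cong (λ b → φ (if b then c₁ v t else c₂ v t)) ev) ⟩
      out A (λ s t → φ (c₂ s t)) v ≡⟨ swap-colours φ v ⟨
      out A (λ s t → φ (c₁ s t)) v ≡⟨ out-cong A v (λ t a → cong φ (trans (sym₁ v t a)
          (cong (if_then c₁ t v else c₂ t v) (sym (opposite′ (bip v t a) ev))))) ⟩
      out A (λ s t → φ (f t s)) v  ≡⟨ out-mask-cong _ v (λ t → adj-sym G v t) ⟩
      out (flip A) (λ s t → φ (f t s)) v ∎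
      where open ≡-Reasoning

good⇒colourable : ∀ G → Bipartite G → Good (adj G) → TwoSimultaneousEdgeColorable G
good⇒colourable G (side , bip) good with simple-colouring (Good._≟ᶜ_ good) (Good.colour good)
  _ (adj G) ≤-refl (Good.turns good) (Good.balanced good)
... | l , g , simple = l , c true , c false ,
  (symmetric true , proper true) , (symmetric false , proper false) , same , different
  where
    open Simple simple
    A = adj G
    V = Fin (n G)

    flipped : ∀ {u v} → A u v ≡ true → A v u ≡ true
    flipped {u} {v} a = trans (adj-sym G v u) a

    -- `c true` reads the arc that leaves the true end of the edge and `c false` the arc that leaves
    -- its false end, whichever way round the ends are given.
    c : Bool → V → V → Fin l
    c b u v = if side u xor b then g v u else g u v

    symmetric : ∀ b u v → A u v ≡ true → c b u v ≡ c b v u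
    symmetric b u v a with side u in eu | side v in ev | b
    ... | true  | true  | _ = contradiction (trans eu (sym ev)) (bip u v a)
    ... | false | false | _ = contradiction (trans eu (sym ev)) (bip u v a)
    ... | true  | false | true  = refl
    ... | true  | false | false = refl
    ... | false | true  | true  = refl
    ... | false | true  | false = refl

    proper : ∀ b u v w → A u v ≡ true → A u w ≡ true → v ≢ w → c b u v ≢ c b u w
    proper b u v w p q ne e with side u xor b
    ... | true  = ne (in-injective (flipped p) (flipped q) e)
    ... | false = ne (out-injective p q e)

    same : ∀ v k → (ColorAt G (c true) v k → ColorAt G (c false) v k) × (ColorAt G (c false) v k → ColorAt G (c true) v k)
    same v k with side v
    ... | true  = (λ { (u , a , e) → let w , b , e′ = out⇒in a in w , flipped b , trans e′ e })
                , (λ { (u , a , e) → let w , b , e′ = in⇒out (flipped a) in w , b , trans e′ e })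
    ... | false = (λ { (u , a , e) → let w , b , e′ = in⇒out (flipped a) in w , b , trans e′ e })
                , (λ { (u , a , e) → let w , b , e′ = out⇒in a in w , flipped b , trans e′ e })

    different : ∀ u v → A u v ≡ true → c true u v ≢ c false u v
    different u v a with side u
    ... | true  = no-return a (flipped a)
    ... | false = no-return (flipped a) a

-- Gluing good arc colourings

infixl 6 _∪_
_∪_ : ∀ {m} → Matrix m → Matrix m → Matrix m
(X ∪ Y) s t = X s t ∨ Y s t

b2n-∨ : ∀ {x y} → (x ≡ true → y ≡ true → ⊥) → b2n (x ∨ y) ≡ b2n x + b2n y
b2n-∨ {true}  {true}  d = ⊥-elim (d refl refl)
b2n-∨ {true}  {false} d = refl
b2n-∨ {false} {y}     d = refl

∪-⊕ : ∀ {m} {X Y : Matrix m} → (∀ {s t} → X s t ≡ true → Y s t ≡ true → ⊥) → X ∪ Y ≐ X ⊕ Y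
∪-⊕ d = disjoint λ s t → b2n-∨ d

⊕-left : ∀ {m} {X Y Z : Matrix m} → Z ≐ X ⊕ Y → X ⊆ Z
⊕-left {X = X} {Y} {Z} d s t = lemma (X s t) (Y s t) (Z s t) (split d s t)
  where
    lemma : ∀ x y z → b2n z ≡ b2n x + b2n y → x ≡ true → z ≡ true
    lemma true y true  _  _ = refl
    lemma true y false () _

⊕-comm : ∀ {m} {X Y Z : Matrix m} → Z ≐ X ⊕ Y → Z ≐ Y ⊕ X
⊕-comm {X = X} d = disjoint λ s t → trans (split d s t) (+-comm (b2n (X s t)) _)

⊕-right : ∀ {m} {X Y Z : Matrix m} → Z ≐ X ⊕ Y → Y ⊆ Z
⊕-right d = ⊕-left (⊕-comm d)

⊕-exclusive : ∀ {m} {X Y Z : Matrix m} → Z ≐ X ⊕ Y → ∀ s t → X s t ≡ true → Y s t ≡ false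
⊕-exclusive {X = X} {Y} {Z} d s t = lemma (X s t) (Y s t) (Z s t) (split d s t)
  where
    lemma : ∀ x y z → b2n z ≡ b2n x + b2n y → x ≡ true → y ≡ false
    lemma x     false z     _ _ = refl
    lemma true  true  true  () _
    lemma true  true  false () _

⊕-cases : ∀ {m} {X Y Z : Matrix m} → Z ≐ X ⊕ Y → ∀ s t → Z s t ≡ true → X s t ≡ true ⊎ Y s t ≡ true
⊕-cases {X = X} {Y} {Z} d s t = lemma (X s t) (Y s t) (Z s t) (split d s t)
  where
    lemma : ∀ x y z → b2n z ≡ b2n x + b2n y → z ≡ true → x ≡ true ⊎ y ≡ true
    lemma true  y     z    _ _ = inj₁ refl
    lemma false true  z    _ _ = inj₂ refl
    lemma false false true () _

edge : ∀ {m} → Fin m → Fin m → Matrix m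
edge a b = δ a b ∪ δ b a

edge-⊕ : ∀ {m} {a b : Fin m} → a ≢ b → edge a b ≐ δ a b ⊕ δ b a
edge-⊕ {a = a} {b} a≢b = ∪-⊕ λ {s} {t} p q → a≢b (trans (sym (proj₁ (δ-sound a b s t p))) (proj₁ (δ-sound b a s t q)))

edge-sound : ∀ {m} (a b s t : Fin m) → edge a b s t ≡ true → (s ≡ a × t ≡ b) ⊎ (s ≡ b × t ≡ a)
edge-sound a b s t e with δ a b s t in e₁
... | true  = inj₁ (δ-sound a b s t e₁)
... | false = inj₂ (δ-sound b a s t e)

edge-left : ∀ {m} (a b : Fin m) → edge a b a b ≡ true
edge-left a b = cong (_∨ δ b a a b) (δ-refl a b)

edge-right : ∀ {m} (a b : Fin m) → edge a b b a ≡ true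
edge-right a b = trans (cong (δ a b b a ∨_) (δ-refl b a)) (Boolₚ.∨-zeroʳ _)

edge-sym : ∀ {m} (a b : Fin m) → Symmetric (edge a b)
edge-sym a b s t = trans (Boolₚ.∨-comm (δ a b s t) _) (cong₂ _∨_ (sym (δ-flip a b s t)) (sym (δ-flip b a s t)))

out-edge : ∀ {m} {a b : Fin m} → a ≢ b → ∀ w s →
  out (edge a b) w s ≡ (s == a) ▹ w a b + (s == b) ▹ w b a
out-edge {a = a} {b} a≢b w s = trans (out-⊕ (edge-⊕ a≢b) w s) (cong₂ _+_ (out-δ a b w s) (out-δ b a w s))

in-edge : ∀ {m} {a b : Fin m} → a ≢ b → ∀ w s →
  out (flip (edge a b)) (flip w) s ≡ (s == b) ▹ w a b + (s == a) ▹ w b a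
in-edge {a = a} {b} a≢b w s =
  trans (out-⊕ (⊕-flip (edge-⊕ a≢b)) (flip w) s) (cong₂ _+_ (in-δ a b w s) (in-δ b a w s))

total-edge : ∀ {m} {a b : Fin m} → a ≢ b → total (edge a b) ≡ 2
total-edge {a = a} {b} a≢b = trans (total-⊕ (edge-⊕ a≢b)) (cong₂ _+_ (total-δ a b) (total-δ b a))

-- The tags keep the palettes apart, so balances simply add, even at vertices shared by both arc
-- sets. Symmetry of `X` keeps the two arcs of an edge in the same part.
good-⊕ : ∀ {m} {X Y Z : Matrix m} → Symmetric X → Z ≐ X ⊕ Y → Good X → Good Y → Good Z
good-⊕ {X = X} {Y} {Z} symX d good₁ good₂ = record
  { _≟ᶜ_ = Sumₚ.≡-dec G₁._≟ᶜ_ G₂._≟ᶜ_ ; colour = f ; turns = turns′ ; balanced = bal }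
  where
    module G₁ = Good good₁
    module G₂ = Good good₂
    f = λ s t → if X s t then inj₁ (G₁.colour s t) else inj₂ (G₂.colour s t)
    on-X : ∀ {s t} → X s t ≡ true → f s t ≡ inj₁ (G₁.colour s t)
    on-X x = cong (if_then _ else _) x
    on-Y : ∀ {s t} → Y s t ≡ true → f s t ≡ inj₂ (G₂.colour s t)
    on-Y {s} {t} y = cong (if_then _ else _) (⊕-exclusive (⊕-comm d) s t y)
    turns′ : Turnless Z f
    turns′ {s} {t} p q e with ⊕-cases d s t p | ⊕-cases d t s q
    ... | inj₁ x | inj₁ x′ = G₁.turns x x′ (inj₁-injective (trans (sym (on-X x)) (trans e (on-X x′))))
    ... | inj₂ y | inj₂ y′ = G₂.turns y y′ (inj₂-injective (trans (sym (on-Y y)) (trans e (on-Y y′))))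
    ... | inj₁ x | inj₂ y′ = true≢false (trans (symX t s) x) (⊕-exclusive (⊕-comm d) t s y′)
    ... | inj₂ y | inj₁ x′ = true≢false (trans (symX s t) x′) (⊕-exclusive (⊕-comm d) s t y)
    bal : Balanced Z f
    bal φ v = begin
      out Z (λ s t → φ (f s t)) v ≡⟨ out-⊕ d _ v ⟩
      out X (λ s t → φ (f s t)) v + out Y (λ s t → φ (f s t)) v
        ≡⟨ cong₂ _+_ (out-cong X v λ t x → cong φ (on-X x)) (out-cong Y v λ t y → cong φ (on-Y y)) ⟩
      out X (λ s t → φ (inj₁ (G₁.colour s t))) v + out Y (λ s t → φ (inj₂ (G₂.colour s t))) v
        ≡⟨ cong₂ _+_ (G₁.balanced (φ ∘ inj₁) v) (G₂.balanced (φ ∘ inj₂) v) ⟩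
      out (flip X) (λ s t → φ (inj₁ (G₁.colour t s))) v + out (flip Y) (λ s t → φ (inj₂ (G₂.colour t s))) v
        ≡⟨ cong₂ _+_ (out-cong (flip X) v λ t x → cong φ (on-X x)) (out-cong (flip Y) v λ t y → cong φ (on-Y y)) ⟨
      out (flip X) (λ s t → φ (f t s)) v + out (flip Y) (λ s t → φ (f t s)) v ≡⟨ out-⊕ (⊕-flip d) _ v ⟨
      out (flip Z) (λ s t → φ (f t s)) v ∎
      where open ≡-Reasoning

-- A good colouring of A together with an invisible path joining a to c, whose colours are
-- α in the direction from a to c and β in the other direction.
record HalfGood {m} (A : Matrix m) (a c : Fin m) : Set₁ where
  field
    {Colour} : Set
    _≟ᶜ_     : DecidableEquality Colour
    colour   : Fin m → Fin m → Colour
    α β      : Colour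
    α≢β      : α ≢ β
    turns    : Turnless A colour
    balanced : ∀ (φ : Colour → ℕ) v →
      out A (λ s t → φ (colour s t)) v + ((v == a) ▹ φ α + (v == c) ▹ φ β) ≡
      out (flip A) (λ s t → φ (colour t s)) v + ((v == a) ▹ φ β + (v == c) ▹ φ α)

-- The removed edge becomes the invisible path; `turns` supplies the inequality of its two colours.
remove-edge : ∀ {m} {Z A : Matrix m} {a c} → a ≢ c → Z ≐ A ⊕ edge a c → Good Z → HalfGood A a c
remove-edge {Z = Z} {A} {a} {c} a≢c d good = record
  { _≟ᶜ_ = _≟ᶜ_ ; colour = colour ; α = colour a c ; β = colour c a
  ; α≢β = turns (⊕-right d a c (edge-left a c)) (⊕-right d c a (edge-right a c))
  ; turns = λ {s} {t} p q → turns (⊕-left d s t p) (⊕-left d t s q)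
  ; balanced = λ φ v → begin
      out A (λ s t → φ (colour s t)) v + ((v == a) ▹ φ (colour a c) + (v == c) ▹ φ (colour c a))
        ≡⟨ cong (out A _ v +_) (out-edge a≢c _ v) ⟨
      out A (λ s t → φ (colour s t)) v + out (edge a c) (λ s t → φ (colour s t)) v
        ≡⟨ out-⊕ d _ v ⟨
      out Z (λ s t → φ (colour s t)) v
        ≡⟨ balanced φ v ⟩
      out (flip Z) (λ s t → φ (colour t s)) v
        ≡⟨ out-⊕ (⊕-flip d) _ v ⟩
      out (flip A) (λ s t → φ (colour t s)) v + out (flip (edge a c)) (λ s t → φ (colour t s)) v
        ≡⟨ cong (out (flip A) _ v +_) (trans (in-edge a≢c _ v) (+-comm ((v == c) ▹ _) _)) ⟩
      out (flip A) (λ s t → φ (colour t s)) v + ((v == a) ▹ φ (colour c a) + (v == c) ▹ φ (colour a c)) ∎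
  }
  where
    open Good good
    open ≡-Reasoning

opaque
  unfolding out

  out-empty : ∀ {m} (X : Matrix m) w s → (∀ t → X s t ≡ false) → out X w s ≡ 0
  out-empty {m} X w s e = trans (sum-cong {m} λ t → cong (_▹ w s t) (e t)) (sum-zero m)

-- At `p` only the edge to `c` and the end of the invisible path meet. Testing balance there with
-- the indicators of `α` and `β` forces the arc from `p` to `c` to continue `α` and the arc from `c`
-- to `p` to supply `β`, so the invisible path can absorb the edge.
contract : ∀ {m} {B A : Matrix m} {a p c} → a ≢ p → c ≢ p → B ≐ A ⊕ edge p c →
  (∀ t → A p t ≡ false) → (∀ t → A t p ≡ false) → HalfGood B a p → HalfGood A a c
contract {B = B} {A} {a} {p} {c} a≢p c≢p d isolated isolated′ half = record
  { _≟ᶜ_ = _≟ᶜ_ ; colour = colour ; α = α ; β = β ; α≢β = α≢β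
  ; turns = λ {s} {t} x y → turns (⊕-left d s t x) (⊕-left d t s y)
  ; balanced = bal }
  where
    open HalfGood half
    open ≡-Reasoning

    expand : ∀ φ v →
      (out A (λ s t → φ (colour s t)) v + ((v == p) ▹ φ (colour p c) + (v == c) ▹ φ (colour c p)))
        + ((v == a) ▹ φ α + (v == p) ▹ φ β) ≡
      (out (flip A) (λ s t → φ (colour t s)) v + ((v == c) ▹ φ (colour p c) + (v == p) ▹ φ (colour c p)))
        + ((v == a) ▹ φ β + (v == p) ▹ φ α)
    expand φ v = trans
      (cong (_+ _) (sym (trans (out-⊕ d _ v) (cong (out A _ v +_) (out-edge (≢-sym c≢p) _ v)))))
      (trans (balanced φ v)
      (cong (_+ _) (trans (out-⊕ (⊕-flip d) _ v) (cong (out (flip A) _ v +_) (in-edge (≢-sym c≢p) _ v)))))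

    at-p : ∀ φ → φ (colour p c) + φ β ≡ φ (colour c p) + φ α
    at-p φ with expand φ p
    ... | e rewrite out-empty A (λ s t → φ (colour s t)) p isolated
                  | out-empty (flip A) (λ s t → φ (colour t s)) p isolated′
                  | ==-refl p | ==-≢ (≢-sym a≢p) | ==-≢ (≢-sym c≢p)
                  | +-identityʳ (φ (colour p c)) = e

    ind : Colour → Colour → ℕ
    ind k x = b2n (does (x ≟ᶜ k))

    ind≡ : ∀ {k x} → x ≡ k → ind k x ≡ 1
    ind≡ {k} {x} e = cong b2n (dec-true (x ≟ᶜ k) e)

    ind≢ : ∀ {k x} → x ≢ k → ind k x ≡ 0
    ind≢ {k} {x} e = cong b2n (dec-false (x ≟ᶜ k) e)

    pc≡α : colour p c ≡ α
    pc≡α = decidable-stable (colour p c ≟ᶜ α) λ ne → contradiction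
      (trans (sym (cong₂ _+_ (ind≢ ne) (ind≢ (≢-sym α≢β)))) (trans (at-p (ind α)) (trans (cong (ind α (colour c p) +_) (ind≡ refl)) (+-comm _ 1))))
      λ ()

    cp≡β : colour c p ≡ β
    cp≡β = decidable-stable (colour c p ≟ᶜ β) λ ne → contradiction
      (trans (sym (cong₂ _+_ (ind≢ ne) (ind≢ α≢β))) (trans (sym (at-p (ind β))) (trans (cong (ind β (colour p c) +_) (ind≡ refl)) (+-comm _ 1))))
      λ ()

    left : ∀ o pα pβ aα cβ → o + (pα + cβ) + (aα + pβ) ≡ o + (aα + cβ) + (pα + pβ)
    left = solve-∀
    right : ∀ i pα pβ aβ cα → i + (cα + pβ) + (aβ + pα) ≡ i + (aβ + cα) + (pα + pβ)
    right = solve-∀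

    bal : ∀ φ v → out A (λ s t → φ (colour s t)) v + ((v == a) ▹ φ α + (v == c) ▹ φ β) ≡
      out (flip A) (λ s t → φ (colour t s)) v + ((v == a) ▹ φ β + (v == c) ▹ φ α)
    bal φ v with expand φ v
    ... | e rewrite pc≡α | cp≡β = +-cancelʳ-≡ (at p α + at p β) _ _
      (trans (sym (left (out A (λ s t → φ (colour s t)) v) (at p α) (at p β) (at a α) (at c β)))
      (trans e (right (out (flip A) (λ s t → φ (colour t s)) v) (at p α) (at p β) (at a β) (at c α))))
      where
        at : _ → Colour → ℕ
        at u k = (v == u) ▹ φ k

-- Recolouring the arcs D of a monochromatic directed path from a to c with a new colour
-- leaves the old colour unsaturated, so that it can leave A at a and come back at c.
recolour : ∀ {m} {A D : Matrix m} {a c} (good : Good A) → let open Good good in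
  D ⊆ A → (∀ {s t} → D s t ≡ true → D t s ≡ true → ⊥) →
  (k : Colour) → (∀ {s t} → D s t ≡ true → colour s t ≡ k) →
  (∀ x v → out D (λ _ _ → x) v + (v == c) ▹ x ≡ out (flip D) (λ _ _ → x) v + (v == a) ▹ x) →
  HalfGood A a c
recolour {m} {A} {D} {a} {c} good D⊆A antisym k mono path = record
  { _≟ᶜ_ = Maybeₚ.≡-dec _≟ᶜ_ ; colour = f ; α = just k ; β = nothing ; α≢β = λ ()
  ; turns = turns′ ; balanced = bal }
  where
    open Good good
    f : Fin m → Fin m → Maybe Colour
    f s t = if D s t then nothing else just (colour s t)

    on-D : ∀ {s t} → D s t ≡ true → f s t ≡ nothing
    on-D e = cong (if_then _ else _) e
    off-D : ∀ {s t} → D s t ≡ false → f s t ≡ just (colour s t)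
    off-D e = cong (if_then _ else _) e
    off-rest : ∀ {s t} → (A ∖ D) s t ≡ true → f s t ≡ just (colour s t)
    off-rest {s} {t} e = off-D (not-true (proj₂ (∧-true {A s t} e)))

    clash : ∀ {x y : Maybe Colour} {z} → x ≡ y → x ≡ nothing → y ≡ just z → ⊥
    clash refl refl ()

    turns′ : Turnless A f
    turns′ {s} {t} p q e with D s t in e₁ | D t s in e₂
    ... | true  | true  = antisym e₁ e₂
    ... | false | false = turns p q (just-injective e)

    d = ∖-⊕ {Y = D} D⊆A
    o i : (Fin m → Fin m → ℕ) → Fin m → ℕ
    o w = out (A ∖ D) w
    i w = out (flip (A ∖ D)) (flip w)

    old : ∀ (φ : Maybe Colour → ℕ) v →
      o (λ s t → φ (just (colour s t))) v + out D (λ _ _ → φ (just k)) v ≡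
      i (λ s t → φ (just (colour s t))) v + out (flip D) (λ _ _ → φ (just k)) v
    old φ v = trans
      (sym (trans (out-⊕ d _ v) (cong (o _ v +_) (out-cong D v λ t e → cong (φ ∘ just) (mono e)))))
      (trans (balanced (φ ∘ just) v)
      (trans (out-⊕ (⊕-flip d) _ v) (cong (i _ v +_) (out-cong (flip D) v λ t e → cong (φ ∘ just) (mono e)))))

    new-out : ∀ φ v → out A (λ s t → φ (f s t)) v ≡
      o (λ s t → φ (just (colour s t))) v + out D (λ _ _ → φ nothing) v
    new-out φ v = trans (out-⊕ d _ v) (cong₂ _+_
      (out-cong (A ∖ D) v λ t e → cong φ (off-rest e)) (out-cong D v λ t e → cong φ (on-D e)))

    new-in : ∀ φ v → out (flip A) (λ s t → φ (f t s)) v ≡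
      i (λ s t → φ (just (colour s t))) v + out (flip D) (λ _ _ → φ nothing) v
    new-in φ v = trans (out-⊕ (⊕-flip d) _ v) (cong₂ _+_
      (out-cong (flip (A ∖ D)) v λ t e → cong φ (off-rest e)) (out-cong (flip D) v λ t e → cong φ (on-D e)))

    arith : ∀ {o i dO dI dO′ dI′ aα cα an cn} → o + dO ≡ i + dI → dO + cα ≡ dI + aα → dO′ + cn ≡ dI′ + an →
      o + dO′ + (aα + cn) ≡ i + dI′ + (an + cα)
    arith {o} {i} {dO} {dI} {dO′} {dI′} {aα} {cα} {an} {cn} h₁ h₂ h₃ = +-cancelʳ-≡ (dI + dO) _ _ (begin
      o + dO′ + (aα + cn) + (dI + dO)     ≡⟨ r₁ o dO′ aα cn dI dO ⟩
      (o + dO) + (dI + aα) + (dO′ + cn)   ≡⟨ cong₂ _+_ (cong₂ _+_ h₁ (sym h₂)) h₃ ⟩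
      (i + dI) + (dO + cα) + (dI′ + an)   ≡⟨ r₂ i dI′ an cα dI dO ⟩
      i + dI′ + (an + cα) + (dI + dO)     ∎)
      where
        open ≡-Reasoning
        r₁ : ∀ o dO′ aα cn dI dO → o + dO′ + (aα + cn) + (dI + dO) ≡ (o + dO) + (dI + aα) + (dO′ + cn)
        r₁ = solve-∀
        r₂ : ∀ i dI′ an cα dI dO → (i + dI) + (dO + cα) + (dI′ + an) ≡ i + dI′ + (an + cα) + (dI + dO)
        r₂ = solve-∀

    bal : ∀ φ v → out A (λ s t → φ (f s t)) v + ((v == a) ▹ φ (just k) + (v == c) ▹ φ nothing) ≡
      out (flip A) (λ s t → φ (f t s)) v + ((v == a) ▹ φ nothing + (v == c) ▹ φ (just k))
    bal φ v = trans (cong (_+ _) (new-out φ v))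
      (trans (arith {o = o (λ s t → φ (just (colour s t))) v} {i = i (λ s t → φ (just (colour s t))) v}
               {dO = out D (λ _ _ → φ (just k)) v} {dI = out (flip D) (λ _ _ → φ (just k)) v}
               {dO′ = out D (λ _ _ → φ nothing) v} {dI′ = out (flip D) (λ _ _ → φ nothing) v}
               {aα = (v == a) ▹ φ (just k)} {cα = (v == c) ▹ φ (just k)}
               {an = (v == a) ▹ φ nothing} {cn = (v == c) ▹ φ nothing}
               (old φ v) (path (φ (just k)) v) (path (φ nothing) v))
      (cong (_+ _) (sym (new-in φ v))))

-- A substitute for a parallel edge `a c`, which a simple graph cannot have: the colour of one arc
-- of the existing edge is set free.
recolour-arc : ∀ {m} {A : Matrix m} {a c} → Irreflexive A → Good A → A a c ≡ true → HalfGood A a c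
recolour-arc {A = A} {a} {c} irr good Aac = recolour {D = δ a c} good (δ⊆ A Aac)
  (λ {s} {t} p q → absurd (δ-sound a c s t p) (δ-sound a c t s q))
  (colour a c) (λ {s} {t} p → lemma (δ-sound a c s t p))
  λ x v → trans (cong (_+ (v == c) ▹ x) (out-δ a c _ v)) (trans (+-comm ((v == a) ▹ x) _)
    (cong (_+ (v == a) ▹ x) (sym (in-δ a c _ v))))
  where
    open Good good
    absurd : ∀ {s t} → s ≡ a × t ≡ c → t ≡ a × s ≡ c → ⊥
    absurd (refl , refl) (refl , _) = true≢false Aac (irr a)
    lemma : ∀ {s t} → s ≡ a × t ≡ c → colour s t ≡ colour a c
    lemma (refl , refl) = refl

-- Here the monochromatic path has two arcs. The hypothesis `a ≢ c` prevents them from being the two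
-- directions of one edge.
recolour-path : ∀ {m} {A : Matrix m} {a x c} → Irreflexive A → (good : Good A) → a ≢ c →
  A a x ≡ true → A x c ≡ true → Good.colour good a x ≡ Good.colour good x c → HalfGood A a c
recolour-path {A = A} {a} {x} {c} irr good a≢c Aax Axc mono = recolour {D = δ a x ∪ δ x c} good
  (λ s t e → [ δ⊆ A Aax s t , δ⊆ A Axc s t ]′ (⊕-cases D⊕ s t e))
  (λ {s} {t} p q → absurd (sound p) (sound q))
  (colour a x) (λ p → lemma (sound p))
  λ y v → trans (cong (_+ (v == c) ▹ y) (trans (out-⊕ D⊕ _ v) (cong₂ _+_ (out-δ a x _ v) (out-δ x c _ v))))
    (trans (ring ((v == a) ▹ y) ((v == x) ▹ y) ((v == c) ▹ y))
    (cong (_+ (v == a) ▹ y) (sym (trans (out-⊕ (⊕-flip D⊕) _ v) (cong₂ _+_ (in-δ a x _ v) (in-δ x c _ v))))))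
  where
    open Good good
    a≢x : a ≢ x
    a≢x refl = true≢false Aax (irr a)
    x≢c : x ≢ c
    x≢c refl = true≢false Axc (irr c)
    D⊕ : δ a x ∪ δ x c ≐ δ a x ⊕ δ x c
    D⊕ = ∪-⊕ λ {s} {t} p q → a≢x (trans (sym (proj₁ (δ-sound a x s t p))) (proj₁ (δ-sound x c s t q)))
    sound : ∀ {s t} → (δ a x ∪ δ x c) s t ≡ true → (s ≡ a × t ≡ x) ⊎ (s ≡ x × t ≡ c)
    sound {s} {t} e with ⊕-cases D⊕ s t e
    ... | inj₁ p = inj₁ (δ-sound a x s t p)
    ... | inj₂ p = inj₂ (δ-sound x c s t p)
    absurd : ∀ {s t} → (s ≡ a × t ≡ x) ⊎ (s ≡ x × t ≡ c) → (t ≡ a × s ≡ x) ⊎ (t ≡ x × s ≡ c) → ⊥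
    absurd (inj₁ (refl , refl)) (inj₁ (refl , _)) = a≢x refl
    absurd (inj₁ (refl , refl)) (inj₂ (_ , e)) = a≢c e
    absurd (inj₂ (refl , refl)) (inj₁ (e , _)) = a≢c (sym e)
    absurd (inj₂ (refl , refl)) (inj₂ (e , _)) = x≢c (sym e)
    lemma : ∀ {s t} → (s ≡ a × t ≡ x) ⊎ (s ≡ x × t ≡ c) → colour s t ≡ colour a x
    lemma (inj₁ (refl , refl)) = refl
    lemma (inj₂ (refl , refl)) = sym mono
    ring : ∀ a x c → (a + x) + c ≡ (x + c) + a
    ring = solve-∀

-- The edge and the invisible path form a closed walk, and each of the two colours goes round it
-- once, in opposite directions.
half-edge : ∀ {m} {A : Matrix m} {a c} → a ≢ c → (∀ s t → A s t ≡ edge a c s t) → HalfGood A a c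
half-edge {A = A} {a} {c} a≢c A≡ = record
  { _≟ᶜ_ = Boolₚ._≟_ ; colour = f ; α = true ; β = false ; α≢β = λ () ; turns = turns′ ; balanced = bal }
  where
    f = δ c a
    fca : f c a ≡ true
    fca = δ-refl c a
    fac : f a c ≡ false
    fac = pairs-distinct (a≢c ∘ proj₁)
    turns′ : Turnless A f
    turns′ {s} {t} p _ e with edge-sound a c s t (trans (sym (A≡ s t)) p)
    ... | inj₁ (refl , refl) = true≢false fca (trans (sym e) fac)
    ... | inj₂ (refl , refl) = true≢false fca (trans e fac)
    ring : ∀ aβ cα aα cβ → aβ + cα + (aα + cβ) ≡ cβ + aα + (aβ + cα)
    ring = solve-∀
    bal : ∀ (φ : Bool → ℕ) v → out A (λ s t → φ (f s t)) v + ((v == a) ▹ φ true + (v == c) ▹ φ false) ≡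
      out (flip A) (λ s t → φ (f t s)) v + ((v == a) ▹ φ false + (v == c) ▹ φ true)
    bal φ v = begin
      out A (λ s t → φ (f s t)) v + (at a true + at c false)
        ≡⟨ cong (_+ (at a true + at c false)) (trans (out-mask-cong {X = A} {edge a c} (λ s t → φ (f s t)) v (A≡ v)) (out-edge a≢c (λ s t → φ (f s t)) v)) ⟩
      at a (f a c) + at c (f c a) + (at a true + at c false)
        ≡⟨ cong₂ (λ x y → at a x + at c y + (at a true + at c false)) fac fca ⟩
      at a false + at c true + (at a true + at c false)
        ≡⟨ ring (at a false) (at c true) (at a true) (at c false) ⟩
      at c false + at a true + (at a false + at c true)
        ≡⟨ cong₂ (λ x y → at c x + at a y + (at a false + at c true)) fac fca ⟨
      at c (f a c) + at a (f c a) + (at a false + at c true)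
        ≡⟨ cong (_+ (at a false + at c true)) (trans (out-mask-cong {X = flip A} {flip (edge a c)} (λ s t → φ (f t s)) v (λ t → A≡ t v))
                              (in-edge a≢c (λ s t → φ (f s t)) v)) ⟨
      out (flip A) (λ s t → φ (f t s)) v + (at a false + at c true) ∎
      where
        open ≡-Reasoning
        at : _ → Bool → ℕ
        at u k = (v == u) ▹ φ k

-- The invisible path is closed at `a`, where both of its colours enter as well as leave. This is
-- the half consisting of a single vertex of degree two.
half-empty : ∀ {m} {A : Matrix m} a → (∀ s t → A s t ≡ false) → HalfGood A a a
half-empty {A = A} a empty = record
  { _≟ᶜ_ = Boolₚ._≟_ ; colour = λ _ _ → true ; α = true ; β = false ; α≢β = λ ()
  ; turns = λ {s} {t} p _ _ → true≢false p (empty s t)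
  ; balanced = λ φ v → cong₂ _+_
      (trans (out-empty A _ v (empty v)) (sym (out-empty (flip A) _ v (λ t → empty t v))))
      (+-comm ((v == a) ▹ φ true) _) }

-- The edges `a b` and `c d` are a 2-cut with sides `A₁` and `A₂`. Each side, together with the cut
-- edges, serves as the invisible path of the other.
module _ {m} {A₁ A₂ W V Z : Matrix m} {a b c d : Fin m} (a≢b : a ≢ b) (c≢d : c ≢ d)
         (sym₁ : Symmetric A₁) (sym₂ : Symmetric A₂)
         (W⊕ : W ≐ A₁ ⊕ A₂) (V⊕ : V ≐ edge a b ⊕ edge c d) (Z⊕ : Z ≐ W ⊕ V)
         (half₁ : HalfGood A₁ a c) (half₂ : HalfGood A₂ b d) where
  private
    module H₁ = HalfGood half₁
    module H₂ = HalfGood half₂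

    C = H₁.Colour ⊎ H₂.Colour

    -- In `half₁` the colour `α` takes the invisible path from `a` to `c`, now realised as
    -- `a b … d c`, so it must run through `A₂` from `b` to `d`. The colour of `half₂` with this
    -- flow on its visible arcs is `β`, whose invisible part leads from `d` to `b`. Hence `κ`
    -- identifies `β` of `half₂` with `α` of `half₁`, and `α` with `β`.
    κ : H₂.Colour → C
    κ x = if does (x H₂.≟ᶜ H₂.α) then inj₁ H₁.β else if does (x H₂.≟ᶜ H₂.β) then inj₁ H₁.α else inj₂ x

    κα : κ H₂.α ≡ inj₁ H₁.β
    κα rewrite dec-true (H₂.α H₂.≟ᶜ H₂.α) refl = refl

    κβ : κ H₂.β ≡ inj₁ H₁.α
    κβ rewrite dec-false (H₂.β H₂.≟ᶜ H₂.α) (≢-sym H₂.α≢β) | dec-true (H₂.β H₂.≟ᶜ H₂.β) refl = refl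

    κ-injective : ∀ {x y} → κ x ≡ κ y → x ≡ y
    κ-injective {x} {y} e with x H₂.≟ᶜ H₂.α | y H₂.≟ᶜ H₂.α | x H₂.≟ᶜ H₂.β | y H₂.≟ᶜ H₂.β
    ... | yes refl | yes refl | _ | _ = refl
    ... | no _ | no _ | yes refl | yes refl = refl
    ... | no _ | no _ | no _ | no _ = inj₂-injective e
    ... | yes _ | no _ | _ | yes _ = contradiction (sym (inj₁-injective e)) H₁.α≢β
    ... | no _ | yes _ | yes _ | _ = contradiction (inj₁-injective e) H₁.α≢β
    κ-injective () | yes _ | no _ | _ | no _
    κ-injective () | no _ | yes _ | no _ | _
    κ-injective () | no _ | no _ | yes _ | no _
    κ-injective () | no _ | no _ | no _ | yes _

    f : Fin m → Fin m → C
    f s t = if A₁ s t then inj₁ (H₁.colour s t) else if A₂ s t then κ (H₂.colour s t)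
            else if δ a b s t ∨ δ d c s t then inj₁ H₁.α else inj₁ H₁.β

    on₁ : ∀ {s t} → A₁ s t ≡ true → f s t ≡ inj₁ (H₁.colour s t)
    on₁ {s} {t} e = cong (if_then inj₁ (H₁.colour s t) else if A₂ s t then κ (H₂.colour s t)
      else if δ a b s t ∨ δ d c s t then inj₁ H₁.α else inj₁ H₁.β) e

    on₂ : ∀ {s t} → A₂ s t ≡ true → f s t ≡ κ (H₂.colour s t)
    on₂ {s} {t} e rewrite ⊕-exclusive (⊕-comm W⊕) s t e | e = refl

    on-V : ∀ {s t} → V s t ≡ true → f s t ≡ (if δ a b s t ∨ δ d c s t then inj₁ H₁.α else inj₁ H₁.β)
    on-V {s} {t} e with W s t in w | ⊕-exclusive (⊕-comm Z⊕) s t e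
    ... | false | _ with A₁ s t in e₁ | A₂ s t in e₂
    ...   | true  | _     = contradiction w (true≢false (⊕-left W⊕ s t e₁))
    ...   | false | true  = contradiction w (true≢false (⊕-right W⊕ s t e₂))
    ...   | false | false = refl

    not-both : ¬ (a ≡ c × b ≡ d)
    not-both (refl , refl) = true≢false (edge-left c d) (⊕-exclusive V⊕ c d (edge-left c d))

    V-ab : V a b ≡ true
    V-ab = ⊕-left V⊕ a b (edge-left a b)
    V-ba : V b a ≡ true
    V-ba = ⊕-left V⊕ b a (edge-right a b)
    V-cd : V c d ≡ true
    V-cd = ⊕-right V⊕ c d (edge-left c d)
    V-dc : V d c ≡ true
    V-dc = ⊕-right V⊕ d c (edge-right c d)

    f-ab : f a b ≡ inj₁ H₁.α
    f-ab = trans (on-V V-ab) (cong (λ x → if x ∨ δ d c a b then inj₁ H₁.α else inj₁ H₁.β) (δ-refl a b))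
    f-dc : f d c ≡ inj₁ H₁.α
    f-dc = trans (on-V V-dc) (cong (if_then inj₁ H₁.α else inj₁ H₁.β)
      (trans (cong (δ a b d c ∨_) (δ-refl d c)) (Boolₚ.∨-zeroʳ _)))
    f-ba : f b a ≡ inj₁ H₁.β
    f-ba = trans (on-V V-ba) (cong (if_then inj₁ H₁.α else inj₁ H₁.β)
      (cong₂ _∨_ (pairs-distinct {a = a} {b} {b} {a} (λ (e , _) → a≢b (sym e)))
                 (pairs-distinct {a = d} {c} {b} {a} (λ (e , e′) → not-both (e′ , e)))))
    f-cd : f c d ≡ inj₁ H₁.β
    f-cd = trans (on-V V-cd) (cong (if_then inj₁ H₁.α else inj₁ H₁.β)
      (cong₂ _∨_ (pairs-distinct {a = a} {b} {c} {d} (λ (e , e′) → not-both (sym e , sym e′)))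
                 (pairs-distinct {a = d} {c} {c} {d} (λ (e , _) → c≢d e))))

    V-cases : ∀ {s t} → V s t ≡ true → (f s t ≡ inj₁ H₁.α × f t s ≡ inj₁ H₁.β) ⊎ (f s t ≡ inj₁ H₁.β × f t s ≡ inj₁ H₁.α)
    V-cases {s} {t} e with ⊕-cases V⊕ s t e
    ... | inj₁ x with edge-sound a b s t x
    ...   | inj₁ (refl , refl) = inj₁ (f-ab , f-ba)
    ...   | inj₂ (refl , refl) = inj₂ (f-ba , f-ab)
    V-cases {s} {t} e | inj₂ x with edge-sound c d s t x
    ...   | inj₁ (refl , refl) = inj₂ (f-cd , f-dc)
    ...   | inj₂ (refl , refl) = inj₁ (f-dc , f-cd)

    turns′ : Turnless Z f
    turns′ {s} {t} p _ e with ⊕-cases Z⊕ s t p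
    turns′ {s} {t} p _ e | inj₂ v with V-cases v
    ... | inj₁ (x , y) = H₁.α≢β (inj₁-injective (trans (sym x) (trans e y)))
    ... | inj₂ (x , y) = H₁.α≢β (sym (inj₁-injective (trans (sym x) (trans e y))))
    turns′ {s} {t} p _ e | inj₁ w with ⊕-cases W⊕ s t w
    ... | inj₁ x = H₁.turns x x′ (inj₁-injective (trans (sym (on₁ x)) (trans e (on₁ x′))))
      where x′ = trans (sym₁ t s) x
    ... | inj₂ x = H₂.turns x x′ (κ-injective (trans (sym (on₂ x)) (trans e (on₂ x′))))
      where x′ = trans (sym₂ t s) x

    ring : ∀ o₁ o₂ aα aβ bα bβ cα cβ dα dβ i₁ i₂ →
      o₁ + (aα + cβ) ≡ i₁ + (aβ + cα) → o₂ + (bβ + dα) ≡ i₂ + (bα + dβ) →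
      o₁ + o₂ + (aα + bβ + (cβ + dα)) ≡ i₁ + i₂ + (bα + aβ + (dβ + cα))
    ring o₁ o₂ aα aβ bα bβ cα cβ dα dβ i₁ i₂ h₁ h₂ =
      trans (r₁ o₁ o₂ aα bβ cβ dα) (trans (cong₂ _+_ h₁ h₂) (r₂ i₁ i₂ aβ bα cα dβ))
      where
        r₁ : ∀ o₁ o₂ aα bβ cβ dα → o₁ + o₂ + (aα + bβ + (cβ + dα)) ≡ (o₁ + (aα + cβ)) + (o₂ + (bβ + dα))
        r₁ = solve-∀
        r₂ : ∀ i₁ i₂ aβ bα cα dβ → (i₁ + (aβ + cα)) + (i₂ + (bα + dβ)) ≡ i₁ + i₂ + (bα + aβ + (dβ + cα))
        r₂ = solve-∀

    out-Z : ∀ φ v → out Z (λ s t → φ (f s t)) v ≡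
      out A₁ (λ s t → φ (inj₁ (H₁.colour s t))) v + out A₂ (λ s t → φ (κ (H₂.colour s t))) v
      + ((v == a) ▹ φ (inj₁ H₁.α) + (v == b) ▹ φ (inj₁ H₁.β) + ((v == c) ▹ φ (inj₁ H₁.β) + (v == d) ▹ φ (inj₁ H₁.α)))
    out-Z φ v = trans (out-⊕ Z⊕ _ v) (cong₂ _+_
      (trans (out-⊕ W⊕ _ v) (cong₂ _+_ (out-cong A₁ v λ t e → cong φ (on₁ e)) (out-cong A₂ v λ t e → cong φ (on₂ e))))
      (trans (out-⊕ V⊕ _ v) (cong₂ _+_
        (trans (out-edge a≢b _ v) (cong₂ (λ x y → (v == a) ▹ φ x + (v == b) ▹ φ y) f-ab f-ba))
        (trans (out-edge c≢d _ v) (cong₂ (λ x y → (v == c) ▹ φ x + (v == d) ▹ φ y) f-cd f-dc)))))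

    in-Z : ∀ φ v → out (flip Z) (λ s t → φ (f t s)) v ≡
      out (flip A₁) (λ s t → φ (inj₁ (H₁.colour t s))) v + out (flip A₂) (λ s t → φ (κ (H₂.colour t s))) v
      + ((v == b) ▹ φ (inj₁ H₁.α) + (v == a) ▹ φ (inj₁ H₁.β) + ((v == d) ▹ φ (inj₁ H₁.β) + (v == c) ▹ φ (inj₁ H₁.α)))
    in-Z φ v = trans (out-⊕ (⊕-flip Z⊕) _ v) (cong₂ _+_
      (trans (out-⊕ (⊕-flip W⊕) _ v) (cong₂ _+_ (out-cong (flip A₁) v λ t e → cong φ (on₁ e)) (out-cong (flip A₂) v λ t e → cong φ (on₂ e))))
      (trans (out-⊕ (⊕-flip V⊕) _ v) (cong₂ _+_
        (trans (in-edge a≢b (λ s t → φ (f s t)) v) (cong₂ (λ x y → (v == b) ▹ φ x + (v == a) ▹ φ y) f-ab f-ba))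
        (trans (in-edge c≢d (λ s t → φ (f s t)) v) (cong₂ (λ x y → (v == d) ▹ φ x + (v == c) ▹ φ y) f-cd f-dc)))))

    half₂-balanced : ∀ φ v →
      out A₂ (λ s t → φ (κ (H₂.colour s t))) v + ((v == b) ▹ φ (inj₁ H₁.β) + (v == d) ▹ φ (inj₁ H₁.α)) ≡
      out (flip A₂) (λ s t → φ (κ (H₂.colour t s))) v + ((v == b) ▹ φ (inj₁ H₁.α) + (v == d) ▹ φ (inj₁ H₁.β))
    half₂-balanced φ v = subst₂
      (λ x y → out A₂ (λ s t → φ (κ (H₂.colour s t))) v + ((v == b) ▹ φ x + (v == d) ▹ φ y) ≡
               out (flip A₂) (λ s t → φ (κ (H₂.colour t s))) v + ((v == b) ▹ φ y + (v == d) ▹ φ x))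
      κα κβ (H₂.balanced (φ ∘ κ) v)

    at : (C → ℕ) → Fin m → Fin m → H₁.Colour → ℕ
    at φ v u k = (v == u) ▹ φ (inj₁ k)

  glue : Good Z
  glue = record
    { _≟ᶜ_ = Sumₚ.≡-dec H₁._≟ᶜ_ H₂._≟ᶜ_ ; colour = f ; turns = turns′
    ; balanced = λ φ v → trans (out-Z φ v) (trans
        (ring (out A₁ (λ s t → φ (inj₁ (H₁.colour s t))) v) (out A₂ (λ s t → φ (κ (H₂.colour s t))) v)
          (at φ v a H₁.α) (at φ v a H₁.β) (at φ v b H₁.α) (at φ v b H₁.β)
          (at φ v c H₁.α) (at φ v c H₁.β) (at φ v d H₁.α) (at φ v d H₁.β)
          (out (flip A₁) (λ s t → φ (inj₁ (H₁.colour t s))) v) (out (flip A₂) (λ s t → φ (κ (H₂.colour t s))) v)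
          (H₁.balanced (φ ∘ inj₁) v) (half₂-balanced φ v))
        (sym (in-Z φ v))) }

-- Splitting off a vertex of degree two

-- `zero` is the new vertex, and `B` is meant to be the graph from which the edges joining `x₁` and
-- `x₂` to the old vertex have been removed.
splitOff : ∀ {m} → Matrix m → Fin m → Fin m → Matrix (suc m)
splitOff B x₁ x₂ zero    zero    = false
splitOff B x₁ x₂ zero    (suc t) = (t == x₁) ∨ (t == x₂)
splitOff B x₁ x₂ (suc s) zero    = (s == x₁) ∨ (s == x₂)
splitOff B x₁ x₂ (suc s) (suc t) = B s t

∨-▹ : ∀ {x y} m → (x ≡ true → y ≡ true → ⊥) → (x ∨ y) ▹ m ≡ x ▹ m + y ▹ m
∨-▹ {x} {y} m d = ▹-split {x ∨ y} {x} {y} m (b2n-∨ d)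

module _ {m} {A B F : Matrix m} {v x₁ x₂ : Fin m} (v≢x₁ : v ≢ x₁) (v≢x₂ : v ≢ x₂) (x₁≢x₂ : x₁ ≢ x₂)
         (symA : Symmetric A) (symB : Symmetric B) (A⊕ : A ≐ B ⊕ F) (F⊕ : F ≐ edge v x₁ ⊕ edge v x₂) where

  private
    K = splitOff B x₁ x₂

    choose : ∀ s k → ((s == x₁) ∨ (s == x₂)) ▹ k ≡ (s == x₁) ▹ k + (s == x₂) ▹ k
    choose s k = ∨-▹ {s == x₁} {s == x₂} k λ p q → x₁≢x₂ (trans (sym (==-sound {u = s} p)) (==-sound {u = s} q))

  opaque
    unfolding out

    out-split-suc : ∀ w s → out K w (suc s) ≡
      (s == x₁) ▹ w (suc s) zero + (s == x₂) ▹ w (suc s) zero + out B (λ s t → w (suc s) (suc t)) s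
    out-split-suc w s = cong (_+ out B (λ s t → w (suc s) (suc t)) s) (choose s (w (suc s) zero))

    out-split-zero : ∀ w → out K w zero ≡ w zero (suc x₁) + w zero (suc x₂)
    out-split-zero w = trans (sum-cong {m} (λ t → choose t (w zero (suc t))))
      (trans (sum-+ {m} (λ t → (t == x₁) ▹ w zero (suc t)) (λ t → (t == x₂) ▹ w zero (suc t)))
             (cong₂ _+_ (sum-pick {m} x₁ _) (sum-pick {m} x₂ _)))

  splitOff-sym : Symmetric K
  splitOff-sym zero    zero    = refl
  splitOff-sym zero    (suc t) = refl
  splitOff-sym (suc s) zero    = refl
  splitOff-sym (suc s) (suc t) = symB s t

  -- Since the number of edges is unchanged, the minimality of edges says nothing about the split
  -- graph; the maximality of vertices has to decide.
  total-splitOff : total K ≡ total A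
  total-splitOff = begin
    total K
      ≡⟨ total-out K ⟩
    out K _ zero + sumFin m (λ s → out K _ (suc s))
      ≡⟨ cong₂ _+_ (out-split-zero _) (sum-cong {m} (out-split-suc _)) ⟩
    2 + sumFin m (λ s → (s == x₁) ▹ 1 + (s == x₂) ▹ 1 + out B (λ _ _ → 1) s)
      ≡⟨ cong (2 +_) (trans (sum-+ {m} (λ s → (s == x₁) ▹ 1 + (s == x₂) ▹ 1) _) (cong₂ _+_
           (trans (sum-+ {m} (λ s → (s == x₁) ▹ 1) _) (cong₂ _+_ (sum-pick {m} x₁ _) (sum-pick {m} x₂ _)))
           (sym (total-out B)))) ⟩
    4 + total B
      ≡⟨ +-comm 4 _ ⟩
    total B + 4
      ≡⟨ cong (total B +_) (trans (total-⊕ F⊕) (cong₂ _+_ (total-edge v≢x₁) (total-edge v≢x₂))) ⟨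
    total B + total F
      ≡⟨ total-⊕ A⊕ ⟨
    total A ∎
    where open ≡-Reasoning

  -- Identifying `zero` with `v` adds the two balance equations, and every edge keeps its pair of
  -- colours. A proper colouring need not survive this step, as a colour may occur at both vertices.
  merge : Good K → Good A
  merge good = record { _≟ᶜ_ = _≟ᶜ_ ; colour = f ; turns = turns′ ; balanced = bal }
    where
      open Good good
      f : Fin m → Fin m → Colour
      f s t = if B s t then colour (suc s) (suc t) else if s == v then colour zero (suc t) else colour (suc s) zero

      on-B : ∀ {s t} → B s t ≡ true → f s t ≡ colour (suc s) (suc t)
      on-B {s} {t} e rewrite e = refl
      from-v : ∀ {t} → F v t ≡ true → f v t ≡ colour zero (suc t)
      from-v {t} e rewrite ⊕-exclusive (⊕-comm A⊕) v t e | ==-refl v = refl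
      to-v : ∀ {s} → s ≢ v → F s v ≡ true → f s v ≡ colour (suc s) zero
      to-v {s} ne e rewrite ⊕-exclusive (⊕-comm A⊕) s v e | ==-≢ ne = refl

      F-vx₁ = ⊕-left F⊕ v x₁ (edge-left v x₁)
      F-x₁v = ⊕-left F⊕ x₁ v (edge-right v x₁)
      F-vx₂ = ⊕-right F⊕ v x₂ (edge-left v x₂)
      F-x₂v = ⊕-right F⊕ x₂ v (edge-right v x₂)

      f-vx₁ = from-v F-vx₁
      f-vx₂ = from-v F-vx₂
      f-x₁v = to-v (≢-sym v≢x₁) F-x₁v
      f-x₂v = to-v (≢-sym v≢x₂) F-x₂v

      K-x₁ : K zero (suc x₁) ≡ true
      K-x₁ = cong (_∨ (x₁ == x₂)) (==-refl x₁)
      K-x₂ : K zero (suc x₂) ≡ true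
      K-x₂ = trans (cong ((x₂ == x₁) ∨_) (==-refl x₂)) (Boolₚ.∨-zeroʳ _)

      turns′ : Turnless A f
      turns′ {s} {t} p q e with ⊕-cases A⊕ s t p
      ... | inj₁ b = turns b b′ (trans (sym (on-B b)) (trans e (on-B b′)))
        where b′ = trans (symB t s) b
      ... | inj₂ x with ⊕-cases F⊕ s t x
      ...   | inj₁ y with edge-sound v x₁ s t y
      ...     | inj₁ (refl , refl) = turns K-x₁ K-x₁ (trans (sym f-vx₁) (trans e f-x₁v))
      ...     | inj₂ (refl , refl) = turns K-x₁ K-x₁ (trans (sym f-x₁v) (trans e f-vx₁))
      turns′ {s} {t} p q e | inj₂ x | inj₂ y with edge-sound v x₂ s t y
      ...     | inj₁ (refl , refl) = turns K-x₂ K-x₂ (trans (sym f-vx₂) (trans e f-x₂v))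
      ...     | inj₂ (refl , refl) = turns K-x₂ K-x₂ (trans (sym f-x₂v) (trans e f-vx₂))

      ▹-+ : ∀ b x y → b ▹ x + b ▹ y ≡ b ▹ (x + y)
      ▹-+ true  x y = refl
      ▹-+ false x y = refl

      out-merged : ∀ (w : Fin (suc m) → Fin (suc m) → ℕ) (g : Fin m → Fin m → ℕ) →
        (∀ {s t} → B s t ≡ true → g s t ≡ w (suc s) (suc t)) →
        (∀ {x} → x ≡ x₁ ⊎ x ≡ x₂ → g v x ≡ w zero (suc x) × g x v ≡ w (suc x) zero) →
        ∀ s → out A g s ≡ out K w (suc s) + (s == v) ▹ out K w zero
      out-merged w g on-B on-F s = begin
        out A g s
          ≡⟨ trans (out-⊕ A⊕ _ s) (cong₂ _+_ (out-cong B s λ t b → on-B b)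
               (trans (out-⊕ F⊕ _ s) (cong₂ _+_ (out-edge v≢x₁ _ s) (out-edge v≢x₂ _ s)))) ⟩
        o + (((s == v) ▹ g v x₁ + (s == x₁) ▹ g x₁ v) + ((s == v) ▹ g v x₂ + (s == x₂) ▹ g x₂ v))
          ≡⟨ cong (o +_) (cong₂ _+_ (both x₁ (on-F (inj₁ refl))) (both x₂ (on-F (inj₂ refl)))) ⟩
        o + ((V x₁ + X x₁) + (V x₂ + X x₂))
          ≡⟨ ring o (V x₁) (X x₁) (V x₂) (X x₂) ⟩
        (X x₁ + X x₂ + o) + (V x₁ + V x₂)
          ≡⟨ cong₂ (λ x y → x + o + y) (sym (cong₂ _+_ (localize x₁) (localize x₂))) (▹-+ (s == v) _ _) ⟩
        ((s == x₁) ▹ w (suc s) zero + (s == x₂) ▹ w (suc s) zero + o) + (s == v) ▹ (w zero (suc x₁) + w zero (suc x₂))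
          ≡⟨ cong₂ _+_ (out-split-suc w s) (cong ((s == v) ▹_) (out-split-zero w)) ⟨
        out K w (suc s) + (s == v) ▹ out K w zero ∎
        where
          open ≡-Reasoning
          o = out B (λ s t → w (suc s) (suc t)) s
          V X : Fin m → ℕ
          V x = (s == v) ▹ w zero (suc x)
          X x = (s == x) ▹ w (suc x) zero
          both : ∀ x → g v x ≡ w zero (suc x) × g x v ≡ w (suc x) zero →
            (s == v) ▹ g v x + (s == x) ▹ g x v ≡ V x + X x
          both x (e , e′) = cong₂ (λ y z → (s == v) ▹ y + (s == x) ▹ z) e e′
          localize : ∀ x → (s == x) ▹ w (suc s) zero ≡ X x
          localize x = ▹-cong (s == x) λ e → cong (λ y → w (suc y) zero) (==-sound {u = s} e)
          ring : ∀ o a b c d → o + ((a + b) + (c + d)) ≡ (b + d + o) + (a + c)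
          ring = solve-∀

      at-F : ∀ {x} → x ≡ x₁ ⊎ x ≡ x₂ → f v x ≡ colour zero (suc x) × f x v ≡ colour (suc x) zero
      at-F (inj₁ refl) = f-vx₁ , f-x₁v
      at-F (inj₂ refl) = f-vx₂ , f-x₂v

      balK : ∀ φ u → out K (λ s t → φ (colour s t)) u ≡ out K (λ s t → φ (colour t s)) u
      balK φ u = trans (balanced φ u) (out-mask-cong _ u (λ t → splitOff-sym t u))

      bal : Balanced A f
      bal φ s = trans
        (out-merged _ _ (λ b → cong φ (on-B b)) (λ x → let e , e′ = at-F x in cong φ e , cong φ e′) s)
        (trans (cong₂ (λ x y → x + (s == v) ▹ y) (balK φ (suc s)) (balK φ zero))
        (trans (sym (out-merged _ _ (λ {s} {t} b → cong φ (on-B (trans (symB t s) b)))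
                                    (λ x → let e , e′ = at-F x in cong φ e′ , cong φ e) s))
               (out-mask-cong _ s (λ t → symA s t))))

-- Cuts

cut : ∀ {m} → Matrix m → (Fin m → Bool) → Matrix m
cut A S u v = A u v ∧ (S u ∧ not (S v))

cut-sound : ∀ {m} (A : Matrix m) S {u v} → cut A S u v ≡ true → A u v ≡ true × S u ≡ true × S v ≡ false
cut-sound A S {u} {v} e = let p , q = ∧-true {A u v} e ; r , s = ∧-true {S u} q in p , r , not-true s

cut-intro : ∀ {m} (A : Matrix m) S {u v} → A u v ≡ true → S u ≡ true → S v ≡ false → cut A S u v ≡ true
cut-intro A S p q r = ∧-intro p (∧-intro q (not-false r))

opaque
  unfolding total

  cutSize-total : ∀ G S → cutSize G S ≡ total (cut (adj G) S)
  cutSize-total G S = refl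

  degree-out : ∀ G v → degree G v ≡ sumFin (n G) (λ u → b2n (adj G v u))
  degree-out G v = refl

cut-complement : ∀ {m} (A : Matrix m) → Symmetric A → ∀ S → total (cut A (not ∘ S)) ≡ total (cut A S)
cut-complement A symA S = trans (total-cong eq) (total-flip (cut A S))
  where
    eq : ∀ s t → cut A (not ∘ S) s t ≡ cut A S t s
    eq s t = cong₂ _∧_ (symA s t) (trans (cong (not (S s) ∧_) (not-involutive (S t))) (∧-comm (not (S s)) (S t)))

-- `P` marks the vertices that count; the others are meant to be isolated. Subgraphs can thus be
-- formed without renumbering the vertices.
BridgelessOn : ∀ {m} → (Fin m → Bool) → Matrix m → Set
BridgelessOn P A = ∀ S → (∃[ x ] (P x ≡ true × S x ≡ true)) → (∃[ y ] (P y ≡ true × S y ≡ false)) → 2 ≤ total (cut A S)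

handshake : ∀ G → total (adj G) ≡ numEdges G + numEdges G
handshake G = trans (total-⊕ halves) (cong₂ _+_ numEdges≡ (trans (total-flip L) numEdges≡))
  where
    A = adj G
    L : Matrix (n G)
    L u v = A u v ∧ (toℕ u ℕ.<ᵇ toℕ v)
    opaque
      unfolding total
      numEdges≡ : total L ≡ numEdges G
      numEdges≡ = refl
    trichotomy : ∀ a b → a ≢ b → b2n (a ℕ.<ᵇ b) + b2n (b ℕ.<ᵇ a) ≡ 1
    trichotomy zero    zero    ne = contradiction refl ne
    trichotomy zero    (suc b) ne = refl
    trichotomy (suc a) zero    ne = refl
    trichotomy (suc a) (suc b) ne = trichotomy a b (ne ∘ cong suc)
    pointwise : ∀ u v → b2n (A u v) ≡ b2n (A u v ∧ (toℕ u ℕ.<ᵇ toℕ v)) + b2n (A v u ∧ (toℕ v ℕ.<ᵇ toℕ u))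
    pointwise u v rewrite adj-sym G v u with A u v in e
    ... | false = refl
    ... | true  = sym (trichotomy (toℕ u) (toℕ v) λ eq → true≢false
      (subst (λ w → A u w ≡ true) (sym (Finₚ.toℕ-injective eq)) e) (adj-irrefl G u))
    halves : A ≐ L ⊕ flip L
    halves = disjoint pointwise

-- Deleting isolated vertices

extend : ∀ {m} {X : Set} → Fin (suc m) → X → (Fin m → X) → Fin (suc m) → X
extend v d g s with v Fin.≟ s
... | yes _ = d
... | no v≢s = g (punchOut v≢s)

extend-punchIn : ∀ {m} {X : Set} (v : Fin (suc m)) (d : X) g i → extend v d g (punchIn v i) ≡ g i
extend-punchIn v d g i with v Fin.≟ punchIn v i
... | yes e = contradiction (sym e) (Finₚ.punchInᵢ≢i v i)
... | no ne = cong g (trans (Finₚ.punchOut-cong v refl) (Finₚ.punchOut-punchIn v))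

data PunchView {m} (v : Fin (suc m)) : Fin (suc m) → Set where
  hole  : PunchView v v
  other : ∀ i → PunchView v (punchIn v i)

punchView : ∀ {m} (v s : Fin (suc m)) → PunchView v s
punchView v s with v Fin.≟ s
... | yes refl = hole
... | no v≢s = subst (PunchView v) (Finₚ.punchIn-punchOut v≢s) (other (punchOut v≢s))

minor : ∀ {m} → Fin (suc m) → Matrix (suc m) → Matrix m
minor v A i j = A (punchIn v i) (punchIn v j)

opaque
  unfolding out

  out-minor : ∀ {m} (X : Matrix (suc m)) v w i → X (punchIn v i) v ≡ false →
    out X w (punchIn v i) ≡ out (minor v X) (λ s t → w (punchIn v s) (punchIn v t)) i
  out-minor X v w i e = trans (sum-punchIn (λ t → X (punchIn v i) t ▹ w (punchIn v i) t) v)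
    (cong (λ b → b ▹ w (punchIn v i) v + out (minor v X) (λ s t → w (punchIn v s) (punchIn v t)) i) e)

total-minor : ∀ {m} (X : Matrix (suc m)) v → (∀ t → X v t ≡ false) → (∀ s → X s v ≡ false) →
  total X ≡ total (minor v X)
total-minor {m} X v row col = trans (total-out X) (trans (sum-punchIn (out X (λ _ _ → 1)) v)
  (trans (cong₂ _+_ (out-empty X (λ _ _ → 1) v row) (sum-cong {m} λ i → out-minor X v (λ _ _ → 1) i (col (punchIn v i)))) (sym (total-out (minor v X)))))

good-minor : ∀ {m} (A : Matrix (suc m)) v → (∀ t → A v t ≡ false) → (∀ s → A s v ≡ false) →
  Good (minor v A) → Good A
good-minor {m} A v row col good = record
  { _≟ᶜ_ = Maybeₚ.≡-dec _≟ᶜ_ ; colour = f ; turns = turns′ ; balanced = bal }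
  where
    open Good good
    f : Fin (suc m) → Fin (suc m) → Maybe Colour
    -- `nothing` only fills the pairs involving `v`, between which there are no arcs.
    f s t = extend v nothing (λ i → extend v nothing (λ j → just (colour i j)) t) s
    f-punchIn : ∀ i j → f (punchIn v i) (punchIn v j) ≡ just (colour i j)
    f-punchIn i j = trans (extend-punchIn v nothing _ i) (extend-punchIn v nothing _ j)
    turns′ : Turnless A f
    turns′ {s} {t} p q e with punchView v s | punchView v t
    ... | hole    | _       = true≢false p (row t)
    ... | other i | hole    = true≢false p (col s)
    ... | other i | other j = turns p q (just-injective (trans (sym (f-punchIn i j)) (trans e (f-punchIn j i))))
    bal : Balanced A f
    bal φ s with punchView v s
    ... | hole    = trans (out-empty A _ v row) (sym (out-empty (flip A) _ v col))
    ... | other i = begin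
      out A (λ s t → φ (f s t)) (punchIn v i)
        ≡⟨ out-minor A v _ i (col _) ⟩
      out (minor v A) (λ s t → φ (f (punchIn v s) (punchIn v t))) i
        ≡⟨ out-cong (minor v A) i (λ j _ → cong φ (f-punchIn i j)) ⟩
      out (minor v A) (λ s t → φ (just (colour s t))) i
        ≡⟨ balanced (φ ∘ just) i ⟩
      out (flip (minor v A)) (λ s t → φ (just (colour t s))) i
        ≡⟨ out-cong (flip (minor v A)) i (λ j _ → cong φ (f-punchIn j i)) ⟨
      out (flip (minor v A)) (λ s t → φ (f (punchIn v t) (punchIn v s))) i
        ≡⟨ out-minor (flip A) v _ i (row _) ⟨
      out (flip A) (λ s t → φ (f t s)) (punchIn v i) ∎
      where open ≡-Reasoning

bridgeless-minor : ∀ {m} (A : Matrix (suc m)) v P → (∀ t → A v t ≡ false) → (∀ s → A s v ≡ false) →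
  BridgelessOn P A → BridgelessOn (P ∘ punchIn v) (minor v A)
bridgeless-minor {m} A v P row col bA S (x , Px , Sx) (y , Py , Sy) = subst (2 ≤_) same
  (bA S⁺ (punchIn v x , Px , trans (S⁺≡ x) Sx) (punchIn v y , Py , trans (S⁺≡ y) Sy))
  where
    S⁺ : Fin (suc m) → Bool
    S⁺ = extend v false S
    S⁺≡ : ∀ i → S⁺ (punchIn v i) ≡ S i
    S⁺≡ = extend-punchIn v false S
    same : total (cut A S⁺) ≡ total (cut (minor v A) S)
    same = trans (total-minor (cut A S⁺) v (λ t → cong (_∧ (S⁺ v ∧ not (S⁺ t))) (row t))
                                           (λ s → cong (_∧ (S⁺ s ∧ not (S⁺ v))) (col s)))
      (total-cong λ i j → cong₂ (λ a b → minor v A i j ∧ (a ∧ not b)) (S⁺≡ i) (S⁺≡ j))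

BipartiteMatrix : ∀ {m} → Matrix m → Set
BipartiteMatrix {m} A = Σ (Fin m → Bool) λ side → ∀ u v → A u v ≡ true → side u ≢ side v

-- The double negation is what minimality provides: it excludes that `H` is uncolourable without
-- producing a colouring. The bound `N` counts arcs, that is, each edge twice.
SmallGood : ℕ → Set₁
SmallGood N = ∀ H → Bipartite H → Bridgeless H → total (adj H) < N → ¬ ¬ Good (adj H)

-- Vertices outside `P` are isolated and would violate `Bridgeless`. They are deleted one at a time,
-- and the colouring is carried back each time.
small-good : ∀ {N} → SmallGood N → ∀ {m} (A : Matrix m) P → Symmetric A → Irreflexive A →
  BipartiteMatrix A → (∀ s t → A s t ≡ true → P s ≡ true) → BridgelessOn P A → total A < N → ¬ ¬ Good A
small-good hyp {m} A P symA irr bip supp bl lt with any? (λ v → P v Boolₚ.≟ false)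
small-good hyp {suc m} A P symA irr (side , bip) supp bl lt | yes (v , Pv) = λ notGood →
  small-good hyp (minor v A) (P ∘ punchIn v) (λ s t → symA _ _) (λ s → irr _) (side ∘ punchIn v , λ s t → bip _ _)
    (λ s t → supp _ _) (bridgeless-minor A v P row col bl)
    (subst (_< _) (total-minor A v row col) lt) (notGood ∘ good-minor A v row col)
  where
    row : ∀ t → A v t ≡ false
    row t with A v t in e
    ... | false = refl
    ... | true  = contradiction Pv (true≢false (supp v t e))
    col : ∀ s → A s v ≡ false
    col s = trans (symA s v) (row s)
small-good hyp {m} A P symA irr bip supp bl lt | no all = hyp H bip
  (λ S ((x , Sx) , (y , Sy)) → subst (2 ≤_) (sym (cutSize-total H S)) (bl S (x , everywhere x , Sx) (y , everywhere y , Sy))) lt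
  where
    H : SimpleGraph
    H = record { n = m ; adj = A ; adj-sym = symA ; adj-irrefl = irr }
    everywhere : ∀ x → P x ≡ true
    everywhere x = ¬-not (λ e → all (x , e))

-- Reachability

-- Each reached vertex other than `v₀` retains a reached predecessor. In a Kempe chain this
-- identifies the edge by which the chain came in.
Entered : ∀ {m} → Matrix m → Fin m → (Fin m → Set) → (Fin m → Bool) → Fin m → Set
Entered E v₀ Q R w = Q w × (w ≡ v₀ ⊎ ∃[ u ] (R u ≡ true × E u w ≡ true))

Closure : ∀ {m} → Matrix m → Fin m → (Fin m → Set) → Set
Closure {m} E v₀ Q = Σ (Fin m → Bool) λ R → R v₀ ≡ true ×
  (∀ u w → R u ≡ true → E u w ≡ true → R w ≡ true) × (∀ w → R w ≡ true → Entered E v₀ Q R w)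

closure : ∀ {m} (E : Matrix m) v₀ (Q : Fin m → Set) → Q v₀ → (∀ u w → Q u → E u w ≡ true → Q w) → Closure E v₀ Q
closure {m} E v₀ Q q₀ stepQ = grow _ (_== v₀) ≤-refl (==-refl v₀)
  λ w e → subst Q (sym (==-sound {u = w} e)) q₀ , inj₁ (==-sound {u = w} e)
  where
    grow : ∀ k (R : Fin m → Bool) → sumFin m (b2n ∘ not ∘ R) ≤ k → R v₀ ≡ true →
      (∀ w → R w ≡ true → Entered E v₀ Q R w) → Closure E v₀ Q
    grow k R le R₀ inv with any? (λ u → any? λ w → (R u Boolₚ.≟ true) ×-dec (E u w Boolₚ.≟ true) ×-dec (R w Boolₚ.≟ false))
    ... | no closed = R , R₀ , (λ u w p q → ¬-not λ r → closed (u , w , p , q , r)) , inv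
    grow zero R le R₀ inv | yes (u , w , p , q , r) =
      contradiction (≤-trans (≤-trans (≤-reflexive (sym (cong (b2n ∘ not) r))) (term≤sum (b2n ∘ not ∘ R) w)) le) λ ()
    grow (suc k) R le R₀ inv | yes (u , w , p , q , r) = grow k R′ smaller (larger R₀) inv′
      where
        R′ : Fin m → Bool
        R′ x = R x ∨ (x == w)
        larger : ∀ {x} → R x ≡ true → R′ x ≡ true
        larger {x} e = cong (_∨ (x == w)) e
        R′w : R′ w ≡ true
        R′w = trans (cong (R w ∨_) (==-refl w)) (Boolₚ.∨-zeroʳ _)
        smaller : sumFin m (b2n ∘ not ∘ R′) ≤ k
        smaller = ℕ.s≤s⁻¹ (≤-trans (sum-strict {m} {b2n ∘ not ∘ R′} {b2n ∘ not ∘ R}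
          (λ x → b2n-mono {not (R′ x)} {not (R x)} (λ e → not-false (lower x (not-true e)))) w
          (subst₂ (λ a b → b2n (not a) < b2n (not b)) (sym R′w) (sym r) (s≤s z≤n))) le)
          where
            lower : ∀ x → R′ x ≡ false → R x ≡ false
            lower x e with R x
            ... | false = refl
        inv′ : ∀ x → R′ x ≡ true → Entered E v₀ Q R′ x
        inv′ x e with R x in Rx
        ... | false rewrite ==-sound {u = x} e = stepQ u w (proj₁ (inv u p)) q , inj₂ (u , larger p , q)
        ... | true with inv x Rx
        ...   | qx , inj₁ x≡ = qx , inj₁ x≡
        ...   | qx , inj₂ (y , Ry , Eyx) = qx , inj₂ (y , larger Ry , Eyx)

snoc : ∀ {G u v w} → Reach G u v → adj G v w ≡ true → Reach G u w
snoc here       e = step e here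
snoc (step d r) e = step d (snoc r e)

connected : ∀ G → (∀ S → NonemptyProper G S → 1 ≤ total (cut (adj G) S)) → Connected G
connected G cuts u w with closure (adj G) u (Reach G u) here (λ _ _ r e → snoc r e)
... | R , Ru , closed , inv with R w in Rw
...   | true  = proj₁ (inv w Rw)
...   | false with total-positive _ (cuts R ((u , Ru) , (w , Rw)))
...     | s , t , e = let a , p , q = cut-sound (adj G) R e in contradiction q (true≢false (closed s t p a))

-- König's edge colouring theorem

transpose : ∀ {d} → Fin d → Fin d → Fin d → Fin d
transpose a b k = if k == a then b else if k == b then a else k

transpose-left : ∀ {d} (a b : Fin d) → transpose a b a ≡ b
transpose-left a b rewrite ==-refl a = refl

transpose-right : ∀ {d} (a b : Fin d) → transpose a b b ≡ a
transpose-right a b with b Fin.≟ a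
... | yes refl = refl
... | no _ rewrite ==-refl b = refl

transpose-other : ∀ {d} {a b k : Fin d} → k ≢ a → k ≢ b → transpose a b k ≡ k
transpose-other p q rewrite ==-≢ p | ==-≢ q = refl

transpose-involutive : ∀ {d} (a b k : Fin d) → transpose a b (transpose a b k) ≡ k
transpose-involutive a b k = go (k Fin.≟ a) (k Fin.≟ b)
  where
    go : Dec (k ≡ a) → Dec (k ≡ b) → transpose a b (transpose a b k) ≡ k
    go (yes refl) _ = trans (cong (transpose a b) (transpose-left a b)) (transpose-right a b)
    go (no _) (yes refl) = trans (cong (transpose a b) (transpose-right a b)) (transpose-left a b)
    go (no p) (no q) = trans (cong (transpose a b) (transpose-other p q)) (transpose-other p q)

transpose-injective : ∀ {d} (a b : Fin d) {k l} → transpose a b k ≡ transpose a b l → k ≡ l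
transpose-injective a b {k} {l} e =
  trans (sym (transpose-involutive a b k)) (trans (cong (transpose a b) e) (transpose-involutive a b l))

row : ∀ {m} → Matrix m → Fin m → ℕ
row {m} A v = sumFin m (λ t → b2n (A v t))

sum-palette : ∀ {m l} (p : Fin m → Bool) (c : Fin m → Fin l) →
  sumFin m (b2n ∘ p) ≡ sumFin l (λ k → sumFin m (λ t → (p t ∧ (k == c t)) ▹ 1))
sum-palette {m} {l} p c = trans (sum-cong {m} λ t → sym (▹-one (p t))) (palette p c (const 1))

sum-one : ∀ m → sumFin m (const 1) ≡ m
sum-one zero    = refl
sum-one (suc m) = cong suc (sum-one m)

-- If all `l` colours occurred, grouping the elements of `p` by colour would give at least `l` of
-- them.
missing-colour : ∀ {m l} (p : Fin m → Bool) (c : Fin m → Fin l) → sumFin m (b2n ∘ p) < l →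
  ∃[ k ] (∀ t → p t ≡ true → c t ≢ k)
missing-colour {m} {l} p c lt with any? (λ k → all? λ t → ¬? ((p t Boolₚ.≟ true) ×-dec (c t Fin.≟ k)))
... | yes (k , none) = k , λ t pt e → none t (pt , e)
... | no used = contradiction (subst₂ _≤_ (sum-one l) (sym (sum-palette p c)) (sum-mono {l} every)) (<⇒≱ lt)
  where
    every : ∀ k → 1 ≤ sumFin m (λ t → (p t ∧ (k == c t)) ▹ 1)
    every k with any? (λ t → (p t Boolₚ.≟ true) ×-dec (c t Fin.≟ k))
    ... | yes (t , pt , refl) = ≤-trans
          (≤-reflexive (cong (_▹ 1) (sym (∧-intro {p t} {c t == c t} pt (==-refl (c t))))))
          (term≤sum (λ t′ → (p t′ ∧ (c t == c t′)) ▹ 1) t)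
    ... | no none = contradiction (k , λ t q → none (t , q)) used

EdgeColouring : ∀ {m} → Matrix m → ∀ l → (Fin m → Fin m → Fin l) → Set
EdgeColouring A l c =
  (∀ {x y} → A x y ≡ true → c x y ≡ c y x) × (∀ {x y z} → A x y ≡ true → A x z ≡ true → c x y ≡ c x z → y ≡ z)

-- Kempe change: recolouring the alternating chain of v frees the colour a, missing at u, at v as well.
module Kempe {m l} {A : Matrix m} (symA : Symmetric A) (side : Fin m → Bool)
             (bip : ∀ x y → A x y ≡ true → side x ≢ side y) {u v : Fin m} (u≢v : u ≢ v) (sides : side u ≢ side v)
             {c : Fin m → Fin m → Fin l} (colouring : EdgeColouring A l c) {a b : Fin l}
             (missing-a : ∀ t → A u t ≡ true → c u t ≢ a) (missing-b : ∀ t → A v t ≡ true → c v t ≢ b) where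

  private
    symmetric = proj₁ colouring
    proper = proj₂ colouring

    flipped : ∀ {x y} → A x y ≡ true → A y x ≡ true
    flipped {x} {y} e = trans (symA y x) e

    -- The chain is directed: it leaves vertices on the side of `v` along `a` and the others along
    -- `b`. Vertices on the far side are thus entered only by `a`, a colour missing at `u`, so the
    -- chain never reaches `u`.
    chain : Matrix m
    chain x y = A x y ∧ (if side x xor side v then c x y == b else c x y == a)

    near : ∀ {x} → side x ≡ side v → side x xor side v ≡ false
    near {x} e rewrite e = Boolₚ.xor-same (side v)

    far : ∀ {x} → side x ≢ side v → side x xor side v ≡ true
    far {x} ne with side x | side v
    ... | true  | true  = contradiction refl ne
    ... | true  | false = refl
    ... | false | true  = refl
    ... | false | false = contradiction refl ne

    chain-near : ∀ {x y} → side x ≡ side v → A x y ≡ true → c x y ≡ a → chain x y ≡ true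
    chain-near {x} {y} s e k = ∧-intro e (trans (cong (if_then c x y == b else (c x y == a)) (near s)) (==-≡ k))

    chain-far : ∀ {x y} → side x ≢ side v → A x y ≡ true → c x y ≡ b → chain x y ≡ true
    chain-far {x} {y} s e k = ∧-intro e (trans (cong (if_then c x y == b else (c x y == a)) (far s)) (==-≡ k))

    near-chain : ∀ {x y} → side x ≡ side v → chain x y ≡ true → A x y ≡ true × c x y ≡ a
    near-chain {x} {y} s e = let p , q = ∧-true {A x y} e in
      p , ==-sound (trans (sym (cong (if_then c x y == b else (c x y == a)) (near s))) q)

    far-chain : ∀ {x y} → side x ≢ side v → chain x y ≡ true → A x y ≡ true × c x y ≡ b
    far-chain {x} {y} s e = let p , q = ∧-true {A x y} e in
      p , ==-sound (trans (sym (cong (if_then c x y == b else (c x y == a)) (far s))) q)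

    reached = closure chain v (λ _ → Fin m) v (λ _ _ _ _ → v)
    R = proj₁ reached
    Rv : R v ≡ true
    Rv = proj₁ (proj₂ reached)
    closed : ∀ {x y} → R x ≡ true → chain x y ≡ true → R y ≡ true
    closed {x} {y} = proj₁ (proj₂ (proj₂ reached)) x y
    predecessor : ∀ {x} → R x ≡ true → x ≡ v ⊎ ∃[ y ] (R y ≡ true × chain y x ≡ true)
    predecessor {x} r = proj₂ (proj₂ (proj₂ (proj₂ reached)) x r)

    third : ∀ {x y z : Bool} → x ≢ y → z ≢ y → x ≡ z
    third p q = trans (¬-not p) (sym (¬-not q))

    entered-near : ∀ {x} → side x ≡ side v → R x ≡ true → x ≡ v ⊎ ∃[ y ] (R y ≡ true × A x y ≡ true × c x y ≡ b)
    entered-near {x} s r with predecessor {x} r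
    ... | inj₁ e = inj₁ e
    ... | inj₂ (y , Ry , yx) with far-chain (λ e → bip y x (proj₁ (∧-true {A y x} yx)) (trans e (sym s))) yx
    ...   | p , k = inj₂ (y , Ry , flipped p , trans (sym (symmetric p)) k)

    entered-far : ∀ {x} → side x ≢ side v → R x ≡ true → ∃[ y ] (R y ≡ true × A x y ≡ true × c x y ≡ a)
    entered-far {x} s r with predecessor {x} r
    ... | inj₁ refl = contradiction refl s
    ... | inj₂ (y , Ry , yx) with near-chain (third (bip y x (proj₁ (∧-true {A y x} yx))) (≢-sym s)) yx
    ...   | p , k = y , Ry , flipped p , trans (sym (symmetric p)) k

    Ru : R u ≡ false
    Ru with R u in r
    ... | false = refl
    ... | true with entered-far {u} sides r
    ...   | y , _ , e , k = contradiction k (missing-a y e)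

    -- A vertex on the side of `v` passes its `a`-edge on; for a vertex on the far side, properness
    -- makes the `a`-edge the one through which it was entered. With the same for `b`, which is
    -- missing at `v`, no edge leaving `R` has colour `a` or `b`.
    chain-a : ∀ {x y} → R x ≡ true → A x y ≡ true → c x y ≡ a → R y ≡ true
    chain-a {x} {y} r e k with side x Boolₚ.≟ side v
    ... | yes s = closed {x} {y} r (chain-near s e k)
    ... | no s with entered-far {x} s r
    ...   | z , Rz , e′ , k′ = subst (λ t → R t ≡ true) (proper e′ e (trans k′ (sym k))) Rz

    chain-b : ∀ {x y} → R x ≡ true → A x y ≡ true → c x y ≡ b → R y ≡ true
    chain-b {x} {y} r e k with side x Boolₚ.≟ side v
    ... | no s = closed {x} {y} r (chain-far s e k)
    ... | yes s with entered-near {x} s r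
    ...   | inj₁ refl = contradiction k (missing-b y e)
    ...   | inj₂ (z , Rz , e′ , k′) = subst (λ t → R t ≡ true) (proper e′ e (trans k′ (sym k))) Rz

    -- Exchanging `a` and `b` at the vertices of `R` respects symmetry, because edges leaving `R`
    -- have other colours. Afterwards `a` is missing at both `u` and `v`.
    c̃ : Fin m → Fin m → Fin l
    c̃ x y = if R x then transpose a b (c x y) else c x y

    c̃-sym : ∀ {x y} → A x y ≡ true → c̃ x y ≡ c̃ y x
    c̃-sym {x} {y} e with R x in rx | R y in ry
    ... | true  | true  = cong (transpose a b) (symmetric e)
    ... | false | false = symmetric e
    ... | true  | false = trans (transpose-other
            (λ k → true≢false (chain-a {x} {y} rx e k) ry) (λ k → true≢false (chain-b {x} {y} rx e k) ry)) (symmetric e)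
    ... | false | true  = trans (symmetric e) (sym (transpose-other
            (λ k → true≢false (chain-a {y} {x} ry (flipped e) k) rx) (λ k → true≢false (chain-b {y} {x} ry (flipped e) k) rx)))

    c̃-proper : ∀ {x y z} → A x y ≡ true → A x z ≡ true → c̃ x y ≡ c̃ x z → y ≡ z
    c̃-proper {x} p q e with R x
    ... | true  = proper p q (transpose-injective a b e)
    ... | false = proper p q e

    c̃-u : ∀ {z} → A u z ≡ true → c̃ u z ≢ a
    c̃-u {z} e rewrite Ru = missing-a z e

    c̃-v : ∀ {z} → A v z ≡ true → c̃ v z ≢ a
    c̃-v {z} e k rewrite Rv = missing-b z e (transpose-injective a b (trans k (sym (transpose-right a b))))

    c⁺ : Fin m → Fin m → Fin l
    c⁺ x y = if edge u v x y then a else c̃ x y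

    on-edge : ∀ {x y} → edge u v x y ≡ true → c⁺ x y ≡ a
    on-edge {x} {y} e = cong (if_then a else c̃ x y) e

    off-edge : ∀ {x y} → edge u v x y ≡ false → c⁺ x y ≡ c̃ x y
    off-edge {x} {y} e = cong (if_then a else c̃ x y) e

  extended : ∀ {A⁺} → A⁺ ≐ A ⊕ edge u v → EdgeColouring A⁺ l c⁺
  extended {A⁺} d = symmetric⁺ , proper⁺
    where
      off : ∀ {x y} → A x y ≡ true → c⁺ x y ≡ c̃ x y
      off {x} {y} e = off-edge (⊕-exclusive d x y e)

      symmetric⁺ : ∀ {x y} → A⁺ x y ≡ true → c⁺ x y ≡ c⁺ y x
      symmetric⁺ {x} {y} e with ⊕-cases d x y e
      ... | inj₁ p = trans (off p) (trans (c̃-sym p) (sym (off (flipped p))))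
      ... | inj₂ p = trans (on-edge p) (sym (on-edge (trans (edge-sym u v y x) p)))

      mixed : ∀ {x y z} → edge u v x y ≡ true → A x z ≡ true → c⁺ x y ≢ c⁺ x z
      mixed {x} {y} p q e with edge-sound u v x y p
      ... | inj₁ (refl , refl) = c̃-u q (trans (sym (off q)) (trans (sym e) (on-edge p)))
      ... | inj₂ (refl , refl) = c̃-v q (trans (sym (off q)) (trans (sym e) (on-edge p)))

      proper⁺ : ∀ {x y z} → A⁺ x y ≡ true → A⁺ x z ≡ true → c⁺ x y ≡ c⁺ x z → y ≡ z
      proper⁺ {x} {y} {z} p q e with ⊕-cases d x y p | ⊕-cases d x z q
      ... | inj₁ p′ | inj₁ q′ = c̃-proper p′ q′ (trans (sym (off p′)) (trans e (off q′)))
      ... | inj₁ p′ | inj₂ q′ = contradiction (sym e) (mixed q′ p′)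
      ... | inj₂ p′ | inj₁ q′ = contradiction e (mixed p′ q′)
      ... | inj₂ p′ | inj₂ q′ with edge-sound u v x y p′ | edge-sound u v x z q′
      ...   | inj₁ (refl , refl) | inj₁ (_ , refl) = refl
      ...   | inj₂ (refl , refl) | inj₂ (_ , refl) = refl
      ...   | inj₁ (refl , refl) | inj₂ (e′ , _) = contradiction e′ u≢v
      ...   | inj₂ (refl , refl) | inj₁ (e′ , _) = contradiction (sym e′) u≢v

edge⊆ : ∀ {m} {A : Matrix m} → Symmetric A → ∀ {a b} → A a b ≡ true → edge a b ⊆ A
edge⊆ {A = A} symA {a} {b} e s t p with edge-sound a b s t p
... | inj₁ (refl , refl) = e
... | inj₂ (refl , refl) = trans (symA b a) e

∖-sym : ∀ {m} {A B : Matrix m} → Symmetric A → Symmetric B → Symmetric (A ∖ B)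
∖-sym symA symB s t = cong₂ (λ x y → x ∧ not y) (symA s t) (symB s t)

-- Induction on the number of edges: without the edge `u v` both ends have degree at most `d`, so
-- each misses a colour, and a Kempe change makes the missing colours agree. The form `suc d`
-- provides a colour for the empty graph.
könig : ∀ k {m} (A : Matrix m) d → total A ≤ k → Symmetric A → BipartiteMatrix A → (∀ v → row A v ≤ suc d) →
  ∃ (EdgeColouring A (suc d))
könig k A d le symA bip deg with 1 ℕ.≤? total A
... | no empty = (λ _ _ → zero) , (λ _ → refl) , λ p _ _ → contradiction (total-nonempty A p) empty
könig zero A d le symA bip deg | yes 1≤ = contradiction (≤-trans 1≤ le) λ ()
könig (suc k) {m} A d le symA (side , bip) deg | yes 1≤ with total-positive A 1≤
... | u , v , uv with könig k (A ∖ edge u v) d smaller (∖-sym {A = A} symA (edge-sym u v))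
                        (side , λ x y e → bip x y (proj₁ (∧-true e))) (λ x → ≤-trans (thinner x) (deg x))
  where
    weaken : A ∖ edge u v ⊆ A
    weaken x y e = proj₁ (∧-true {A x y} e)
    gone : ∀ {x y} → edge u v x y ≡ true → (A ∖ edge u v) x y ≡ false
    gone {x} {y} e = trans (cong (λ b → A x y ∧ not b) e) (Boolₚ.∧-zeroʳ (A x y))
    smaller : total (A ∖ edge u v) ≤ k
    smaller = ℕ.s≤s⁻¹ (≤-trans (total-strict (A ∖ edge u v) A {u} {v} weaken (gone (edge-left u v)) uv) le)
    thinner : ∀ x → row (A ∖ edge u v) x ≤ row A x
    thinner x = sum-mono {m} λ y → b2n-mono (weaken x y)
... | c , colouring = _ , Kempe.extended (∖-sym {A = A} symA (edge-sym u v)) side (λ x y e → bip x y (proj₁ (∧-true e)))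
      u≢v (bip u v uv) colouring (proj₂ free-u) (proj₂ free-v) (∖-⊕ (edge⊆ symA uv))
  where
    u≢v : u ≢ v
    u≢v refl = bip u u uv refl
    drop : ∀ {x y} → A x y ≡ true → edge u v x y ≡ true → row (A ∖ edge u v) x < suc d
    drop {x} {y} e e′ = ≤-trans (sum-strict {m} (λ z → b2n-mono {(A ∖ edge u v) x z} (proj₁ ∘ ∧-true)) y
      (subst₂ _<_ (sym (cong b2n (trans (cong (λ b → A x y ∧ not b) e′) (Boolₚ.∧-zeroʳ (A x y))))) (sym (cong b2n e)) (s≤s z≤n)))
      (deg x)
    free-u = missing-colour ((A ∖ edge u v) u) (c u) (drop uv (edge-left u v))
    free-v = missing-colour ((A ∖ edge u v) v) (c v) (drop (trans (symA v u) uv) (edge-right u v))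

-- In a regular bipartite graph every vertex sees all colours, so the colours can be shifted by a derangement.
regular-colourable : ∀ G d → Bipartite G → (∀ v → degree G v ≡ suc d) →
  (ν ν⁻¹ : Fin (suc d) → Fin (suc d)) → (∀ k → ν (ν⁻¹ k) ≡ k) → (∀ k → ν⁻¹ (ν k) ≡ k) → (∀ k → ν k ≢ k) →
  TwoSimultaneousEdgeColorable G
regular-colourable G d bip reg ν ν⁻¹ νν⁻¹ ν⁻¹ν derangement
  with könig _ (adj G) d ≤-refl (adj-sym G) bip (λ v → ≤-reflexive (trans (sym (degree-out G v)) (reg v)))
... | c , symmetric , proper = suc d , c , (λ u v → ν (c u v)) ,
  ((λ u v → symmetric) , λ u v w p q ne e → ne (proper p q e)) ,
  ((λ u v e → cong ν (symmetric e)) , λ u v w p q ne e → ne (proper p q (ν-injective e))) ,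
  (λ v k → (λ _ → let t , p , e = sees v (ν⁻¹ k) in t , p , trans (cong ν e) (νν⁻¹ k)) , λ _ → sees v k) ,
  λ u v _ e → derangement (c u v) (sym e)
  where
    ν-injective : ∀ {k l} → ν k ≡ ν l → k ≡ l
    ν-injective {k} {l} e = trans (sym (ν⁻¹ν k)) (trans (cong ν⁻¹ e) (ν⁻¹ν l))

    count : Fin (n G) → Fin (suc d) → ℕ
    count v k = sumFin (n G) (λ t → (adj G v t ∧ (k == c v t)) ▹ 1)

    hit : ∀ {v k t} → (adj G v t ∧ (k == c v t)) ≡ true → adj G v t ≡ true × c v t ≡ k
    hit {v} {k} {t} e = let p , q = ∧-true {adj G v t} e in p , sym (==-sound q)

    at-most-one : ∀ v k → count v k ≤ 1
    at-most-one v k with any? (λ t → (adj G v t ∧ (k == c v t)) Boolₚ.≟ true)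
    ... | yes (t , e) = ≤-trans (sum-mono {n G} only) (≤-reflexive (sum-pick t (const 1)))
      where
        only : ∀ s → (adj G v s ∧ (k == c v s)) ▹ 1 ≤ (s == t) ▹ 1
        only s with adj G v s ∧ (k == c v s) in e′
        ... | false = z≤n
        ... | true = ≤-reflexive (cong (_▹ 1) (sym (==-≡ (proper (proj₁ (hit {v} {k} {s} e′)) (proj₁ (hit {v} {k} {t} e))
                       (trans (proj₂ (hit {v} {k} {s} e′)) (sym (proj₂ (hit {v} {k} {t} e))))))))
    ... | no none = ≤-trans (≤-reflexive (trans (sum-cong {n G} λ t → cong (_▹ 1) (Boolₚ.¬-not λ e → none (t , e))) (sum-zero (n G)))) z≤n

    sees : ∀ v k → ColorAt G c v k
    -- Each of the `suc d` colours occurs at most once at `v`, and the occurrences add up to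
    -- `suc d`, so every colour occurs.
    sees v k with sum-positive {n G} _ (≤-reflexive (sym (sum-tight {suc d} (at-most-one v)
      (trans (sym (sum-palette (adj G v) (c v))) (trans (trans (sym (degree-out G v)) (reg v)) (sym (sum-one (suc d))))) k)))
    ... | t , pos with adj G v t ∧ (k == c v t) in e
    ...   | true = t , hit {v} {k} {t} e

-- Neighbours

without : ∀ {m} → (Fin m → Bool) → Fin m → Fin m → Bool
without p x t = p t ∧ not (t == x)

without-intro : ∀ {m} (p : Fin m → Bool) {x t} → p t ≡ true → t ≢ x → without p x t ≡ true
without-intro p e ne = ∧-intro e (not-false (==-≢ ne))

without-elim : ∀ {m} (p : Fin m → Bool) {x t} → without p x t ≡ true → p t ≡ true × t ≢ x
without-elim p {x} {t} e = let q , r = ∧-true {p t} e in q , λ { refl → true≢false (==-refl x) (not-true r) }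

size : ∀ {m} → (Fin m → Bool) → ℕ
size {m} p = sumFin m (b2n ∘ p)

size-without : ∀ {m} (p : Fin m → Bool) {x} → p x ≡ true → size p ≡ suc (size (without p x))
size-without {m} p {x} px = trans (sum-cong {m} pointwise) (trans (sum-+ {m} (λ t → (t == x) ▹ 1) (b2n ∘ without p x))
  (cong (_+ size (without p x)) (sum-pick {m} x (const 1))))
  where
    pointwise : ∀ t → b2n (p t) ≡ (t == x) ▹ 1 + b2n (without p x t)
    pointwise t with t Fin.≟ x
    ... | yes refl = trans (cong b2n px) (cong (λ b → 1 + b2n b) (sym (Boolₚ.∧-zeroʳ (p t))))
    ... | no _ = cong b2n (sym (Boolₚ.∧-identityʳ (p t)))

pick : ∀ {m} (p : Fin m → Bool) {k} → suc k ≤ size p → ∃[ x ] (p x ≡ true × k ≤ size (without p x))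
pick p le with sum-positive _ (≤-trans (s≤s z≤n) le)
... | x , pos = let px = b2n-positive pos in x , px , ℕ.s≤s⁻¹ (subst (_ ≤_) (size-without p px) le)

member : ∀ {m} (p : Fin m → Bool) {k x} → p x ≡ true → k ≤ size (without p x) → suc k ≤ size p
member p px le = subst (_ ≤_) (sym (size-without p px)) (s≤s le)

three-distinct : ∀ {m} {a b c : Fin m} → a ≢ b → b ≢ c → a ≢ c → 3 ≤ m
three-distinct {1} {zero} {zero} p q r = contradiction refl p
three-distinct {2} {zero} {zero} p q r = contradiction refl p
three-distinct {2} {suc zero} {suc zero} p q r = contradiction refl p
three-distinct {2} {zero} {suc zero} {zero} p q r = contradiction refl r
three-distinct {2} {zero} {suc zero} {suc zero} p q r = contradiction refl q
three-distinct {2} {suc zero} {zero} {zero} p q r = contradiction refl q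
three-distinct {2} {suc zero} {zero} {suc zero} p q r = contradiction refl r
three-distinct {suc (suc (suc m))} p q r = s≤s (s≤s (s≤s z≤n))

⊕-intro : ∀ {m} {X Y Z : Matrix m} → X ⊆ Z → Y ⊆ Z → (∀ s t → X s t ≡ true → Y s t ≡ true → ⊥) →
  (∀ s t → Z s t ≡ true → X s t ≡ true ⊎ Y s t ≡ true) → Z ≐ X ⊕ Y
⊕-intro {X = X} {Y} {Z} X⊆Z Y⊆Z excl cov = disjoint pointwise
  where
    pointwise : ∀ s t → b2n (Z s t) ≡ b2n (X s t) + b2n (Y s t)
    pointwise s t with X s t in x | Y s t in y
    ... | true  | true  = ⊥-elim (excl s t x y)
    ... | true  | false = cong b2n (X⊆Z s t x)
    ... | false | true  = cong b2n (Y⊆Z s t y)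
    ... | false | false with Z s t in z
    ...   | false = refl
    ...   | true with cov s t z
    ...     | inj₁ e = contradiction x (true≢false e)
    ...     | inj₂ e = contradiction y (true≢false e)

-- Induced subgraphs and vertex deletion

restrict : ∀ {m} → Matrix m → (Fin m → Bool) → Matrix m
restrict A P s t = A s t ∧ (P s ∧ P t)

restrict-elim : ∀ {m} (A : Matrix m) P {s t} → restrict A P s t ≡ true → A s t ≡ true × P s ≡ true × P t ≡ true
restrict-elim A P {s} {t} e = let p , q = ∧-true {A s t} e in p , ∧-true {P s} q

restrict-intro : ∀ {m} (A : Matrix m) P {s t} → A s t ≡ true → P s ≡ true → P t ≡ true → restrict A P s t ≡ true
restrict-intro A P p q r = ∧-intro p (∧-intro q r)

restrict-sym : ∀ {m} {A : Matrix m} → Symmetric A → ∀ P → Symmetric (restrict A P)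
restrict-sym symA P s t = cong₂ _∧_ (symA s t) (∧-comm (P s) (P t))

restrict-irrefl : ∀ {m} {A : Matrix m} → Irreflexive A → ∀ P → Irreflexive (restrict A P)
restrict-irrefl irr P s = cong (_∧ (P s ∧ P s)) (irr s)

∨-elim : ∀ {a b} → a ∨ b ≡ true → a ≡ true ⊎ b ≡ true
∨-elim {true}  _ = inj₁ refl
∨-elim {false} e = inj₂ e

∨-introˡ : ∀ {a} b → a ≡ true → a ∨ b ≡ true
∨-introˡ b refl = refl

∨-introʳ : ∀ a {b} → b ≡ true → a ∨ b ≡ true
∨-introʳ a refl = Boolₚ.∨-zeroʳ a

agrees : Bool → Bool → Bool
agrees a b = not (a xor b)

agrees-sound : ∀ {a b} → agrees a b ≡ true → a ≡ b
agrees-sound {true}  {true}  _ = refl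
agrees-sound {false} {false} _ = refl

agrees-≡ : ∀ {a b} → a ≡ b → agrees a b ≡ true
agrees-≡ {true}  refl = refl
agrees-≡ {false} refl = refl

true⊎false : ∀ b → b ≡ true ⊎ b ≡ false
true⊎false true  = inj₁ refl
true⊎false false = inj₂ refl

delete-bridgeless : ∀ G v → BridgelessOn (λ s → not (s == v)) (restrict (adj G) (λ s → not (s == v))) →
  Bridgeless (delete G v)
delete-bridgeless G@record { n = suc m ; adj = A } v bl S ((x , Sx) , (y , Sy)) =
  subst (2 ≤_) (sym (cutSize-total (delete G v) S)) (≤-trans
    (bridgeless-minor (restrict A Q) v Q row′ col′ bl S (x , present x , Sx) (y , present y , Sy))
    (total-mono λ s t e → let a , p , q = cut-sound (minor v (restrict A Q)) S {s} {t} e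
      in cut-intro (minor v A) S (proj₁ (restrict-elim A Q a)) p q))
  where
    Q : Fin (suc m) → Bool
    Q s = not (s == v)
    absent : Q v ≡ false
    absent = cong not (==-refl v)
    present : ∀ i → Q (punchIn v i) ≡ true
    present i = not-false (==-≢ (Finₚ.punchInᵢ≢i v i))
    row′ : ∀ t → restrict A Q v t ≡ false
    row′ t = ¬-not λ e → true≢false (proj₁ (proj₂ (restrict-elim A Q {v} {t} e))) absent
    col′ : ∀ s → restrict A Q s v ≡ false
    col′ s = ¬-not λ e → true≢false (proj₂ (proj₂ (restrict-elim A Q {s} {v} e))) absent

delete-connected : ∀ G (v : Fin (n G)) → (∀ (T : Fin (n G) → Bool) {x y} → x ≢ v → T x ≡ true → y ≢ v → T y ≡ false →
    ∃[ s ] ∃[ t ] (s ≢ v × t ≢ v × adj G s t ≡ true × T s ≡ true × T t ≡ false)) → Connected (delete G v)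
delete-connected G@record { n = suc m ; adj = A } v crossing = connected (delete G v) cuts
  where
    cuts : ∀ S → NonemptyProper (delete G v) S → 1 ≤ total (cut (minor v A) S)
    cuts S ((x , Sx) , (y , Sy)) with crossing (extend v false S)
      (Finₚ.punchInᵢ≢i v x) (trans (extend-punchIn v false S x) Sx) (Finₚ.punchInᵢ≢i v y) (trans (extend-punchIn v false S y) Sy)
    ... | s , t , s≢v , t≢v , a , p , q with punchView v s | punchView v t
    ...   | hole    | _       = contradiction refl s≢v
    ...   | other i | hole    = contradiction refl t≢v
    ...   | other i | other j = total-nonempty (cut (minor v A) S) {i} {j} (cut-intro (minor v A) S a
            (trans (sym (extend-punchIn v false S i)) p) (trans (sym (extend-punchIn v false S j)) q))

-- Colours passing through a vertex of degree at most three

opaque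
  unfolding out

  out-indicator : ∀ {m} (X : Matrix m) (q : Matrix m) s →
    out X (λ s t → b2n (q s t)) s ≡ size (λ t → X s t ∧ q s t)
  out-indicator {m} X q s = sum-cong {m} λ t → trans (cong (X s t ▹_) (sym (▹-one (q s t))))
    (trans (sym (▹-∧ (X s t) (q s t) 1)) (▹-one _))

module Transition {m} {A : Matrix m} (symA : Symmetric A) (good : Good A) {x : Fin m} (deg : size (A x) ≤ 3) where
  open Good good

  private
    outgoing incoming : Colour → Fin m → Bool
    outgoing k t = A x t ∧ does (colour x t ≟ᶜ k)
    incoming k t = A t x ∧ does (colour t x ≟ᶜ k)

    does-sound : ∀ {P : Set} (d : Dec P) → does d ≡ true → P
    does-sound (yes p) _ = p

    outgoing-sound : ∀ {k t} → outgoing k t ≡ true → A x t ≡ true × colour x t ≡ k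
    outgoing-sound {k} {t} e = let p , q = ∧-true {A x t} e in p , does-sound (colour x t ≟ᶜ k) q

    incoming-intro : ∀ {k t} → A x t ≡ true → colour t x ≡ k → incoming k t ≡ true
    incoming-intro {k} {t} p q = ∧-intro (trans (symA t x) p) (dec-true (colour t x ≟ᶜ k) q)

    conserve : ∀ k → size (outgoing k) ≡ size (incoming k)
    conserve k = trans (sym (out-indicator A (λ s t → does (colour s t ≟ᶜ k)) x))
      (trans (balanced (λ c → b2n (does (c ≟ᶜ k))) x) (out-indicator (flip A) (λ s t → does (colour t s ≟ᶜ k)) x))

  -- Otherwise both arcs entering x from u and w would have to continue to the third neighbour of x.
  opaque
    passes : ∀ {u w} → u ≢ w → A x u ≡ true → A x w ≡ true → colour u x ≡ colour x w ⊎ colour w x ≡ colour x u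
    passes {u} {w} u≢w xu xw with colour u x ≟ᶜ colour x w | colour w x ≟ᶜ colour x u
    ... | yes e | _     = inj₁ e
    ... | no _  | yes e = inj₂ e
    ... | no ¬uw | no ¬wu = ⊥-elim contra
      where
        A-u-w : Fin m → Bool
        A-u-w = without (without (A x) u) w

        third : ∀ {t t′} → A x t ≡ true → A x t′ ≡ true → t ≢ u → t ≢ w → t′ ≢ u → t′ ≢ w → t′ ≡ t
        third {t} {t′} xt xt′ t≢u t≢w t′≢u t′≢w = decidable-stable (t′ Fin.≟ t) λ ne → contradiction deg (<⇒≱
          (member (A x) xu (member (without (A x) u) (without-intro (A x) xw (≢-sym u≢w))
            (member A-u-w (without-intro (without (A x) u) (without-intro (A x) xt t≢u) t≢w)
              (member (without A-u-w t) (without-intro A-u-w (without-intro (without (A x) u) (without-intro (A x) xt′ t′≢u) t′≢w) ne) z≤n)))))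

        no-return : ∀ {t y} → A x y ≡ true → colour x t ≡ colour y x → t ≢ y
        no-return {t} {y} xy e refl = turns xy (trans (symA y x) xy) e

        continues : ∀ {y} → A x y ≡ true → ∃[ t ] (A x t ≡ true × colour x t ≡ colour y x)
        continues {y} xy with pick (outgoing (colour y x))
          (subst (1 ≤_) (sym (conserve (colour y x))) (member (incoming (colour y x)) (incoming-intro xy refl) z≤n))
        ... | t , e , _ = t , outgoing-sound e

        contra : ⊥
        contra with continues xu | continues xw
        ... | t , xt , e | t′ , xt′ , e′ = twice
          where
            t≢w : t ≢ w
            t≢w refl = ¬uw (sym e)
            t′≢u : t′ ≢ u
            t′≢u refl = ¬wu (sym e′)
            k : Colour
            k = colour u x
            wx≡k : colour w x ≡ k
            wx≡k = trans (sym e′) (trans (cong (colour x) (third xt xt′ (no-return xu e) t≢w t′≢u (no-return xw e′))) e)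
            -- Both entering arcs continue along the same arc and hence share the colour `k`.
            -- Balance now demands two arcs of colour `k` leaving `x`, but neither may go to `u` or
            -- `w`, and there is only one other neighbour.
            in≥2 : 2 ≤ size (incoming k)
            in≥2 = member (incoming k) (incoming-intro xu refl)
              (member (without (incoming k) u) (without-intro (incoming k) (incoming-intro xw wx≡k) (≢-sym u≢w)) z≤n)
            avoids : ∀ {s} → colour x s ≡ k → s ≢ u × s ≢ w
            avoids e = no-return xu e , no-return xw (trans e (sym wx≡k))
            twice : ⊥
            twice with pick (outgoing k) (subst (2 ≤_) (sym (conserve k)) in≥2)
            ... | r , er , le with pick (without (outgoing k) r) le
            ...   | s , es , _ =
              let es′ , s≢r = without-elim (outgoing k) {r} {s} es
                  xr , kr = outgoing-sound {k} {r} er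
                  xs , ks = outgoing-sound {k} {s} es′
                  r≢u , r≢w = avoids kr
                  s≢u , s≢w = avoids ks
              in s≢r (third xr xs r≢u r≢w s≢u s≢w)

-- The minimal counterexample: first consequences and 2-connectedness

module Minimal (G : SimpleGraph) (minimal : MinimalCounterexample G) where
  A = adj G
  V = Fin (n G)
  bipartite = proj₁ (proj₁ minimal)
  side = proj₁ bipartite
  bip  = proj₂ bipartite
  bridgeless = proj₁ (proj₂ (proj₁ minimal))
  uncolourable = proj₂ (proj₂ (proj₁ minimal))
  symA = adj-sym G
  irrA = adj-irrefl G

  opaque
    notGood : ¬ Good A
    notGood good = uncolourable (good⇒colourable G bipartite good)

  flipped : ∀ {s t} → A s t ≡ true → A t s ≡ true
  flipped {s} {t} e = trans (symA t s) e

  distinct-ends : ∀ {s t} → A s t ≡ true → s ≢ t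
  distinct-ends {s} e refl = true≢false e (irrA s)

  opaque
    cuts : ∀ S {x y} → S x ≡ true → S y ≡ false → 2 ≤ total (cut A S)
    cuts S {x} {y} Sx Sy = subst (2 ≤_) (cutSize-total G S) (bridgeless S ((x , Sx) , (y , Sy)))

  opaque
    fewer-edges : SmallGood (total A)
    fewer-edges H bipH blH lt notGoodH = contradiction (proj₁ (proj₂ minimal) H
        (bipH , blH , λ col → notGoodH (colourable⇒good H bipH col)))
      (<⇒≱ (≰⇒> λ le → <⇒≱ lt (subst₂ _≤_ (sym (handshake G)) (sym (handshake H)) (+-mono-≤ le le))))

  opaque
    more-vertices : ∀ H → Bipartite H → Bridgeless H → total (adj H) ≡ total A → n G < n H → ¬ ¬ Good (adj H)
    more-vertices H bipH blH eq lt notGoodH = contradiction (proj₂ (proj₂ minimal) H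
        (bipH , blH , λ col → notGoodH (colourable⇒good H bipH col))
        (halve (trans (sym (handshake H)) (trans eq (handshake G)))))
      (<⇒≱ lt)
      where
        halve : ∀ {a b} → a + a ≡ b + b → a ≡ b
        halve {a} {b} e with <-cmp a b
        ... | tri< a<b _ _ = contradiction e (<⇒≢ (+-mono-< a<b a<b))
        ... | tri≈ _ a≡b _ = a≡b
        ... | tri> _ _ b<a = contradiction (sym e) (<⇒≢ (+-mono-< b<a b<a))

  opaque
    some-edge : ∃[ p ] ∃[ q ] A p q ≡ true
    some-edge with 1 ℕ.≤? total A
    ... | yes 1≤ = total-positive A 1≤
    ... | no none = contradiction good notGood
      where
        empty : ∀ s t → A s t ≡ false
        empty s t = ¬-not λ e → none (total-nonempty A e)
        good : Good A
        good = record { _≟ᶜ_ = Boolₚ._≟_ ; colour = λ _ _ → true ; turns = λ {s} {t} p → contradiction p (not-¬ (empty s t))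
          ; balanced = λ φ v → trans (out-empty A _ v (empty v)) (sym (out-empty (flip A) _ v (λ t → empty t v))) }

  opaque
    another-vertex : ∀ (v : V) → ∃[ w ] w ≢ v
    another-vertex v with some-edge
    ... | p , q , e with p Fin.≟ v
    ...   | no p≢v = p , p≢v
    ...   | yes refl = q , ≢-sym (distinct-ends e)

  opaque
    degree≥2 : ∀ v → 2 ≤ size (A v)
    degree≥2 v with another-vertex v
    ... | w , w≢v with two-entries _ (cuts (_== v) {v} {w} (==-refl v) (==-≢ w≢v))
    ...   | two {p} {q} {p′} {q′} e e′ ne with cut-sound A (_== v) {p} {q} e | cut-sound A (_== v) {p′} {q′} e′
    ...     | a , s , _ | a′ , s′ , _ with ==-sound {u = p} {v} s | ==-sound {u = p′} {v} s′
    ...       | refl | refl = member (A v) a (member (without (A v) q) (without-intro (A v) a′ (λ q≡ → ne (refl , q≡))) z≤n)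

  opaque
    neighbour-avoiding : ∀ v w → ∃[ t ] (A v t ≡ true × t ≢ w)
    neighbour-avoiding v w with pick (A v) (degree≥2 v)
    ... | x , e , le with x Fin.≟ w
    ...   | no x≢w = x , e , x≢w
    ...   | yes refl with pick (without (A v) x) le
    ...     | y , e′ , _ = y , without-elim (A v) e′

  opaque
    neighbour : ∀ v → ∃[ t ] A v t ≡ true
    neighbour v = let t , e , _ = neighbour-avoiding v v in t , e

  opaque
    -- The rest of the graph meets `P` only in `v`. Extending `S` outside `P` by its value at `v`
    -- therefore adds no edge to the cut.
    block-bridgeless : ∀ P v → P v ≡ true →
      (∀ {s t} → A s t ≡ true → (P s ≡ true × P t ≡ true) ⊎ ((P s ≡ false ⊎ s ≡ v) × (P t ≡ false ⊎ t ≡ v))) →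
      BridgelessOn P (restrict A P)
    block-bridgeless P v Pv block S (x , Px , Sx) (y , Py , Sy) =
      ≤-trans (cuts S′ {x} {y} (trans (inside Px) Sx) (trans (inside Py) Sy)) (total-mono sub)
      where
        S′ : V → Bool
        S′ s = if P s then S s else S v
        inside : ∀ {s} → P s ≡ true → S′ s ≡ S s
        inside {s} e = cong (if_then S s else S v) e
        outside : ∀ {s} → P s ≡ false ⊎ s ≡ v → S′ s ≡ S v
        outside {s} (inj₁ e) = cong (if_then S s else S v) e
        outside (inj₂ refl) = inside Pv
        sub : cut A S′ ⊆ cut (restrict A P) S
        sub s t e with cut-sound A S′ e
        ... | a , p , q with block a
        ...   | inj₁ (Ps , Pt) = cut-intro (restrict A P) S (restrict-intro A P a Ps Pt)
                  (trans (sym (inside Ps)) p) (trans (sym (inside Pt)) q)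
        ...   | inj₂ (os , ot) = contradiction (trans (trans (outside ot) (sym (outside os))) p) λ r → true≢false r q

  Crossing : (V → Bool) → V → V → V → Set
  Crossing T v s t = s ≢ v × t ≢ v × A s t ≡ true × T s ≡ true × T t ≡ false

  opaque
    -- Without such an edge, G is the edge-disjoint union of two proper subgraphs sharing only `v`.
    -- Both are bridgeless and smaller, hence good, and their colourings combine by `good-⊕`. The
    -- formulation by crossing edges lets later arguments find an edge avoiding `v` directly.
    no-cut-vertex : ∀ v T {x y} → x ≢ v → T x ≡ true → y ≢ v → T y ≡ false → ∃[ s ] ∃[ t ] Crossing T v s t
    no-cut-vertex v T {x} {y} x≢v Tx y≢v Ty with any? (λ s → any? λ t →
      ¬? (s Fin.≟ v) ×-dec ¬? (t Fin.≟ v) ×-dec (A s t Boolₚ.≟ true) ×-dec (T s Boolₚ.≟ true) ×-dec (T t Boolₚ.≟ false))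
    ... | yes found = found
    ... | no none = ⊥-elim (good-part T Tx x≢v Ty y≢v same λ good₁ →
        good-part (not ∘ T) (not-false Ty) y≢v (cong not Tx) x≢v (λ p q a → cong not (same p q a)) λ good₂ →
        notGood (good-⊕ (restrict-sym {A = A} symA (part T)) parts good₁ good₂))
      where
        same : ∀ {s t} → s ≢ v → t ≢ v → A s t ≡ true → T s ≡ T t
        same {s} {t} p q a with T s in Ts | T t in Tt
        ... | true  | true  = refl
        ... | false | false = refl
        ... | true  | false = contradiction (s , t , p , q , a , Ts , Tt) none
        ... | false | true  = contradiction (t , s , q , p , flipped a , Tt , Ts) none

        part : (V → Bool) → V → Bool
        part T s = T s ∨ (s == v)

        part-v : ∀ T → part T v ≡ true
        part-v T = ∨-introʳ (T v) (==-refl v)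

        part-other : ∀ T {s} → s ≢ v → part T s ≡ T s
        part-other T {s} ne = trans (cong (T s ∨_) (==-≢ ne)) (Boolₚ.∨-identityʳ (T s))

        good-part : ∀ T {x y} → T x ≡ true → x ≢ v → T y ≡ false → y ≢ v →
          (∀ {s t} → s ≢ v → t ≢ v → A s t ≡ true → T s ≡ T t) → ¬ ¬ Good (restrict A (part T))
        good-part T {x} {y} Tx x≢v Ty y≢v same = small-good fewer-edges (restrict A P) P
          (restrict-sym {A = A} symA P) (restrict-irrefl {A = A} irrA P)
          (side , λ s t e → bip s t (proj₁ (restrict-elim A P e)))
          (λ s t e → proj₁ (proj₂ (restrict-elim A P e)))
          (block-bridgeless P v (part-v T) block)
          (total-strict (restrict A P) A {y} {proj₁ (neighbour y)} (λ s t e → proj₁ (restrict-elim A P e))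
            (¬-not λ e → true≢false (proj₁ (proj₂ (restrict-elim A P e))) (trans (part-other T y≢v) Ty))
            (proj₂ (neighbour y)))
          where
            P : V → Bool
            P = part T
            block : ∀ {s t} → A s t ≡ true → (P s ≡ true × P t ≡ true) ⊎ ((P s ≡ false ⊎ s ≡ v) × (P t ≡ false ⊎ t ≡ v))
            block {s} {t} a = decide (s Fin.≟ v) (t Fin.≟ v) (true⊎false (P s)) (true⊎false (P t))
              where
                part-same : s ≢ v → t ≢ v → P s ≡ P t
                part-same p q = trans (part-other T p) (trans (same p q a) (sym (part-other T q)))
                decide : Dec (s ≡ v) → Dec (t ≡ v) → P s ≡ true ⊎ P s ≡ false → P t ≡ true ⊎ P t ≡ false →
                  (P s ≡ true × P t ≡ true) ⊎ ((P s ≡ false ⊎ s ≡ v) × (P t ≡ false ⊎ t ≡ v))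
                decide (yes p) (yes q) _ _ = inj₂ (inj₂ p , inj₂ q)
                decide (yes refl) (no _) _ (inj₁ e) = inj₁ (part-v T , e)
                decide (yes p) (no _) _ (inj₂ e) = inj₂ (inj₂ p , inj₁ e)
                decide (no _) (yes refl) (inj₁ e) _ = inj₁ (e , part-v T)
                decide (no _) (yes q) (inj₂ e) _ = inj₂ (inj₁ e , inj₂ q)
                decide (no p) (no q) (inj₁ e) _ = inj₁ (e , trans (sym (part-same p q)) e)
                decide (no p) (no q) (inj₂ e) _ = inj₂ (inj₁ e , inj₁ (trans (sym (part-same p q)) e))

        part-excl : ∀ {s} → part T s ≡ true → part (not ∘ T) s ≡ true → s ≡ v
        part-excl {s} e e′ with s Fin.≟ v
        ... | yes s≡v = s≡v
        ... | no _ with T s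
        part-excl {s} () e′ | no _ | false
        part-excl {s} e () | no _ | true

        parts : A ≐ restrict A (part T) ⊕ restrict A (part (not ∘ T))
        parts = ⊕-intro (λ s t e → proj₁ (restrict-elim A (part T) e)) (λ s t e → proj₁ (restrict-elim A (part (not ∘ T)) e))
          (λ s t e e′ → let a , p , q = restrict-elim A (part T) e ; _ , p′ , q′ = restrict-elim A (part (not ∘ T)) e′
            in distinct-ends a (trans (part-excl p p′) (sym (part-excl q q′)))) cover
          where
            side-of : ∀ s → part T s ≡ true ⊎ part (not ∘ T) s ≡ true
            side-of s with T s
            ... | true  = inj₁ refl
            ... | false = inj₂ refl
            cover : ∀ s t → A s t ≡ true → restrict A (part T) s t ≡ true ⊎ restrict A (part (not ∘ T)) s t ≡ true
            cover s t a = decide (s Fin.≟ v) (t Fin.≟ v)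
              where
                decide : Dec (s ≡ v) → Dec (t ≡ v) →
                  restrict A (part T) s t ≡ true ⊎ restrict A (part (not ∘ T)) s t ≡ true
                decide (yes refl) (yes refl) = contradiction refl (distinct-ends a)
                decide (yes refl) (no _) with side-of t
                ... | inj₁ e = inj₁ (restrict-intro A (part T) a (part-v T) e)
                ... | inj₂ e = inj₂ (restrict-intro A (part (not ∘ T)) a (part-v (not ∘ T)) e)
                decide (no _) (yes refl) with side-of s
                ... | inj₁ e = inj₁ (restrict-intro A (part T) a e (part-v T))
                ... | inj₂ e = inj₂ (restrict-intro A (part (not ∘ T)) a e (part-v (not ∘ T)))
                decide (no p) (no q) with true⊎false (T s)
                ... | inj₁ e = inj₁ (restrict-intro A (part T) a (trans (part-other T p) e)
                        (trans (part-other T q) (trans (sym (same p q a)) e)))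
                ... | inj₂ e = inj₂ (restrict-intro A (part (not ∘ T)) a (trans (part-other (not ∘ T) p) (cong not e))
                        (trans (part-other (not ∘ T) q) (cong not (trans (sym (same p q a)) e))))

  opaque
    two-neighbours : ∀ v → ∃[ t ] ∃[ t′ ] (A v t ≡ true × A v t′ ≡ true × t′ ≢ t)
    two-neighbours v with neighbour v
    ... | t , e with neighbour-avoiding v t
    ...   | t′ , e′ , ne = t , t′ , e , e′ , ne

    order≥3 : 3 ≤ n G
    order≥3 with some-edge
    ... | p , _ with two-neighbours p
    ...   | t , t′ , e , e′ , ne = three-distinct (distinct-ends e) (≢-sym ne) (distinct-ends e′)

  -- Fleischner's splitting argument: T obstructs splitting the edges v x₁ and v x₂ off v.
  record Obstruction (v x₁ x₂ x₃ x₄ : V) : Set where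
    field
      T      : V → Bool
      T-v    : T v ≡ false
      T-x₁   : T x₁ ≡ true
      T-x₂   : T x₂ ≡ true
      T-x₃   : T x₃ ≡ false
      T-x₄   : T x₄ ≡ false
      unique : ∀ {s t s′ t′} → Crossing T v s t → Crossing T v s′ t′ → s′ ≡ s × t′ ≡ t

  module Split (v x₁ x₂ x₃ x₄ : V) (vx₁ : A v x₁ ≡ true) (vx₂ : A v x₂ ≡ true) (vx₃ : A v x₃ ≡ true) (vx₄ : A v x₄ ≡ true)
    (x₁≢x₂ : x₁ ≢ x₂) (x₁≢x₃ : x₁ ≢ x₃) (x₁≢x₄ : x₁ ≢ x₄) (x₂≢x₃ : x₂ ≢ x₃) (x₂≢x₄ : x₂ ≢ x₄) (x₃≢x₄ : x₃ ≢ x₄) where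

    F B : Matrix (n G)
    F = edge v x₁ ∪ edge v x₂
    B = A ∖ F

    K : Matrix (suc (n G))
    K = splitOff B x₁ x₂

    F-sound : ∀ {s t} → F s t ≡ true → (s ≡ v × (t ≡ x₁ ⊎ t ≡ x₂)) ⊎ ((s ≡ x₁ ⊎ s ≡ x₂) × t ≡ v)
    F-sound {s} {t} e with ∨-elim {edge v x₁ s t} e
    ... | inj₁ e₁ with edge-sound v x₁ s t e₁
    ...   | inj₁ (p , q) = inj₁ (p , inj₁ q)
    ...   | inj₂ (p , q) = inj₂ (inj₁ p , q)
    F-sound {s} {t} e | inj₂ e₂ with edge-sound v x₂ s t e₂
    ...   | inj₁ (p , q) = inj₁ (p , inj₂ q)
    ...   | inj₂ (p , q) = inj₂ (inj₂ p , q)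

    F-vx₁ : F v x₁ ≡ true
    F-vx₁ = ∨-introˡ _ (edge-left v x₁)
    F-x₁v : F x₁ v ≡ true
    F-x₁v = ∨-introˡ _ (edge-right v x₁)
    F-vx₂ : F v x₂ ≡ true
    F-vx₂ = ∨-introʳ (edge v x₁ v x₂) (edge-left v x₂)
    F-x₂v : F x₂ v ≡ true
    F-x₂v = ∨-introʳ (edge v x₁ x₂ v) (edge-right v x₂)

    F-sym : Symmetric F
    F-sym s t = cong₂ _∨_ (edge-sym v x₁ s t) (edge-sym v x₂ s t)

    F⊕ : F ≐ edge v x₁ ⊕ edge v x₂
    F⊕ = ∪-⊕ λ {s} {t} p q → absurd (edge-sound v x₁ s t p) (edge-sound v x₂ s t q)
      where
        absurd : ∀ {s t} → (s ≡ v × t ≡ x₁) ⊎ (s ≡ x₁ × t ≡ v) → (s ≡ v × t ≡ x₂) ⊎ (s ≡ x₂ × t ≡ v) → ⊥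
        absurd (inj₁ (refl , refl)) (inj₁ (_ , e)) = x₁≢x₂ e
        absurd (inj₁ (refl , refl)) (inj₂ (e , _)) = distinct-ends vx₂ e
        absurd (inj₂ (refl , refl)) (inj₁ (e , _)) = distinct-ends vx₁ (sym e)
        absurd (inj₂ (refl , refl)) (inj₂ (e , _)) = x₁≢x₂ e

    F⊆A : F ⊆ A
    F⊆A s t e with ⊕-cases F⊕ s t e
    ... | inj₁ p = edge⊆ symA vx₁ s t p
    ... | inj₂ p = edge⊆ symA vx₂ s t p

    B-sym : Symmetric B
    B-sym = ∖-sym {A = A} symA F-sym

    A⊕ : A ≐ B ⊕ F
    A⊕ = ∖-⊕ F⊆A

    not-good : ¬ Good K
    not-good good = notGood (merge (distinct-ends vx₁) (distinct-ends vx₂) x₁≢x₂ symA B-sym A⊕ F⊕ good)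

    K-sym : Symmetric K
    K-sym = splitOff-sym (distinct-ends vx₁) (distinct-ends vx₂) x₁≢x₂ symA B-sym A⊕ F⊕

    H : SimpleGraph
    H = record { n = suc (n G) ; adj = K ; adj-sym = K-sym ; adj-irrefl = irr }
      where
        irr : ∀ s → K s s ≡ false
        irr zero    = refl
        irr (suc s) = cong (_∧ not (F s s)) (irrA s)

    H-bipartite : Bipartite H
    H-bipartite = sideH , bipH
      where
        sideH : Fin (suc (n G)) → Bool
        sideH zero    = side v
        sideH (suc s) = side s
        chosen : ∀ {s} → (s == x₁) ∨ (s == x₂) ≡ true → A v s ≡ true
        chosen {s} e with ∨-elim {s == x₁} e
        ... | inj₁ p = subst (λ t → A v t ≡ true) (sym (==-sound {u = s} p)) vx₁
        ... | inj₂ p = subst (λ t → A v t ≡ true) (sym (==-sound {u = s} p)) vx₂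
        bipH : ∀ s t → K s t ≡ true → sideH s ≢ sideH t
        bipH zero    (suc t) e = bip v t (chosen e)
        bipH (suc s) zero    e = ≢-sym (bip v s (chosen e))
        bipH (suc s) (suc t) e = bip s t (proj₁ (∧-true e))

    opaque
      -- This is where maximality of the number of vertices enters: `H` has as many edges as G and
      -- one more vertex, and a good colouring of it could be merged.
      not-bridgeless : ¬ Bridgeless H
      not-bridgeless bl = more-vertices H H-bipartite bl
        (total-splitOff (distinct-ends vx₁) (distinct-ends vx₂) x₁≢x₂ symA B-sym A⊕ F⊕) ≤-refl not-good

    K-x₁ : K zero (suc x₁) ≡ true
    K-x₁ = ∨-introˡ _ (==-refl x₁)
    K-x₂ : K zero (suc x₂) ≡ true
    K-x₂ = ∨-introʳ (x₂ == x₁) (==-refl x₂)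

    module Small (S : Fin (suc (n G)) → Bool) (S-v : S (suc v) ≡ false) (small : ¬ 2 ≤ total (cut K S)) where
      T : V → Bool
      T = S ∘ suc

      absurd : ∀ s t s′ t′ → cut K S s t ≡ true → cut K S s′ t′ ≡ true → ¬ (s′ ≡ s × t′ ≡ t) → ⊥
      absurd s t s′ t′ p q ne = small (total≥2 (cut K S) p q ne)

      old : ∀ {s t} → A s t ≡ true → F s t ≡ false → T s ≡ true → T t ≡ false → cut K S (suc s) (suc t) ≡ true
      old a f p q = cut-intro K S (∧-intro a (not-false f)) p q

      from-T : ∀ {s t} → T s ≡ true → F s t ≡ true → (s ≡ x₁ ⊎ s ≡ x₂) × t ≡ v
      from-T p f with F-sound f
      ... | inj₁ (refl , _) = contradiction S-v (true≢false p)
      ... | inj₂ r = r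

      -- With `zero` and `v` on the same side, identifying them changes no cut, so two cut edges of
      -- G give two in `K`; `ρ` redirects the detached edges to `zero`.
      new-vertex-outside : S zero ≡ false → ∀ {z} → T z ≡ true → ⊥
      new-vertex-outside S0 {z} Tz with two-entries _ (cuts T {z} {v} Tz S-v)
      ... | two {p} {q} {p′} {q′} e e′ ne = absurd (suc p) (ρ p q) (suc p′) (ρ p′ q′) (image e) (image e′) λ (r , r′) → differ r r′
        where
          ρ : V → V → Fin (suc (n G))
          ρ s t = if F s t then zero else suc t
          image : ∀ {s t} → cut A T s t ≡ true → cut K S (suc s) (ρ s t) ≡ true
          image {s} {t} e with cut-sound A T e
          ... | a , Ts , Tt with F s t in f
          ...   | false = old a f Ts Tt
          ...   | true with from-T {s} {t} Ts f
          ...     | inj₁ refl , refl = cut-intro K S K-x₁ Ts S0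
          ...     | inj₂ refl , refl = cut-intro K S K-x₂ Ts S0
          differ : suc p′ ≡ suc p → ρ p′ q′ ≡ ρ p q → ⊥
          differ r r′ with F p q in f | F p′ q′ in f′
          differ refl r′ | true | true = ne (refl , trans
            (proj₂ (from-T {p} {q′} (proj₁ (proj₂ (cut-sound A T e′))) f′))
            (sym (proj₂ (from-T {p} {q} (proj₁ (proj₂ (cut-sound A T e))) f))))
          differ refl refl | false | false = ne (refl , refl)

      module Inside (S0 : S zero ≡ true) where

        -- If both neighbours of `zero` were outside, its two edges would be cut. If only `y` were,
        -- then `T` has two cut edges in G; at most one of them, `y′ v`, is not cut in `K`, and the
        -- cut edge from `zero` to `y` takes its place.
        contains : ∀ y y′ → K zero (suc y) ≡ true → K zero (suc y′) ≡ true → y ≢ y′ →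
          (∀ {s t} → T s ≡ true → F s t ≡ true → (s ≡ y ⊎ s ≡ y′) × t ≡ v) → T y ≡ true
        contains y y′ Ky Ky′ y≢y′ from with true⊎false (T y)
        ... | inj₁ Ty = Ty
        ... | inj₂ Ty with true⊎false (T y′)
        ...   | inj₂ Ty′ = ⊥-elim (absurd zero (suc y) zero (suc y′) (cut-intro K S Ky S0 Ty) (cut-intro K S Ky′ S0 Ty′) λ { (_ , refl) → y≢y′ refl })
        ...   | inj₁ Ty′ with two-entries _ (cuts T {y′} {v} Ty′ S-v)
        ...     | two {p} {q} {p′} {q′} e e′ ne = ⊥-elim (absurd (ρ p q) (ρ′ p q) (ρ p′ q′) (ρ′ p′ q′) (image e) (image e′) λ (r , r′) → differ r r′)
          where
            ρ ρ′ : V → V → Fin (suc (n G))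
            ρ  s t = if F s t then zero else suc s
            ρ′ s t = if F s t then suc y else suc t
            image : ∀ {s t} → cut A T s t ≡ true → cut K S (ρ s t) (ρ′ s t) ≡ true
            image {s} {t} e with cut-sound A T e
            ... | a , Ts , Tt with F s t in f
            ...   | false = old a f Ts Tt
            ...   | true = cut-intro K S Ky S0 Ty
            only : ∀ {s t} → cut A T s t ≡ true → F s t ≡ true → s ≡ y′ × t ≡ v
            only {s} {t} e f with cut-sound A T {s} {t} e
            ... | a , Ts , Tt with from Ts f
            ...   | inj₁ refl , _ = contradiction Ty (true≢false Ts)
            ...   | inj₂ r , r′ = r , r′
            differ : ρ p′ q′ ≡ ρ p q → ρ′ p′ q′ ≡ ρ′ p q → ⊥
            differ r r′ with F p q in f | F p′ q′ in f′
            differ refl refl | false | false = ne (refl , refl)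
            differ r r′ | true | true with only {p} {q} e f | only {p′} {q′} e′ f′
            ... | refl , refl | refl , refl = ne (refl , refl)

        T-x₁ : T x₁ ≡ true
        T-x₁ = contains x₁ x₂ K-x₁ K-x₂ x₁≢x₂ from-T
        T-x₂ : T x₂ ≡ true
        T-x₂ = contains x₂ x₁ K-x₂ K-x₁ (≢-sym x₁≢x₂)
          λ p f → let r , r′ = from-T p f in [ inj₂ , inj₁ ]′ r , r′

        -- If `z` were in `T`, the edge `z v` would be cut. A second cut edge is `z′ v` when `z′` is
        -- in `T` as well, and otherwise an edge leaving `T` away from `v`.
        excludes : ∀ z z′ → A z v ≡ true → A z′ v ≡ true → z ≢ x₁ → z ≢ x₂ → z′ ≢ x₁ → z′ ≢ x₂ → z ≢ z′ → T z ≡ false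
        excludes z z′ zv z′v z≢x₁ z≢x₂ z′≢x₁ z′≢x₂ z≢z′ with true⊎false (T z)
        ... | inj₂ Tz = Tz
        ... | inj₁ Tz with true⊎false (T z′)
        ...   | inj₁ Tz′ = ⊥-elim (absurd (suc z) (suc v) (suc z′) (suc v) (old zv (not-F Tz z≢x₁ z≢x₂) Tz S-v) (old z′v (not-F Tz′ z′≢x₁ z′≢x₂) Tz′ S-v)
                (λ { (refl , _) → z≢z′ refl }))
          where
            not-F : ∀ {z} → T z ≡ true → z ≢ x₁ → z ≢ x₂ → F z v ≡ false
            not-F Tz p q = ¬-not λ f → [ p , q ]′ (proj₁ (from-T Tz f))
        ...   | inj₂ Tz′ with no-cut-vertex v T {z} {z′} (distinct-ends zv) Tz (distinct-ends z′v) Tz′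
        ...     | s , t , s≢v , t≢v , a , Ts , Tt = ⊥-elim (absurd (suc z) (suc v) (suc s) (suc t)
                  (old zv (¬-not λ f → [ z≢x₁ , z≢x₂ ]′ (proj₁ (from-T Tz f))) Tz S-v)
                  (old a (¬-not λ f → t≢v (proj₂ (from-T Ts f))) Ts Tt) λ { (_ , refl) → t≢v refl })

        obstruction : Obstruction v x₁ x₂ x₃ x₄
        obstruction = record
          { T = T ; T-v = S-v ; T-x₁ = T-x₁ ; T-x₂ = T-x₂
          ; T-x₃ = excludes x₃ x₄ (flipped vx₃) (flipped vx₄) (≢-sym x₁≢x₃) (≢-sym x₂≢x₃) (≢-sym x₁≢x₄) (≢-sym x₂≢x₄) x₃≢x₄
          ; T-x₄ = excludes x₄ x₃ (flipped vx₄) (flipped vx₃) (≢-sym x₁≢x₄) (≢-sym x₂≢x₄) (≢-sym x₁≢x₃) (≢-sym x₂≢x₃) (≢-sym x₃≢x₄)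
          ; unique = unique }
          where
            old′ : ∀ {s t} → Crossing T v s t → cut K S (suc s) (suc t) ≡ true
            old′ (_ , t≢v , a , Ts , Tt) = old a (¬-not λ f → t≢v (proj₂ (from-T Ts f))) Ts Tt
            unique : ∀ {s t s′ t′} → Crossing T v s t → Crossing T v s′ t′ → s′ ≡ s × t′ ≡ t
            unique {s} {t} {s′} {t′} c c′ with (s′ Fin.≟ s) ×-dec (t′ Fin.≟ t)
            ... | yes e = e
            ... | no ne = ⊥-elim (absurd (suc s) (suc t) (suc s′) (suc t′) (old′ c) (old′ c′) λ { (refl , refl) → ne (refl , refl) })

    small-cut : ∀ S {z} → S (suc v) ≡ false → S z ≡ true → ¬ 2 ≤ total (cut K S) → Obstruction v x₁ x₂ x₃ x₄
    small-cut S {z} Sv Sz small with true⊎false (S zero)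
    ... | inj₁ S0 = Small.Inside.obstruction S Sv small S0
    small-cut S {zero}  Sv Sz small | inj₂ S0 = contradiction S0 (true≢false Sz)
    small-cut S {suc z} Sv Sz small | inj₂ S0 = ⊥-elim (Small.new-vertex-outside S Sv small S0 Sz)

    opaque
      -- Since G cannot be split at these edges, some cut of `K` is too small. After passing to the
      -- complement it leaves `v` outside, and then it must contain the new vertex.
      obstructed : ¬ ¬ Obstruction v x₁ x₂ x₃ x₄
      obstructed none = not-bridgeless λ S ((x , Sx) , (y , Sy)) → subst (2 ≤_) (sym (cutSize-total H S)) (bound S Sx Sy)
        where
          bound : ∀ S {x y} → S x ≡ true → S y ≡ false → 2 ≤ total (cut K S)
          bound S {x} {y} Sx Sy = decidable-stable (2 ℕ.≤? _) λ small → go small (true⊎false (S (suc v)))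
            where
              go : ¬ 2 ≤ total (cut K S) → S (suc v) ≡ true ⊎ S (suc v) ≡ false → ⊥
              go small (inj₂ Sv) = none (small-cut S Sv Sx small)
              go small (inj₁ Sv) = none (small-cut (not ∘ S) (cong not Sv) (not-false Sy)
                (λ le → small (subst (2 ≤_) (cut-complement K K-sym S) le)))

  -- G − v is connected, but only the edges p q and p′ q′ join the four nonempty atoms of T and T′.
  incompatible : ∀ {v x₁ x₂ x₃ x₄} → A v x₁ ≡ true → A v x₂ ≡ true → A v x₃ ≡ true → A v x₄ ≡ true →
    Obstruction v x₁ x₂ x₃ x₄ → Obstruction v x₁ x₃ x₂ x₄ → ⊥
  incompatible {v} {x₁} {x₂} {x₃} {x₄} vx₁ vx₂ vx₃ vx₄ ob ob′ = conclude crossing-T crossing-T′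
    where
      module O = Obstruction ob
      module O′ = Obstruction ob′
      T  = O.T
      T′ = O′.T

      ne : ∀ {x} → A v x ≡ true → x ≢ v
      ne e = ≢-sym (distinct-ends e)

      crossing-T  = no-cut-vertex v T  {x₁} {x₃} (ne vx₁) O.T-x₁ (ne vx₃) O.T-x₃
      crossing-T′ = no-cut-vertex v T′ {x₁} {x₂} (ne vx₁) O′.T-x₁ (ne vx₂) O′.T-x₃

      -- The vertices `x₁`, `x₂`, `x₃`, `x₄` witness that the atoms 11, 10, 01, 00 are nonempty, the
      -- first digit referring to `T` and the second to `T′`.
      Atom : Bool → Bool → V → Bool
      Atom i j s = agrees (T s) i ∧ agrees (T′ s) j

      inside : ∀ {i j s} → Atom i j s ≡ true → T s ≡ i × T′ s ≡ j
      inside {i} {j} {s} e = let p , q = ∧-true {agrees (T s) i} e in agrees-sound p , agrees-sound q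

      inside⁻ : ∀ {i j s} → T s ≡ i → T′ s ≡ j → Atom i j s ≡ true
      inside⁻ p q = ∧-intro (agrees-≡ p) (agrees-≡ q)

      outside : ∀ {i j s} → Atom i j s ≡ false → T s ≡ i → T′ s ≡ j → ⊥
      outside {i} {j} {s} e p q = true≢false (inside⁻ {i} {j} {s} p q) e

      conclude : ∃[ p ] ∃[ q ] Crossing T v p q → ∃[ p ] ∃[ q ] Crossing T′ v p q → ⊥
      conclude (p , q , c) (p′ , q′ , c′) = final (true⊎false (T′ p)) leaving-11 leaving-10 leaving-01 leaving-00
        where
          e-T  : ∀ {s t} → Crossing T v s t → s ≡ p × t ≡ q
          e-T = O.unique c
          e-T′ : ∀ {s t} → Crossing T′ v s t → s ≡ p′ × t ≡ q′
          e-T′ = O′.unique c′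

          -- An edge of G - v leaving an atom changes `T` or `T′`, hence is `p q` or `p′ q′`. The
          -- alternatives record which sides their ends must then have; the next three facts treat
          -- the other atoms.
          leaving-11 : T′ p ≡ true ⊎ (T p′ ≡ true × T q′ ≡ true)
          leaving-11 with no-cut-vertex v (Atom true true) {x₁} {x₄} (ne vx₁) (inside⁻ {s = x₁} O.T-x₁ O′.T-x₁) (ne vx₄)
                            (¬-not λ e → true≢false (proj₁ (inside {true} {true} {x₄} e)) O.T-x₄)
          ... | y , z , y≢v , z≢v , a , iy , oz with inside {true} {true} {y} iy | true⊎false (T z)
          ...   | Ty , T′y | inj₂ Tz with e-T (y≢v , z≢v , a , Ty , Tz)
          ...     | refl , refl = inj₁ T′y
          leaving-11 | y , z , y≢v , z≢v , a , iy , oz | Ty , T′y | inj₁ Tz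
            with e-T′ (y≢v , z≢v , a , T′y , ¬-not λ T′z → outside {true} {true} {z} oz Tz T′z)
          ...     | refl , refl = inj₂ (Ty , Tz)

          leaving-10 : T′ p ≡ false ⊎ (T p′ ≡ true × T q′ ≡ true)
          leaving-10 with no-cut-vertex v (Atom true false) {x₂} {x₁} (ne vx₂) (inside⁻ {s = x₂} O.T-x₂ O′.T-x₃) (ne vx₁)
                            (¬-not λ e → true≢false O′.T-x₁ (proj₂ (inside {true} {false} {x₁} e)))
          ... | y , z , y≢v , z≢v , a , iy , oz with inside {true} {false} {y} iy | true⊎false (T z)
          ...   | Ty , T′y | inj₂ Tz with e-T (y≢v , z≢v , a , Ty , Tz)
          ...     | refl , refl = inj₁ T′y
          leaving-10 | y , z , y≢v , z≢v , a , iy , oz | Ty , T′y | inj₁ Tz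
            with e-T′ (z≢v , y≢v , flipped a , ¬-not (λ T′z → outside {true} {false} {z} oz Tz T′z) , T′y)
          ...     | refl , refl = inj₂ (Tz , Ty)

          leaving-01 : T p′ ≡ false ⊎ (T′ p ≡ true × T′ q ≡ true)
          leaving-01 with no-cut-vertex v (Atom false true) {x₃} {x₁} (ne vx₃) (inside⁻ {s = x₃} O.T-x₃ O′.T-x₂) (ne vx₁)
                            (¬-not λ e → true≢false O.T-x₁ (proj₁ (inside {false} {true} {x₁} e)))
          ... | y , z , y≢v , z≢v , a , iy , oz with inside {false} {true} {y} iy | true⊎false (T′ z)
          ...   | Ty , T′y | inj₂ T′z with e-T′ (y≢v , z≢v , a , T′y , T′z)
          ...     | refl , refl = inj₁ Ty
          leaving-01 | y , z , y≢v , z≢v , a , iy , oz | Ty , T′y | inj₁ T′z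
            with e-T (z≢v , y≢v , flipped a , ¬-not (λ Tz → outside {false} {true} {z} oz Tz T′z) , Ty)
          ...     | refl , refl = inj₂ (T′z , T′y)

          leaving-00 : T′ q ≡ false ⊎ (T p′ ≡ false × T q′ ≡ false)
          leaving-00 with no-cut-vertex v (Atom false false) {x₄} {x₁} (ne vx₄) (inside⁻ {s = x₄} O.T-x₄ O′.T-x₄) (ne vx₁)
                            (¬-not λ e → true≢false O.T-x₁ (proj₁ (inside {false} {false} {x₁} e)))
          ... | y , z , y≢v , z≢v , a , iy , oz with inside {false} {false} {y} iy | true⊎false (T z)
          ...   | Ty , T′y | inj₁ Tz with e-T (z≢v , y≢v , flipped a , Tz , Ty)
          ...     | refl , refl = inj₁ T′y
          leaving-00 | y , z , y≢v , z≢v , a , iy , oz | Ty , T′y | inj₂ Tz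
            with e-T′ (z≢v , y≢v , flipped a , ¬-not (λ T′z → outside {false} {false} {z} oz Tz T′z) , T′y)
          ...     | refl , refl = inj₂ (Tz , Ty)

          -- Only one of the two atoms inside `T` contains `p`, so the other is left along `p′ q′`,
          -- which therefore lies inside `T`. Both atoms outside `T` would then have to be left
          -- along `p q`, although `q` lies in only one of them.
          final : T′ p ≡ true ⊎ T′ p ≡ false →
            T′ p ≡ true ⊎ (T p′ ≡ true × T q′ ≡ true) → T′ p ≡ false ⊎ (T p′ ≡ true × T q′ ≡ true) →
            T p′ ≡ false ⊎ (T′ p ≡ true × T′ q ≡ true) → T′ q ≡ false ⊎ (T p′ ≡ false × T q′ ≡ false) → ⊥
          final (inj₁ x) _ (inj₁ y) _ _ = true≢false x y
          final (inj₂ x) (inj₁ y) _ _ _ = true≢false y x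
          final (inj₁ x) _ (inj₂ (y , _)) l₁ l₀ = rest y l₁ l₀
            where
              rest : T p′ ≡ true → T p′ ≡ false ⊎ (T′ p ≡ true × T′ q ≡ true) → T′ q ≡ false ⊎ (T p′ ≡ false × T q′ ≡ false) → ⊥
              rest y (inj₁ z) _ = true≢false y z
              rest y (inj₂ (_ , z)) (inj₁ w) = true≢false z w
              rest y (inj₂ _) (inj₂ (w , _)) = true≢false y w
          final (inj₂ x) (inj₂ (y , _)) _ (inj₁ z) _ = true≢false y z
          final (inj₂ x) (inj₂ (y , _)) _ (inj₂ (z , _)) _ = true≢false z x

  -- The degrees

  opaque
    -- Among four neighbours, splitting off `x₁` with `x₂` and splitting off `x₁` with `x₃` would
    -- both be obstructed, and the two obstructions exclude each other.
    degree≤3 : ∀ v → size (A v) ≤ 3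
    degree≤3 v with size (A v) ℕ.≤? 3
    ... | yes le = le
    ... | no gt with pick (A v) (≰⇒> gt)
    ... | x₁ , e₁ , le₁ with pick (without (A v) x₁) le₁
    ... | x₂ , e₂ , le₂ with pick (without (without (A v) x₁) x₂) le₂
    ... | x₃ , e₃ , le₃ with pick (without (without (without (A v) x₁) x₂) x₃) le₃
    ... | x₄ , e₄ , _ =
      let vx₂ , 2≢1 = without-elim (A v) {x₁} {x₂} e₂
          e₃′ , 3≢2 = without-elim (without (A v) x₁) {x₂} {x₃} e₃
          vx₃ , 3≢1 = without-elim (A v) {x₁} {x₃} e₃′
          e₄′ , 4≢3 = without-elim (without (without (A v) x₁) x₂) {x₃} {x₄} e₄
          e₄″ , 4≢2 = without-elim (without (A v) x₁) {x₂} {x₄} e₄′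
          vx₄ , 4≢1 = without-elim (A v) {x₁} {x₄} e₄″
      in ⊥-elim (Split.obstructed v x₁ x₂ x₃ x₄ e₁ vx₂ vx₃ vx₄
            (≢-sym 2≢1) (≢-sym 3≢1) (≢-sym 4≢1) (≢-sym 3≢2) (≢-sym 4≢2) (≢-sym 4≢3)
            λ ob → Split.obstructed v x₁ x₃ x₂ x₄ e₁ vx₃ vx₂ vx₄
              (≢-sym 3≢1) (≢-sym 2≢1) (≢-sym 4≢1) 3≢2 (≢-sym 4≢3) (≢-sym 4≢2)
              λ ob′ → incompatible e₁ vx₂ vx₃ vx₄ ob ob′)

    -- Otherwise G would be regular, hence colourable.
    some-degree-2 : ∃[ v ] size (A v) ≡ 2
    some-degree-2 with any? (λ v → size (A v) ℕ.≟ 2)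
    ... | yes found = found
    ... | no none = contradiction (regular-colourable G 2 bipartite (λ v → trans (degree-out G v) (cubic v))
      ν ν⁻¹ νν⁻¹ ν⁻¹ν derangement) uncolourable
      where
        cubic : ∀ v → size (A v) ≡ 3
        cubic v = ≤-antisym (degree≤3 v) (≤∧≢⇒< (degree≥2 v) (λ e → none (v , sym e)))
        ν ν⁻¹ : Fin 3 → Fin 3
        ν zero = suc zero
        ν (suc zero) = suc (suc zero)
        ν (suc (suc zero)) = zero
        ν⁻¹ zero = suc (suc zero)
        ν⁻¹ (suc zero) = zero
        ν⁻¹ (suc (suc zero)) = suc zero
        νν⁻¹ : ∀ k → ν (ν⁻¹ k) ≡ k
        νν⁻¹ zero = refl
        νν⁻¹ (suc zero) = refl
        νν⁻¹ (suc (suc zero)) = refl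
        ν⁻¹ν : ∀ k → ν⁻¹ (ν k) ≡ k
        ν⁻¹ν zero = refl
        ν⁻¹ν (suc zero) = refl
        ν⁻¹ν (suc (suc zero)) = refl
        derangement : ∀ k → ν k ≢ k
        derangement zero ()
        derangement (suc zero) ()
        derangement (suc (suc zero)) ()

    -- Otherwise G is 2-regular, and exchanging the two colours of a proper colouring gives the
    -- second one.
    some-degree-3 : ∃[ v ] size (A v) ≡ 3
    some-degree-3 with any? (λ v → size (A v) ℕ.≟ 3)
    ... | yes found = found
    ... | no none = contradiction (regular-colourable G 1 bipartite (λ v → trans (degree-out G v) (cycle v))
      ν ν νν νν derangement) uncolourable
      where
        cycle : ∀ v → size (A v) ≡ 2
        cycle v = ≤-antisym (ℕ.s≤s⁻¹ (≤∧≢⇒< (degree≤3 v) (λ e → none (v , e)))) (degree≥2 v)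
        ν : Fin 2 → Fin 2
        ν zero = suc zero
        ν (suc zero) = zero
        νν : ∀ k → ν (ν k) ≡ k
        νν zero = refl
        νν (suc zero) = refl
        derangement : ∀ k → ν k ≢ k
        derangement zero ()
        derangement (suc zero) ()

  -- Edge cuts of size two

  record TwoCut (S : V → Bool) (a b c d : V) : Set where
    field
      Sa      : S a ≡ true
      Sb      : S b ≡ false
      Sc      : S c ≡ true
      Sd      : S d ≡ false
      ab      : A a b ≡ true
      cd      : A c d ≡ true
      exhaust : ∀ {s t} → A s t ≡ true → S s ≡ true → S t ≡ false → (s ≡ a × t ≡ b) ⊎ (s ≡ c × t ≡ d)

  complement : ∀ {S a b c d} → TwoCut S a b c d → TwoCut (not ∘ S) b a d c
  complement {S} {a} {b} {c} {d} two-cut = record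
    { Sa = not-false Sb ; Sb = cong not Sa ; Sc = not-false Sd ; Sd = cong not Sc
    ; ab = flipped ab ; cd = flipped cd
    ; exhaust = λ e p q → turn (exhaust (flipped e) (Boolₚ.not-injective q) (not-true p)) }
    where
      open TwoCut two-cut
      turn : ∀ {s t} → (t ≡ a × s ≡ b) ⊎ (t ≡ c × s ≡ d) → (s ≡ b × t ≡ a) ⊎ (s ≡ d × t ≡ c)
      turn (inj₁ (p , q)) = inj₁ (q , p)
      turn (inj₂ (p , q)) = inj₂ (q , p)

  opaque
    -- The two cut edges need only differ as edges. They may share an end, as happens when one side
    -- is a vertex of degree two.
    not-both-halves : ∀ {S a b c d} → TwoCut S a b c d → ¬ (a ≡ c × b ≡ d) →
      HalfGood (restrict A S) a c → HalfGood (restrict A (not ∘ S)) b d → ⊥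
    not-both-halves {S} {a} {b} {c} {d} two-cut distinct half half′ = notGood
      (glue (distinct-ends ab) (distinct-ends cd) (restrict-sym {A = A} symA S) (restrict-sym {A = A} symA (not ∘ S))
        W⊕ V⊕ (⊕-intro W⊆A V⊆A excl cover) half half′)
      where
        open TwoCut two-cut
        R R′ W : Matrix (n G)
        R = restrict A S
        R′ = restrict A (not ∘ S)
        W = R ∪ R′
        W⊕ : W ≐ R ⊕ R′
        W⊕ = ∪-⊕ λ {s} {t} p q → true≢false (proj₁ (proj₂ (restrict-elim A S {s} {t} p)))
          (not-true (proj₁ (proj₂ (restrict-elim A (not ∘ S) {s} {t} q))))
        V⊕ : edge a b ∪ edge c d ≐ edge a b ⊕ edge c d
        V⊕ = ∪-⊕ λ {s} {t} p q → absurd (edge-sound a b s t p) (edge-sound c d s t q)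
          where
            absurd : ∀ {s t} → (s ≡ a × t ≡ b) ⊎ (s ≡ b × t ≡ a) → (s ≡ c × t ≡ d) ⊎ (s ≡ d × t ≡ c) → ⊥
            absurd (inj₁ (p , q)) (inj₁ (p′ , q′)) = distinct (trans (sym p) p′ , trans (sym q) q′)
            absurd (inj₁ (refl , _)) (inj₂ (refl , _)) = true≢false Sa Sd
            absurd (inj₂ (refl , _)) (inj₁ (refl , _)) = true≢false Sc Sb
            absurd (inj₂ (p , q)) (inj₂ (p′ , q′)) = distinct (trans (sym q) q′ , trans (sym p) p′)
        W⊆A : W ⊆ A
        W⊆A s t e with ∨-elim {R s t} e
        ... | inj₁ p = proj₁ (restrict-elim A S p)
        ... | inj₂ p = proj₁ (restrict-elim A (not ∘ S) p)
        V⊆A : edge a b ∪ edge c d ⊆ A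
        V⊆A s t e with ∨-elim {edge a b s t} e
        ... | inj₁ p = edge⊆ symA ab s t p
        ... | inj₂ p = edge⊆ symA cd s t p
        same-side : ∀ {s t} → W s t ≡ true → S s ≡ S t
        same-side {s} {t} e with ∨-elim {R s t} e
        ... | inj₁ p = let _ , q , r = restrict-elim A S p in trans q (sym r)
        ... | inj₂ p = let _ , q , r = restrict-elim A (not ∘ S) p in trans (not-true q) (sym (not-true r))
        other-side : ∀ {s t} → (edge a b ∪ edge c d) s t ≡ true → S s ≢ S t
        other-side {s} {t} e eq with ∨-elim {edge a b s t} e
        ... | inj₁ p with edge-sound a b s t p
        ...   | inj₁ (refl , refl) = true≢false (trans (sym eq) Sa) Sb
        ...   | inj₂ (refl , refl) = true≢false (trans eq Sa) Sb
        other-side {s} {t} e eq | inj₂ p with edge-sound c d s t p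
        ...   | inj₁ (refl , refl) = true≢false (trans (sym eq) Sc) Sd
        ...   | inj₂ (refl , refl) = true≢false (trans eq Sc) Sd
        excl : ∀ s t → W s t ≡ true → (edge a b ∪ edge c d) s t ≡ true → ⊥
        excl s t p q = other-side q (same-side p)
        crossing : ∀ {s t} → (s ≡ a × t ≡ b) ⊎ (s ≡ c × t ≡ d) → (edge a b ∪ edge c d) s t ≡ true × (edge a b ∪ edge c d) t s ≡ true
        crossing (inj₁ (refl , refl)) = ∨-introˡ _ (edge-left a b) , ∨-introˡ _ (edge-right a b)
        crossing (inj₂ (refl , refl)) = ∨-introʳ (edge a b c d) (edge-left c d) , ∨-introʳ (edge a b d c) (edge-right c d)
        cover : ∀ s t → A s t ≡ true → W s t ≡ true ⊎ (edge a b ∪ edge c d) s t ≡ true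
        cover s t e with true⊎false (S s) | true⊎false (S t)
        ... | inj₁ p | inj₁ q = inj₁ (∨-introˡ _ (restrict-intro A S e p q))
        ... | inj₂ p | inj₂ q = inj₁ (∨-introʳ (R s t) (restrict-intro A (not ∘ S) e (not-false p) (not-false q)))
        ... | inj₁ p | inj₂ q = inj₂ (proj₁ (crossing (exhaust e p q)))
        ... | inj₂ p | inj₁ q = inj₂ (proj₂ (crossing (exhaust (flipped e) q p)))

  -- No vertex has all its edges in the cut, that is, the cut is nontrivial.
  Inner : (V → Bool) → Set
  Inner S = ∀ z → ∃[ u ] (A z u ≡ true × S u ≡ S z)

  inner-complement : ∀ {S} → Inner S → Inner (not ∘ S)
  inner-complement inner z = let u , e , p = inner z in u , e , cong not p

  module Half {S : V → Bool} {a b c d : V} (two-cut : TwoCut S a b c d) (a≢c : a ≢ c) (b≢d : b ≢ d) (inner : Inner S) where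
    open TwoCut two-cut

    R Y : Matrix (n G)
    R = restrict A S
    -- `Y` serves as a yardstick: it has four arcs more than `R` but misses the edge from `b` to an
    -- inner neighbour. Every replacement of the other side by at most two edges is therefore
    -- smaller than G.
    Y = R ∪ edge a b ∪ edge c d

    outside≢inside : ∀ {s t} → S s ≡ true → S t ≡ false → s ≢ t
    outside≢inside p q refl = true≢false p q

    R-elim : ∀ {s t} → R s t ≡ true → A s t ≡ true × S s ≡ true × S t ≡ true
    R-elim = restrict-elim A S

    Rab⊕ : R ∪ edge a b ≐ R ⊕ edge a b
    Rab⊕ = ∪-⊕ λ {s} {t} p q → absurd (R-elim p) (edge-sound a b s t q)
      where
        absurd : ∀ {s t} → A s t ≡ true × S s ≡ true × S t ≡ true → (s ≡ a × t ≡ b) ⊎ (s ≡ b × t ≡ a) → ⊥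
        absurd (_ , p , q) (inj₁ (_ , refl)) = true≢false q Sb
        absurd (_ , p , q) (inj₂ (refl , _)) = true≢false p Sb

    Y⊕ : Y ≐ R ∪ edge a b ⊕ edge c d
    Y⊕ = ∪-⊕ λ {s} {t} p q → absurd (⊕-cases Rab⊕ s t p) (edge-sound c d s t q)
      where
        absurd : ∀ {s t} → R s t ≡ true ⊎ edge a b s t ≡ true → (s ≡ c × t ≡ d) ⊎ (s ≡ d × t ≡ c) → ⊥
        absurd (inj₁ r) (inj₁ (_ , refl)) = true≢false (proj₂ (proj₂ (R-elim r))) Sd
        absurd (inj₁ r) (inj₂ (refl , _)) = true≢false (proj₁ (proj₂ (R-elim r))) Sd
        absurd {s} {t} (inj₂ e) r with edge-sound a b s t e | r
        ... | inj₁ (refl , refl) | inj₁ (p , _) = a≢c p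
        ... | inj₁ (refl , refl) | inj₂ (p , _) = true≢false (subst (λ s → S s ≡ true) p Sa) Sd
        ... | inj₂ (refl , refl) | inj₁ (p , _) = true≢false (subst (λ s → S s ≡ true) (sym p) Sc) Sb
        ... | inj₂ (refl , refl) | inj₂ (_ , p) = a≢c p

    total-Y : total Y ≡ total R + 4
    total-Y = trans (total-⊕ Y⊕) (trans (cong₂ _+_ (trans (total-⊕ Rab⊕) (cong (total R +_) (total-edge (distinct-ends ab))))
      (total-edge (distinct-ends cd))) (+-assoc (total R) 2 2))

    opaque
      Y<A : total Y < total A
      Y<A with inner b
      ... | b′ , bb′ , Sb′ = total-strict Y A {b} {b′} Y⊆A (¬-not not-Y) bb′
        where
          Y⊆A : Y ⊆ A
          Y⊆A s t e with ⊕-cases Y⊕ s t e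
          ... | inj₂ p = edge⊆ symA cd s t p
          ... | inj₁ p with ⊕-cases Rab⊕ s t p
          ...   | inj₁ r = proj₁ (R-elim r)
          ...   | inj₂ r = edge⊆ symA ab s t r
          not-Y : Y b b′ ≢ true
          not-Y e with ⊕-cases Y⊕ b b′ e
          ... | inj₂ p with edge-sound c d b b′ p
          ...   | inj₁ (refl , _) = true≢false Sc Sb
          ...   | inj₂ (q , _) = b≢d q
          not-Y e | inj₁ p with ⊕-cases Rab⊕ b b′ p
          ...   | inj₁ r = true≢false (proj₁ (proj₂ (R-elim r))) Sb
          ...   | inj₂ r with edge-sound a b b b′ r
          ...     | inj₁ (refl , _) = true≢false Sa Sb
          ...     | inj₂ (_ , refl) = true≢false Sa (trans Sb′ Sb)

    -- If a and c are on the same side, the other part of G is contracted to b.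
    module Contract (same : side a ≡ side c) where
      B K : Matrix (n G)
      B = R ∪ edge b c
      K = B ∪ edge a b

      a≢b : a ≢ b
      a≢b = distinct-ends ab
      c≢b : c ≢ b
      c≢b = outside≢inside Sc Sb

      B⊕ : B ≐ R ⊕ edge b c
      B⊕ = ∪-⊕ λ {s} {t} p q → absurd (R-elim p) (edge-sound b c s t q)
        where
          absurd : ∀ {s t} → A s t ≡ true × S s ≡ true × S t ≡ true → (s ≡ b × t ≡ c) ⊎ (s ≡ c × t ≡ b) → ⊥
          absurd (_ , p , q) (inj₁ (refl , _)) = true≢false p Sb
          absurd (_ , p , q) (inj₂ (_ , refl)) = true≢false q Sb

      K⊕ : K ≐ B ⊕ edge a b
      K⊕ = ∪-⊕ λ {s} {t} p q → absurd (⊕-cases B⊕ s t p) (edge-sound a b s t q)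
        where
          absurd : ∀ {s t} → R s t ≡ true ⊎ edge b c s t ≡ true → (s ≡ a × t ≡ b) ⊎ (s ≡ b × t ≡ a) → ⊥
          absurd (inj₁ r) (inj₁ (_ , refl)) = true≢false (proj₂ (proj₂ (R-elim r))) Sb
          absurd (inj₁ r) (inj₂ (refl , _)) = true≢false (proj₁ (proj₂ (R-elim r))) Sb
          absurd {s} {t} (inj₂ e) r with edge-sound b c s t e | r
          ... | inj₁ (refl , refl) | inj₁ (p , _) = a≢b (sym p)
          ... | inj₁ (refl , refl) | inj₂ (_ , p) = a≢c (sym p)
          ... | inj₂ (refl , refl) | inj₁ (p , _) = a≢c (sym p)
          ... | inj₂ (refl , refl) | inj₂ (p , _) = c≢b p

      total-K : total K ≡ total R + 4
      total-K = trans (total-⊕ K⊕) (trans (cong₂ _+_ (trans (total-⊕ B⊕) (cong (total R +_) (total-edge (≢-sym c≢b))))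
        (total-edge a≢b)) (+-assoc (total R) 2 2))

      K-cases : ∀ {s t} → K s t ≡ true → R s t ≡ true ⊎ ((s ≡ b × t ≡ c) ⊎ (s ≡ c × t ≡ b)) ⊎ ((s ≡ a × t ≡ b) ⊎ (s ≡ b × t ≡ a))
      K-cases {s} {t} e with ⊕-cases K⊕ s t e
      ... | inj₂ p = inj₂ (inj₂ (edge-sound a b s t p))
      ... | inj₁ p with ⊕-cases B⊕ s t p
      ...   | inj₁ r = inj₁ r
      ...   | inj₂ r = inj₂ (inj₁ (edge-sound b c s t r))

      K-R : ∀ {s t} → R s t ≡ true → K s t ≡ true
      K-R {s} {t} r = ⊕-left K⊕ s t (⊕-left B⊕ s t r)
      K-ab : K a b ≡ true
      K-ab = ⊕-right K⊕ a b (edge-left a b)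
      K-ba : K b a ≡ true
      K-ba = ⊕-right K⊕ b a (edge-right a b)
      K-bc : K b c ≡ true
      K-bc = ⊕-left K⊕ b c (⊕-right B⊕ b c (edge-left b c))
      K-cb : K c b ≡ true
      K-cb = ⊕-left K⊕ c b (⊕-right B⊕ c b (edge-right b c))

      K-sym : Symmetric K
      K-sym s t = cong₂ _∨_ (cong₂ _∨_ (restrict-sym {A = A} symA S s t) (edge-sym b c s t)) (edge-sym a b s t)

      K-ends : ∀ {s t} → K s t ≡ true → side s ≢ side t
      K-ends {s} {t} e with K-cases e
      ... | inj₁ r = bip s t (proj₁ (R-elim r))
      ... | inj₂ (inj₁ (inj₁ (refl , refl))) = λ q → bip a b ab (trans same (sym q))
      ... | inj₂ (inj₁ (inj₂ (refl , refl))) = λ q → bip a b ab (trans same q)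
      ... | inj₂ (inj₂ (inj₁ (refl , refl))) = bip a b ab
      ... | inj₂ (inj₂ (inj₂ (refl , refl))) = ≢-sym (bip a b ab)

      K-irr : Irreflexive K
      K-irr s = ¬-not λ e → K-ends {s} {s} e refl

      P : V → Bool
      P s = S s ∨ (s == b)

      support : ∀ s t → K s t ≡ true → P s ≡ true
      support s t e with K-cases {s} {t} e
      ... | inj₁ r = ∨-introˡ (s == b) (proj₁ (proj₂ (R-elim r)))
      ... | inj₂ (inj₁ (inj₁ (refl , _))) = ∨-introʳ (S b) (==-refl b)
      ... | inj₂ (inj₁ (inj₂ (refl , _))) = ∨-introˡ (c == b) Sc
      ... | inj₂ (inj₂ (inj₁ (refl , _))) = ∨-introˡ (a == b) Sa
      ... | inj₂ (inj₂ (inj₂ (refl , _))) = ∨-introʳ (S b) (==-refl b)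

      ρ : V → V
      ρ s = if S s then s else b

      ρ-in : ∀ {s} → S s ≡ true → ρ s ≡ s
      ρ-in {s} e = cong (if_then s else b) e
      ρ-out : ∀ {s} → S s ≡ false → ρ s ≡ b
      ρ-out {s} e = cong (if_then s else b) e
      ρ-P : ∀ {s} → P s ≡ true → ρ s ≡ s
      ρ-P {s} e with ∨-elim {S s} e
      ... | inj₁ p = ρ-in p
      ... | inj₂ p with ==-sound {u = s} {b} p
      ...   | refl = ρ-out Sb

      ρ-fibre : ∀ {s s′} → ρ s ≡ ρ s′ → s ≡ s′ ⊎ (S s ≡ false × S s′ ≡ false)
      ρ-fibre {s} {s′} e with true⊎false (S s) | true⊎false (S s′)
      ... | inj₁ p | inj₁ q = inj₁ (trans (sym (ρ-in p)) (trans e (ρ-in q)))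
      ... | inj₂ p | inj₂ q = inj₂ (p , q)
      ... | inj₁ p | inj₂ q = contradiction Sb (true≢false (subst (λ x → S x ≡ true) (trans (sym (ρ-in p)) (trans e (ρ-out q))) p))
      ... | inj₂ p | inj₁ q = contradiction Sb (true≢false (subst (λ x → S x ≡ true) (trans (sym (ρ-in q)) (trans (sym e) (ρ-out p))) q))

      -- As `a ≢ c`, no vertex of `S` meets both cut edges, so the contraction creates no parallel
      -- edges.
      partner : ∀ {s t t′} → A s t ≡ true → A s t′ ≡ true → S s ≡ true → S t ≡ false → S t′ ≡ false → t ≡ t′
      partner e e′ p q q′ with exhaust e p q | exhaust e′ p q′
      ... | inj₁ (_ , r) | inj₁ (_ , r′) = trans r (sym r′)
      ... | inj₂ (_ , r) | inj₂ (_ , r′) = trans r (sym r′)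
      ... | inj₁ (r , _) | inj₂ (r′ , _) = contradiction (trans (sym r) r′) a≢c
      ... | inj₂ (r , _) | inj₁ (r′ , _) = contradiction (trans (sym r′) r) a≢c

      opaque
        -- A cut of the contracted graph is pulled back along `ρ`. The two cut edges found in G do
        -- not lie inside the contracted part, and `ρ` keeps them apart.
        K-bridgeless : BridgelessOn P K
        K-bridgeless X (x , Px , Xx) (y , Py , Xy)
          with two-entries _ (cuts (X ∘ ρ) {x} {y} (trans (cong X (ρ-P Px)) Xx) (trans (cong X (ρ-P Py)) Xy))
        ... | two {p} {q} {p′} {q′} e e′ ne = total≥2 (cut K X) (image e) (image e′) λ (r , r′) → ne (injective e′ e r r′)
          where
            not-both-out : ∀ {s t} → cut A (X ∘ ρ) s t ≡ true → S s ≡ false → S t ≡ false → ⊥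
            not-both-out {s} {t} e p q with cut-sound A (X ∘ ρ) {s} {t} e
            ... | _ , Xs , Xt = true≢false (trans (cong X (trans (ρ-out q) (sym (ρ-out p)))) Xs) Xt

            lift : ∀ {s t} → A s t ≡ true → (S s ≡ false → S t ≡ false → ⊥) → K (ρ s) (ρ t) ≡ true
            lift {s} {t} e nb with true⊎false (S s) | true⊎false (S t)
            ... | inj₂ p | inj₂ q = ⊥-elim (nb p q)
            ... | inj₁ p | inj₁ q = subst₂ (λ s t → K s t ≡ true) (sym (ρ-in p)) (sym (ρ-in q)) (K-R (restrict-intro A S e p q))
            ... | inj₁ p | inj₂ q with exhaust e p q
            ...   | inj₁ (refl , refl) = subst₂ (λ s t → K s t ≡ true) (sym (ρ-in p)) (sym (ρ-out q)) K-ab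
            ...   | inj₂ (refl , refl) = subst₂ (λ s t → K s t ≡ true) (sym (ρ-in p)) (sym (ρ-out q)) K-cb
            lift {s} {t} e nb | inj₂ p | inj₁ q with exhaust (flipped e) q p
            ...   | inj₁ (refl , refl) = subst₂ (λ s t → K s t ≡ true) (sym (ρ-out p)) (sym (ρ-in q)) K-ba
            ...   | inj₂ (refl , refl) = subst₂ (λ s t → K s t ≡ true) (sym (ρ-out p)) (sym (ρ-in q)) K-bc

            image : ∀ {s t} → cut A (X ∘ ρ) s t ≡ true → cut K X (ρ s) (ρ t) ≡ true
            image {s} {t} e = let a , Xs , Xt = cut-sound A (X ∘ ρ) {s} {t} e
                              in cut-intro K X (lift a (not-both-out {s} {t} e)) Xs Xt

            injective : ∀ {s t s′ t′} → cut A (X ∘ ρ) s t ≡ true → cut A (X ∘ ρ) s′ t′ ≡ true →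
              ρ s ≡ ρ s′ → ρ t ≡ ρ t′ → s ≡ s′ × t ≡ t′
            injective {s} {t} {s′} {t′} e e′ r r′ with ρ-fibre r | ρ-fibre r′
            ... | inj₁ p | inj₁ q = p , q
            ... | inj₂ (p , _) | inj₂ (q , _) = ⊥-elim (not-both-out {s} {t} e p q)
            ... | inj₁ refl | inj₂ (q , q′) = refl ,
                  partner (proj₁ (cut-sound A (X ∘ ρ) {s} {t} e)) (proj₁ (cut-sound A (X ∘ ρ) {s} {t′} e′))
                    (¬-not λ p → not-both-out {s} {t} e p q) q q′
            ... | inj₂ (p , p′) | inj₁ refl =
                  partner (flipped (proj₁ (cut-sound A (X ∘ ρ) {s} {t} e))) (flipped (proj₁ (cut-sound A (X ∘ ρ) {s′} {t} e′)))
                    (¬-not λ q → not-both-out {s} {t} e p q) p p′ , refl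

        half : ¬ ¬ HalfGood R a c
        half none = small-good fewer-edges K P K-sym K-irr (side , λ s t → K-ends) support K-bridgeless
          (subst (_< total A) (trans total-Y (sym total-K)) Y<A)
          -- The path `a b c` of `K` stands for the other side: its edge `a b` is made invisible,
          -- and `contract` then absorbs `b c`.
          λ good → none (contract a≢b c≢b B⊕ (λ t → ¬-not λ r → true≢false (proj₁ (proj₂ (R-elim r))) Sb)
            (λ t → ¬-not λ r → true≢false (proj₂ (proj₂ (R-elim r))) Sb) (remove-edge a≢b K⊕ good))

    -- Otherwise the other part of G is replaced by an edge joining a and c, which A may already contain.
    module Chord (opp : side a ≢ side c) (w : V) (Sw : S w ≡ true) (w≢a : w ≢ a) (w≢c : w ≢ c) where

      -- The chord `e e′` is one edge of the cut `X`. Its end `e` is chosen on the same side of `X`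
      -- as `w`, so, as `e` is no cut vertex, an edge avoiding `e` leaves the part of `S` on that
      -- side. It starts at neither end of the chord, hence stays inside `S` and is a second edge of
      -- the cut.
      second-pair : ∀ {K : Matrix (n G)} → R ⊆ K → ∀ X e e′ → S e ≡ true → S e′ ≡ true → e′ ≢ e →
        (∀ {s t} → A s t ≡ true → S s ≡ true → s ≢ e → s ≢ e′ → S t ≡ true) →
        K e e′ ≡ true → K e′ e ≡ true → X e′ ≢ X e → X w ≡ X e → w ≢ e → 2 ≤ total (cut K X)
      second-pair {K} R⊆K X e e′ Se Se′ e′≢e stays Kee′ Ke′e differ Xw w≢e
        with no-cut-vertex e (λ s → S s ∧ agrees (X s) (X e)) {w} {e′} w≢e (∧-intro Sw (agrees-≡ Xw)) e′≢e
               (¬-not λ r → differ (agrees-sound (proj₂ (∧-true {S e′} r))))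
      ... | s , t , s≢e , t≢e , a , p , q with ∧-true {S s} p
      ...   | Ss , Xs with true⊎false (X e)
      ...     | inj₁ Xe = total≥2 (cut K X) (cut-intro K X Kee′ Xe (opposite (≢-sym differ) Xe))
                (cut-intro K X (R⊆K s t (restrict-intro A S a Ss St)) X-s X-t) λ { (refl , _) → s≢e refl }
        where
          X-s : X s ≡ true
          X-s = trans (agrees-sound Xs) Xe
          St : S t ≡ true
          St = stays a Ss s≢e λ { refl → differ (trans X-s (sym Xe)) }
          X-t : X t ≡ false
          X-t = opposite (λ eq → true≢false (∧-intro St (agrees-≡ (sym eq))) q) Xe
      ...     | inj₂ Xe = total≥2 (cut K X) (cut-intro K X Ke′e (opposite′ (≢-sym differ) Xe) Xe)
                (cut-intro K X (R⊆K t s (restrict-intro A S (flipped a) St Ss)) X-t X-s) λ { (_ , refl) → s≢e refl }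
        where
          X-s : X s ≡ false
          X-s = trans (agrees-sound Xs) Xe
          St : S t ≡ true
          St = stays a Ss s≢e λ { refl → differ (trans X-s (sym Xe)) }
          X-t : X t ≡ true
          X-t = opposite′ (λ eq → true≢false (∧-intro St (agrees-≡ (sym eq))) q) Xe

      opaque
        -- If `X` agrees on `a` and `c`, it extends by this value over the other side without
        -- gaining cut edges. Otherwise the chord is cut, and the third vertex `w` lies on the side
        -- of one of its ends.
        chord-bridgeless : ∀ {K : Matrix (n G)} → R ⊆ K → K a c ≡ true → K c a ≡ true → BridgelessOn S K
        chord-bridgeless {K} R⊆K Kac Kca X (x , Sx , Xx) (y , Sy , Xy) with X a Boolₚ.≟ X c
        ... | yes eq = ≤-trans (cuts X′ {x} {y} (trans (in-S Sx) Xx) (trans (in-S Sy) Xy)) (total-mono sub)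
          where
            X′ : V → Bool
            X′ s = if S s then X s else X a
            in-S : ∀ {s} → S s ≡ true → X′ s ≡ X s
            in-S {s} e = cong (if_then X s else X a) e
            out-S : ∀ {s} → S s ≡ false → X′ s ≡ X a
            out-S {s} e = cong (if_then X s else X a) e
            across : ∀ {s t} → A s t ≡ true → S s ≡ true → S t ≡ false → X′ s ≡ X′ t
            across e p q with exhaust e p q
            ... | inj₁ (refl , refl) = trans (in-S p) (sym (out-S q))
            ... | inj₂ (refl , refl) = trans (in-S p) (trans (sym eq) (sym (out-S q)))
            sub : cut A X′ ⊆ cut K X
            sub s t e with cut-sound A X′ {s} {t} e
            ... | a , p , q with true⊎false (S s) | true⊎false (S t)
            ...   | inj₁ Ss | inj₁ St = cut-intro K X (R⊆K s t (restrict-intro A S a Ss St))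
                      (trans (sym (in-S Ss)) p) (trans (sym (in-S St)) q)
            ...   | inj₁ Ss | inj₂ St = contradiction (trans (sym (across a Ss St)) p) (not-¬ q)
            ...   | inj₂ Ss | inj₁ St = contradiction (trans (across (flipped a) St Ss) p) (not-¬ q)
            ...   | inj₂ Ss | inj₂ St = contradiction (trans (trans (out-S St) (sym (out-S Ss))) p) (not-¬ q)
        ... | no ne with X w Boolₚ.≟ X a
        ...   | yes Xw = second-pair R⊆K X a c Sa Sc (≢-sym a≢c) stays Kac Kca (≢-sym ne) Xw w≢a
          where
            stays : ∀ {s t} → A s t ≡ true → S s ≡ true → s ≢ a → s ≢ c → S t ≡ true
            stays e p s≢a s≢c = ¬-not λ q → [ s≢a ∘ proj₁ , s≢c ∘ proj₁ ]′ (exhaust e p q)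
        ...   | no Xw = second-pair R⊆K X c a Sc Sa a≢c stays Kca Kac ne (trans (¬-not Xw) (sym (¬-not (≢-sym ne)))) w≢c
          where
            stays : ∀ {s t} → A s t ≡ true → S s ≡ true → s ≢ c → s ≢ a → S t ≡ true
            stays e p s≢c s≢a = ¬-not λ q → [ s≢a ∘ proj₁ , s≢c ∘ proj₁ ]′ (exhaust e p q)

        half : ¬ ¬ HalfGood R a c
        half none with true⊎false (A a c)
        -- The chord is already an edge of `R`, so `R` itself is the bridgeless graph to be
        -- coloured, and one arc of that edge is recoloured afterwards.
        ... | inj₁ ac = small-good fewer-edges R S (restrict-sym {A = A} symA S) (restrict-irrefl {A = A} irrA S)
                (side , λ s t r → bip s t (proj₁ (R-elim r))) (λ s t r → proj₁ (proj₂ (R-elim r)))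
                (chord-bridgeless (λ _ _ r → r) Rac (restrict-intro A S (flipped ac) Sc Sa))
                (≤-trans (s≤s (≤-trans (m≤m+n (total R) 4) (≤-reflexive (sym total-Y)))) Y<A)
                λ good → none (recolour-arc (restrict-irrefl {A = A} irrA S) good Rac)
          where
            Rac : R a c ≡ true
            Rac = restrict-intro A S ac Sa Sc
        ... | inj₂ ¬ac = small-good fewer-edges K S K-sym (λ s → ¬-not λ e → K-ends {s} {s} e refl)
                (side , λ s t → K-ends) support
                (chord-bridgeless (⊕-left K⊕) (⊕-right K⊕ a c (edge-left a c)) (⊕-right K⊕ c a (edge-right a c)))
                (≤-trans (s≤s (≤-trans (≤-reflexive total-K) (≤-trans (+-monoʳ-≤ (total R) (s≤s (s≤s z≤n))) (≤-reflexive (sym total-Y))))) Y<A)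
                λ good → none (remove-edge a≢c K⊕ good)
          where
            K : Matrix (n G)
            K = R ∪ edge a c
            K⊕ : K ≐ R ⊕ edge a c
            K⊕ = ∪-⊕ λ {s} {t} p q → absurd (proj₁ (R-elim p)) (edge-sound a c s t q)
              where
                absurd : ∀ {s t} → A s t ≡ true → (s ≡ a × t ≡ c) ⊎ (s ≡ c × t ≡ a) → ⊥
                absurd e (inj₁ (refl , refl)) = true≢false e ¬ac
                absurd e (inj₂ (refl , refl)) = true≢false (flipped e) ¬ac
            total-K : total K ≡ total R + 2
            total-K = trans (total-⊕ K⊕) (cong (total R +_) (total-edge a≢c))
            K-sym : Symmetric K
            K-sym s t = cong₂ _∨_ (restrict-sym {A = A} symA S s t) (edge-sym a c s t)
            K-ends : ∀ {s t} → K s t ≡ true → side s ≢ side t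
            K-ends {s} {t} e with ⊕-cases K⊕ s t e
            ... | inj₁ r = bip s t (proj₁ (R-elim r))
            ... | inj₂ r with edge-sound a c s t r
            ...   | inj₁ (refl , refl) = opp
            ...   | inj₂ (refl , refl) = ≢-sym opp
            support : ∀ s t → K s t ≡ true → S s ≡ true
            support s t e with ⊕-cases K⊕ s t e
            ... | inj₁ r = proj₁ (proj₂ (R-elim r))
            ... | inj₂ r with edge-sound a c s t r
            ...   | inj₁ (refl , _) = Sa
            ...   | inj₂ (refl , _) = Sc

    opaque
      half : ¬ ¬ HalfGood R a c
      half none with side a Boolₚ.≟ side c
      ... | yes same = Contract.half same none
      ... | no opp with any? (λ w → (S w Boolₚ.≟ true) ×-dec ¬? (w Fin.≟ a) ×-dec ¬? (w Fin.≟ c))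
      ...   | yes (w , Sw , w≢a , w≢c) = Chord.half opp w Sw w≢a w≢c none
      -- With no third vertex the side consists of the edge `a c` alone. The chord construction
      -- would leave a bridge, so the half is coloured directly.
      ...   | no only = none (half-edge a≢c R≡)
        where
          ends : ∀ {s} → S s ≡ true → s ≡ a ⊎ s ≡ c
          ends {s} Ss with s Fin.≟ a | s Fin.≟ c
          ... | yes p | _ = inj₁ p
          ... | no _ | yes q = inj₂ q
          ... | no p | no q = contradiction (s , Ss , p , q) only
          ac : A a c ≡ true
          ac with inner a
          ... | u , e , Su with ends (trans Su Sa)
          ...   | inj₁ refl = contradiction refl (distinct-ends e)
          ...   | inj₂ refl = e
          R≡ : ∀ s t → R s t ≡ edge a c s t
          R≡ s t with true⊎false (edge a c s t)
          ... | inj₁ e with edge-sound a c s t e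
          ...   | inj₁ (refl , refl) = trans (restrict-intro A S ac Sa Sc) (sym e)
          ...   | inj₂ (refl , refl) = trans (restrict-intro A S (flipped ac) Sc Sa) (sym e)
          R≡ s t | inj₂ e = trans (¬-not λ r → go (R-elim r)) (sym e)
            where
              go : A s t ≡ true × S s ≡ true × S t ≡ true → ⊥
              go (x , p , q) with ends p | ends q
              ... | inj₁ refl | inj₁ refl = distinct-ends x refl
              ... | inj₂ refl | inj₂ refl = distinct-ends x refl
              ... | inj₁ refl | inj₂ refl = true≢false (edge-left a c) e
              ... | inj₂ refl | inj₁ refl = true≢false (edge-right a c) e

  opaque
    -- If both cut edges met at `a`, then `a` would separate its neighbour within `S` from `b`.
    ends-distinct : ∀ {S a b c d} → TwoCut S a b c d → Inner S → a ≢ c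
    ends-distinct {S} {a} {b} two-cut inner refl with inner a
    ... | a′ , e , Sa′ with no-cut-vertex a (λ s → S s ∧ not (s == a)) {a′} {b}
            (≢-sym (distinct-ends e)) (∧-intro (trans Sa′ Sa) (not-false (==-≢ (≢-sym (distinct-ends e)))))
            (≢-sym (distinct-ends ab)) (cong (_∧ not (b == a)) Sb)
      where open TwoCut two-cut
    ... | s , t , s≢a , t≢a , x , p , q = [ s≢a ∘ proj₁ , s≢a ∘ proj₁ ]′ (exhaust x (proj₁ (∧-true p)) St)
      where
        open TwoCut two-cut
        St : S t ≡ false
        St = ¬-not λ St → true≢false (∧-intro St (not-false (==-≢ t≢a))) q

    -- When every vertex has a neighbour on its own side, both sides have half colourings, which
    -- would glue to a good colouring of G.
    two-cuts-trivial : ∀ S {x y} → S x ≡ true → S y ≡ false → total (cut A S) ≤ 2 → TrivialCut G S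
    two-cuts-trivial S {x} {y} Sx Sy le
      with any? (λ z → ¬? (any? (λ u → (A z u Boolₚ.≟ true) ×-dec (S u Boolₚ.≟ S z))))
    ... | yes (z , none) = z , λ u e → ¬-not λ same → none (u , e , same)
    ... | no nontrivial with two-entries (cut A S) (cuts S {x} {y} Sx Sy)
    ...   | two {a} {b} {c} {d} e e′ ne =
      ⊥-elim (Half.half two-cut a≢c b≢d inner λ half →
        Half.half (complement two-cut) b≢d a≢c (inner-complement inner) λ half′ →
        not-both-halves two-cut (a≢c ∘ proj₁) half half′)
      where
        inner : Inner S
        inner z = decidable-stable (any? (λ u → (A z u Boolₚ.≟ true) ×-dec (S u Boolₚ.≟ S z))) λ none → nontrivial (z , none)
        two-cut : TwoCut S a b c d
        two-cut = record
          { Sa = proj₁ (proj₂ (cut-sound A S {a} {b} e)) ; Sb = proj₂ (proj₂ (cut-sound A S {a} {b} e))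
          ; Sc = proj₁ (proj₂ (cut-sound A S {c} {d} e′)) ; Sd = proj₂ (proj₂ (cut-sound A S {c} {d} e′))
          ; ab = proj₁ (cut-sound A S {a} {b} e) ; cd = proj₁ (cut-sound A S {c} {d} e′)
          ; exhaust = λ {s} {t} x p q → two-exhaust (cut A S) le e e′ ne {s} {t} (cut-intro A S x p q) }
        a≢c : a ≢ c
        a≢c = ends-distinct two-cut inner
        b≢d : b ≢ d
        b≢d = ends-distinct (complement two-cut) (inner-complement inner)

  -- Vertices of degree two

  module DegreeTwo (v u w : V) (u≢w : u ≢ w) (vu : A v u ≡ true) (vw : A v w ≡ true)
                   (only : ∀ x → A v x ≡ true → x ≡ u ⊎ x ≡ w) where
    Q : V → Bool
    Q s = not (s == v)

    Q-v : Q v ≡ false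
    Q-v = cong not (==-refl v)

    Q-other : ∀ {s} → s ≢ v → Q s ≡ true
    Q-other ne = not-false (==-≢ ne)

    other-Q : ∀ {s} → Q s ≡ true → s ≢ v
    other-Q e refl = true≢false e Q-v

    K : Matrix (n G)
    K = restrict A Q

    opaque
      -- Moving v to the side of u gives a 2-cut, whose trivial component can only be w.
      bridge-end : ∀ S {y z p q} → A v y ≡ true → (∀ x → A v x ≡ true → x ≡ y ⊎ x ≡ z) → S y ≡ true → S z ≡ false → z ≢ v →
        (∀ {s t} → Crossing S v s t → s ≡ p × t ≡ q) → q ≡ z
      bridge-end S {y} {z} {p} {q} vy only′ Sy Sz z≢v unique = conclude
        (two-cuts-trivial S′ {y} {z} (∨-introˡ (y == v) Sy) (trans (cong (S z ∨_) (==-≢ z≢v)) (trans (Boolₚ.∨-identityʳ (S z)) Sz))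
          (total≤2 (cut A S′) {v} {z} {p} {q} λ {s} {t} → cover {s} {t}))
        where
          S′ : V → Bool
          S′ s = S s ∨ (s == v)
          S′-v : S′ v ≡ true
          S′-v = ∨-introʳ (S v) (==-refl v)
          off : ∀ {t} → S′ t ≡ false → t ≢ v × S t ≡ false
          off {t} e = (λ { refl → true≢false S′-v e }) , ¬-not λ St → true≢false (∨-introˡ (t == v) St) e
          on : ∀ {s} → S′ s ≡ true → s ≢ v → S s ≡ true
          on {s} e ne with ∨-elim {S s} e
          ... | inj₁ Ss = Ss
          ... | inj₂ r = contradiction (==-sound r) ne
          cover : ∀ {s t} → cut A S′ s t ≡ true → (s ≡ v × t ≡ z) ⊎ (s ≡ p × t ≡ q)
          cover {s} {t} e with cut-sound A S′ {s} {t} e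
          ... | a , Ss , St = decide (s Fin.≟ v) (off {t} St)
            where
              decide : Dec (s ≡ v) → t ≢ v × S t ≡ false → (s ≡ v × t ≡ z) ⊎ (s ≡ p × t ≡ q)
              decide (no s≢v) (t≢v , St′) = inj₂ (unique (s≢v , t≢v , a , on {s} Ss s≢v , St′))
              decide (yes refl) (_ , St′) with only′ t a
              ... | inj₁ refl = contradiction St′ (true≢false Sy)
              ... | inj₂ refl = inj₁ (refl , refl)
          conclude : TrivialCut G S′ → q ≡ z
          -- The vertex `r` has at least two edges, all in the cut, whose only edges are `v z` and
          -- `p q`. Inside `S′` this is impossible: `r` is not `v`, as the edge `v y` is not cut,
          -- and any other vertex meets at most one cut edge from within. Outside, both cut edges
          -- end at `r`, so `q` and `z` coincide.
          conclude (r , across) with two-neighbours r | true⊎false (S′ r)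
          ... | t , t′ , e , e′ , ne | inj₁ Sr = go (r Fin.≟ v)
            where
              cross : ∀ {t} → A r t ≡ true → cut A S′ r t ≡ true
              cross {t} e = cut-intro A S′ e Sr (trans (across t e) (cong not Sr))
              go : Dec (r ≡ v) → q ≡ z
              go (yes refl) = contradiction (trans (across y vy) (cong not Sr)) (true≢false (∨-introˡ (y == v) Sy))
              go (no r≢v) with cover {r} {t} (cross e) | cover {r} {t′} (cross e′)
              ... | inj₁ (r≡v , _) | _ = contradiction r≡v r≢v
              ... | inj₂ _ | inj₁ (r≡v , _) = contradiction r≡v r≢v
              ... | inj₂ (_ , x) | inj₂ (_ , x′) = contradiction (trans x′ (sym x)) ne
          ... | t , t′ , e , e′ , ne | inj₂ Sr with cover {t} {r} (cross e) | cover {t′} {r} (cross e′)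
            where
              cross : ∀ {t} → A r t ≡ true → cut A S′ t r ≡ true
              cross {t} e = cut-intro A S′ (flipped e) (trans (across t e) (cong not Sr)) Sr
          ...   | inj₁ (x , _) | inj₁ (x′ , _) = contradiction (trans x′ (sym x)) ne
          ...   | inj₂ (x , _) | inj₂ (x′ , _) = contradiction (trans x′ (sym x)) ne
          ...   | inj₁ (_ , x) | inj₂ (_ , x′) = trans (sym x′) x
          ...   | inj₂ (_ , x) | inj₁ (_ , x′) = trans (sym x) x′

      -- If only one edge of G - v crossed, `bridge-end` applied to `S` and to its complement would
      -- show that it joins `z` and `y`. As neighbours of `v`, these lie in the same class.
      separated : ∀ S {y z} → A v y ≡ true → A v z ≡ true → (∀ x → A v x ≡ true → x ≡ y ⊎ x ≡ z) →
        S y ≡ true → S z ≡ false → 2 ≤ total (cut K S)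
      separated S {y} {z} vy vz only′ Sy Sz = decidable-stable (2 ℕ.≤? _) λ small → go small
        (no-cut-vertex v S {y} {z} (≢-sym (distinct-ends vy)) Sy (≢-sym (distinct-ends vz)) Sz)
        where
          go : ¬ 2 ≤ total (cut K S) → ∃[ p ] ∃[ q ] Crossing S v p q → ⊥
          go small (p , q , c@(p≢v , q≢v , pq , Sp , Sq)) = bip y z
            (subst₂ (λ s t → A s t ≡ true) p≡y q≡z pq) sides
            where
              entry : ∀ {s t} → Crossing S v s t → cut K S s t ≡ true
              entry (s≢v , t≢v , a , Ss , St) = cut-intro K S (restrict-intro A Q a (Q-other s≢v) (Q-other t≢v)) Ss St
              unique : ∀ {s t} → Crossing S v s t → s ≡ p × t ≡ q
              unique {s} {t} c′ = decidable-stable ((s Fin.≟ p) ×-dec (t Fin.≟ q)) λ ne →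
                small (total≥2 (cut K S) (entry c) (entry c′) ne)
              q≡z : q ≡ z
              q≡z = bridge-end S vy only′ Sy Sz (≢-sym (distinct-ends vz)) unique
              p≡y : p ≡ y
              p≡y = bridge-end (not ∘ S) vz (λ x e → [ inj₂ , inj₁ ]′ (only′ x e)) (not-false Sz) (cong not Sy)
                (≢-sym (distinct-ends vy)) λ (s≢v , t≢v , a , Ss , St) →
                  let x , x′ = unique (t≢v , s≢v , flipped a , Boolₚ.not-injective St , not-true Ss) in x′ , x
              sides : side y ≡ side z
              sides = trans (¬-not (≢-sym (bip v y vy))) (sym (¬-not (≢-sym (bip v z vz))))

      -- Placing `v` on the common side of its neighbours keeps both of its edges out of the cut.
      together : ∀ S {x y} → x ≢ v → S x ≡ true → y ≢ v → S y ≡ false → S u ≡ S w → 2 ≤ total (cut K S)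
      together S {x} {y} x≢v Sx y≢v Sy eq = ≤-trans (cuts S′ {x} {y} (trans (same x≢v) Sx) (trans (same y≢v) Sy)) (total-mono sub)
        where
          S′ : V → Bool
          S′ s = if s == v then S u else S s
          same : ∀ {s} → s ≢ v → S′ s ≡ S s
          same {s} ne = cong (if_then S u else S s) (==-≢ ne)
          at-v : S′ v ≡ S u
          at-v = cong (if_then S u else S v) (==-refl v)
          constant : ∀ {t} → A v t ≡ true → S′ t ≡ S′ v
          constant {t} e with only t e
          ... | inj₁ refl = trans (same (≢-sym (distinct-ends e))) (sym at-v)
          ... | inj₂ refl = trans (same (≢-sym (distinct-ends e))) (trans (sym eq) (sym at-v))
          sub : cut A S′ ⊆ cut K S
          sub s t e with cut-sound A S′ {s} {t} e
          ... | a , p , q = decide (s Fin.≟ v) (t Fin.≟ v)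
            where
              decide : Dec (s ≡ v) → Dec (t ≡ v) → cut K S s t ≡ true
              decide (yes refl) _ = contradiction (trans (constant a) p) (not-¬ q)
              decide (no _) (yes refl) = contradiction (trans (sym (constant (flipped a))) p) (not-¬ q)
              decide (no s≢v) (no t≢v) = cut-intro K S (restrict-intro A Q a (Q-other s≢v) (Q-other t≢v))
                (trans (sym (same s≢v)) p) (trans (sym (same t≢v)) q)

      K-bridgeless : BridgelessOn Q K
      K-bridgeless S (x , Qx , Sx) (y , Qy , Sy) with true⊎false (S u) | true⊎false (S w)
      ... | inj₁ Su | inj₂ Sw = separated S vu vw only Su Sw
      ... | inj₂ Su | inj₁ Sw = separated S vw vu (λ x e → [ inj₂ , inj₁ ]′ (only x e)) Sw Su
      ... | inj₁ Su | inj₁ Sw = together S (other-Q Qx) Sx (other-Q Qy) Sy (trans Su (sym Sw))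
      ... | inj₂ Su | inj₂ Sw = together S (other-Q Qx) Sx (other-Q Qy) Sy (trans Su (sym Sw))

      K-good : ¬ ¬ Good K
      K-good = small-good fewer-edges K Q (restrict-sym {A = A} symA Q) (restrict-irrefl {A = A} irrA Q)
        (side , λ s t e → bip s t (proj₁ (restrict-elim A Q e))) (λ s t e → proj₁ (proj₂ (restrict-elim A Q e))) K-bridgeless
        (total-strict K A {v} {u} (λ s t e → proj₁ (restrict-elim A Q e))
          (¬-not λ e → true≢false (proj₁ (proj₂ (restrict-elim A Q {v} {u} e))) Q-v) vu)

      -- The path `y v z` realises the invisible path, with `v` alone as the second half.
      no-half : ∀ {y z} → y ≢ z → A v y ≡ true → A v z ≡ true → (∀ x → A v x ≡ true → x ≡ y ⊎ x ≡ z) → ¬ HalfGood K y z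
      no-half {y} {z} y≢z vy vz only′ half = not-both-halves two-cut (y≢z ∘ proj₁) half
        (half-empty v λ s t → ¬-not λ e → let a , p , q = restrict-elim A (not ∘ Q) {s} {t} e
          in distinct-ends a (trans (is-v {s} p) (sym (is-v {t} q))))
        where
          is-v : ∀ {s} → not (Q s) ≡ true → s ≡ v
          is-v {s} e = ==-sound (trans (sym (not-involutive (s == v))) e)
          two-cut : TwoCut Q y v z v
          two-cut = record
            { Sa = Q-other (≢-sym (distinct-ends vy)) ; Sb = Q-v ; Sc = Q-other (≢-sym (distinct-ends vz)) ; Sd = Q-v
            ; ab = flipped vy ; cd = flipped vz ; exhaust = exhaust }
            where
              exhaust : ∀ {s t} → A s t ≡ true → Q s ≡ true → Q t ≡ false → (s ≡ y × t ≡ v) ⊎ (s ≡ z × t ≡ v)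
              exhaust {s} {t} a p q with is-v {t} (not-false q)
              ... | refl with only′ s (flipped a)
              ...   | inj₁ e = inj₁ (e , refl)
              ...   | inj₂ e = inj₂ (e , refl)

      -- In a good colouring of G - v some colour passes through `x` from one neighbour of `v` to
      -- the other; recolouring these two arcs would give the half colouring excluded by `no-half`.
      no-common-neighbour : ∀ x → A u x ≡ true → A w x ≡ true → x ≡ v
      no-common-neighbour x ux wx = decidable-stable (x Fin.≟ v) λ x≢v → K-good λ good → go x≢v good
        where
          module _ (x≢v : x ≢ v) where
            K-to : ∀ {y} → A y x ≡ true → A v y ≡ true → K y x ≡ true
            K-to yx vy = restrict-intro A Q yx (Q-other (≢-sym (distinct-ends vy))) (Q-other x≢v)
            K-from : ∀ {y} → A y x ≡ true → A v y ≡ true → K x y ≡ true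
            K-from yx vy = restrict-intro A Q (flipped yx) (Q-other x≢v) (Q-other (≢-sym (distinct-ends vy)))
            degree-K : size (K x) ≤ 3
            degree-K = ≤-trans (sum-mono {n G} λ t → b2n-mono λ e → proj₁ (restrict-elim A Q {x} {t} e)) (degree≤3 x)
            irrK : Irreflexive K
            irrK = restrict-irrefl {A = A} irrA Q
            go : ¬ Good K
            go good with Transition.passes (restrict-sym {A = A} symA Q) good degree-K u≢w (K-from ux vu) (K-from wx vw)
            ... | inj₁ e = no-half u≢w vu vw only (recolour-path irrK good u≢w (K-to ux vu) (K-from wx vw) e)
            ... | inj₂ e = no-half (≢-sym u≢w) vw vu (λ y e → [ inj₂ , inj₁ ]′ (only y e))
                  (recolour-path irrK good (≢-sym u≢w) (K-to wx vw) (K-from ux vu) e)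

  opaque
    neighbours-of-degree-2 : ∀ v → size (A v) ≡ 2 →
      ∃[ u ] ∃[ w ] (u ≢ w × A v u ≡ true × A v w ≡ true × (∀ x → A v x ≡ true → x ≡ u ⊎ x ≡ w))
    neighbours-of-degree-2 v deg with two-neighbours v
    ... | u , w , vu , vw , w≢u = u , w , ≢-sym w≢u , vu , vw , only
      where
        only : ∀ x → A v x ≡ true → x ≡ u ⊎ x ≡ w
        only x e with x Fin.≟ u | x Fin.≟ w
        ... | yes p | _ = inj₁ p
        ... | no _ | yes q = inj₂ q
        ... | no p | no q = contradiction (≤-reflexive deg) (<⇒≱ (member (A v) vu
          (member (without (A v) u) (without-intro (A v) vw w≢u)
            (member (without (without (A v) u) w) (without-intro (without (A v) u) (without-intro (A v) e p) q) z≤n))))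

theorem3p1 : (G : SimpleGraph) → MinimalCounterexample G →
    TwoConnected G
    × ((∃[ v ] degree G v ≡ 2) × (∀ v → 2 ≤ degree G v)
    × (∃[ v ] degree G v ≡ 3) × (∀ v → degree G v ≤ 3))
    × (∀ S → NonemptyProper G S → cutSize G S ≡ 2 → TrivialCut G S)
    × (∀ v → degree G v ≡ 2 → Bridgeless (delete G v))
    × (∀ v u w → u ≢ w → adj G v u ≡ true → adj G v w ≡ true
    → (∀ x → adj G v x ≡ true → x ≡ u ⊎ x ≡ w)
    → ∀ x → ((adj G u x ≡ true × adj G w x ≡ true) → x ≡ v)
    × (x ≡ v → adj G u x ≡ true × adj G w x ≡ true))
theorem3p1 G minimal =
    (order≥3 , connected G (λ S ((x , Sx) , (y , Sy)) → ≤-trans (s≤s z≤n) (cuts S {x} {y} Sx Sy)) ,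
      λ v → delete-connected G v (no-cut-vertex v))
  , ( (let v , e = some-degree-2 in v , trans (degree-out G v) e) , (λ v → subst (2 ≤_) (sym (degree-out G v)) (degree≥2 v))
    , (let v , e = some-degree-3 in v , trans (degree-out G v) e) , λ v → subst (_≤ 3) (sym (degree-out G v)) (degree≤3 v))
  , (λ S ((x , Sx) , (y , Sy)) e → two-cuts-trivial S {x} {y} Sx Sy (≤-reflexive (trans (sym (cutSize-total G S)) e)))
  , (λ v e → let u , w , u≢w , vu , vw , only = neighbours-of-degree-2 v (trans (sym (degree-out G v)) e)
             in delete-bridgeless G v (DegreeTwo.K-bridgeless v u w u≢w vu vw only))
  , λ v u w u≢w vu vw only x →
      (λ (ux , wx) → DegreeTwo.no-common-neighbour v u w u≢w vu vw only x ux wx) ,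
      λ { refl → flipped vu , flipped vw }
  where
    open Minimal G minimal
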